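{- Let $\Phi=(G,\varphi)$ be a finite complex unit gain graph of order $n$ (without loops and multiple edges). Then $r(\Phi)=r(G)+2\theta(G)$ if and only if all of the following hold: (i) the cycles (if any) of $G$ are pairwise vertex-disjoint; (ii) each cycle $C_p^{\varphi}$ of $\Phi$ is of Type B and has order $p\equiv 0 \pmod 4$; (iii) a series of $\delta$-transformations can transform $G$ into a crucial subgraph $G_0$ that is the disjoint union of $\theta(G)$ cycles together with some isolated vertices.
   Context: A complex unit gain graph $\Phi=(G,\varphi)$ consists of a finite simple graph $G$ (the underlying graph) with vertex set $\{v_1,\dots,v_n\}$ and a gain function $\varphi$ assigning to each oriented edge $e_{ij}$ (from $v_i$ to $v_j$, where $v_iv_j\in E(G)$) a complex number of modulus $1$, with $\varphi(e_{ji})=\overline{\varphi(e_{ij})}$. The adjacency matrix $A(\Phi)$ is the Hermitian matrix with $(i,j)$ entry $\varphi(e_{ij})$ if $v_iv_j\in E(G)$ and $0$ otherwise; $r(\Phi)$ is its rank, and $r(G)$ is the rank of the $0$-$1$ adjacency matrix of $G$. $\theta(G)=|E(G)|-|V(G)|+\omega(G)$, where $\omega(G)$ is the number of connected components. Subgraphs of $\Phi$ carry the gains of $\Phi$; a cycle $C_p^\varphi$ of $\Phi$ is a cycle of $G$ with its gains. For a gain cycle $C_p^{\varphi}$ with vertices $v_1,\dots,v_p$ in cyclic order, $\varphi(C_p)=\varphi(e_{12})\varphi(e_{23})\cdots\varphi(e_{p1})$; for $p$ even it is of Type B if $\varphi(C_p)\neq(-1)^{p/2}$. A $\delta$-transformation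 of a graph with a pendant vertex (vertex of degree $1$) deletes a pendant vertex together with its unique neighbour. A crucial subgraph of $G$ is a graph without pendant vertices obtained from $G$ by a series of $\delta$-transformations. -}

module Defs where

open import Algebra.Bundles using (CommutativeRing)
import Algebra.Properties.CommutativeMonoid.Sum as MonoidSum
import Algebra.Properties.Ring as RingProperties
import Algebra.Properties.Semiring.Exp as SemiringExp
import Algebra.Properties.Semiring.Sum as SemiringSum
import Algebra.Solver.Ring.NaturalCoefficients.Default as SemiringSolver
open import Data.Fin.Base as Fin using (Fin; zero; suc; toℕ)
import Data.Fin.Properties as Fin
open import Data.Fin.Subset
  using (Subset; inside; outside; _∈_; _∉_; _∩_; _-_; ∣_∣; ⊤; ⊥)
open import Data.Fin.Subset.Properties
  using (anySubset?; ∣p∣≤n; ∣⊥∣≡0; ∉⊥; drop-there)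
open import Data.Integer.Base using (ℤ; +_) renaming (_+_ to _+ℤ_; _-_ to _-ℤ_)
open import Data.List.Base
  using (List; []; _∷_; allFin; cartesianProduct; deduplicate; filter; length)
open import Data.List.Membership.Propositional using () renaming (_∈_ to _∈ˡ_)
open import Data.List.Membership.Propositional.Properties using (∈-allFin)
open import Data.List.Relation.Unary.Any using (here; there)
open import Data.Nat.Base as ℕ using (ℕ; zero; suc)
open import Data.Nat.DivMod using (_mod_)
import Data.Nat.Properties as ℕ
open import Data.Product.Base using (∃; ∃-syntax; _×_; _,_; proj₁; proj₂)
open import Data.Sum.Base using (_⊎_; inj₁; inj₂)
open import Data.Vec.Base as Vec using ([]; _∷_; here; there)
open import Data.Vec.Functional using (Vector)
import Data.Vec.Functional as V
open import Function.Base using (_∘_)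
open import Function.Bundles using (_⇔_; mk⇔)
open import Function.Definitions using (Injective)
open import Level using (Level; _⊔_; 0ℓ) renaming (suc to lsuc)
open import Relation.Binary.Construct.Closure.ReflexiveTransitive
  using (Star; ε; _◅_; _◅◅_; return)
open import Relation.Binary.Core using (Rel)
open import Relation.Binary.Definitions using (Decidable; Symmetric; Irreflexive; tri<; tri≈; tri>)
open import Relation.Binary.Structures using (IsStrictTotalOrder)
open import Relation.Binary.PropositionalEquality as ≡ using (_≡_; _≢_)
import Relation.Binary.Reasoning.Setoid as SetoidReasoning
open import Relation.Nullary using (¬_; Dec; yes; no; does; contradiction)
open import Relation.Nullary.Decidable as Dec using (_×-dec_; _⊎-dec_)
open import Relation.Unary using (Pred)

private
  variable
    c ℓ : Level
    m n : ℕ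

------------------------------------------------------------------------
-- Real and complex numbers

record DiscreteField c ℓ : Set (lsuc (c ⊔ ℓ)) where
  field
    commutativeRing : CommutativeRing c ℓ
  open CommutativeRing commutativeRing public
  field
    _≟_     : Decidable _≈_
    1≉0     : ¬ 1# ≈ 0#
    inverse : ∀ x → ¬ x ≈ 0# → ∃[ y ] x * y ≈ 1#

-- The real numbers, given by their characterisation as the complete ordered
-- field.  The order is the classical one, hence trichotomous, and `x ≤ y` is
-- spelled `¬ y < x`.

record Reals c ℓ : Set (lsuc (c ⊔ ℓ)) where
  infix 4 _<_
  field
    commutativeRing : CommutativeRing c ℓ
  open CommutativeRing commutativeRing public
  field
    _<_                : Rel Carrier ℓ
    isStrictTotalOrder : IsStrictTotalOrder _≈_ _<_
    0<1                : 0# < 1#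
    +-monoʳ-<          : ∀ x {y z} → y < z → x + y < x + z
    *-pos              : ∀ {x y} → 0# < x → 0# < y → 0# < x * y
    inverse            : ∀ x → ¬ x ≈ 0# → ∃[ y ] x * y ≈ 1#

  UpperBound : Pred Carrier ℓ → Pred Carrier (c ⊔ ℓ)
  UpperBound P b = ∀ {x} → P x → ¬ b < x

  field
    supremum : (P : Pred Carrier ℓ) → ∃ P → ∃ (UpperBound P) →
               ∃[ s ] UpperBound P s × (∀ {b} → UpperBound P b → ¬ b < s)

  module Order = IsStrictTotalOrder isStrictTotalOrder

module Complex (ℝ : Reals c ℓ) where

  private
    module ℝ = Reals ℝ
    module ℝ-Prop = RingProperties ℝ.ring

  infix  8 -_
  infixl 7 _*_
  infixl 6 _+_
  infix  4 _≈_

  record ℂ : Set c where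
    constructor _+i_
    field
      re im : ℝ.Carrier
  open ℂ public

  _≈_ : Rel ℂ ℓ
  z ≈ w = re z ℝ.≈ re w × im z ℝ.≈ im w

  _+_ _*_ : ℂ → ℂ → ℂ
  z + w = (re z ℝ.+ re w) +i (im z ℝ.+ im w)
  z * w = (re z ℝ.* re w ℝ.- im z ℝ.* im w) +i (re z ℝ.* im w ℝ.+ im z ℝ.* re w)

  -_ : ℂ → ℂ
  - z = (ℝ.- re z) +i (ℝ.- im z)

  conj : ℂ → ℂ
  conj z = re z +i (ℝ.- im z)

  0ℂ 1ℂ : ℂ
  0ℂ = ℝ.0# +i ℝ.0#
  1ℂ = ℝ.1# +i ℝ.0#

  normSq : ℂ → ℝ.Carrier
  normSq z = re z ℝ.* re z ℝ.+ im z ℝ.* im z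

  -- Having modulus 1 means that the square root of normSq is 1.
  Unimodular : Pred ℂ ℓ
  Unimodular z = normSq z ℝ.≈ ℝ.1#

  private
    open SemiringSolver ℝ.commutativeSemiring using (solve; _:+_; _:*_; _:=_; con)
    open SetoidReasoning ℝ.setoid

    -1# : ℝ.Carrier
    -1# = ℝ.- ℝ.1#

    neg : ∀ x y → x ℝ.- y ℝ.≈ x ℝ.+ -1# ℝ.* y
    neg x y = ℝ.+-congˡ (ℝ.sym (ℝ-Prop.-1*x≈-x y))

    *-cong : ∀ {x y z w} → x ≈ y → z ≈ w → x * z ≈ y * w
    *-cong (p , q) (r , s) =
        ℝ.+-cong (ℝ.*-cong p r) (ℝ.-‿cong (ℝ.*-cong q s))
      , ℝ.+-cong (ℝ.*-cong p s) (ℝ.*-cong q r)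

    *-comm : ∀ x y → x * y ≈ y * x
    *-comm x y =
        ℝ.+-cong (ℝ.*-comm _ _) (ℝ.-‿cong (ℝ.*-comm _ _))
      , ℝ.trans (ℝ.+-comm _ _) (ℝ.+-cong (ℝ.*-comm _ _) (ℝ.*-comm _ _))

    *-assoc : ∀ x y z → (x * y) * z ≈ x * (y * z)
    *-assoc (a +i b) (d +i e) (f +i g) = real , imag
      where
      real = begin
        (a ℝ.* d ℝ.- b ℝ.* e) ℝ.* f ℝ.- (a ℝ.* e ℝ.+ b ℝ.* d) ℝ.* g
          ≈⟨ neg _ _ ⟩
        (a ℝ.* d ℝ.- b ℝ.* e) ℝ.* f ℝ.+ -1# ℝ.* ((a ℝ.* e ℝ.+ b ℝ.* d) ℝ.* g)
          ≈⟨ ℝ.+-congʳ (ℝ.*-congʳ (neg _ _)) ⟩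
        (a ℝ.* d ℝ.+ -1# ℝ.* (b ℝ.* e)) ℝ.* f ℝ.+ -1# ℝ.* ((a ℝ.* e ℝ.+ b ℝ.* d) ℝ.* g)
          ≈⟨ solve 7 (λ a b d e f g m →
               (a :* d :+ m :* (b :* e)) :* f :+ m :* ((a :* e :+ b :* d) :* g)
               := a :* (d :* f :+ m :* (e :* g)) :+ m :* (b :* (d :* g :+ e :* f)))
               ℝ.refl a b d e f g -1# ⟩
        a ℝ.* (d ℝ.* f ℝ.+ -1# ℝ.* (e ℝ.* g)) ℝ.+ -1# ℝ.* (b ℝ.* (d ℝ.* g ℝ.+ e ℝ.* f))
          ≈⟨ ℝ.+-congʳ (ℝ.*-congˡ (neg _ _)) ⟨
        a ℝ.* (d ℝ.* f ℝ.- e ℝ.* g) ℝ.+ -1# ℝ.* (b ℝ.* (d ℝ.* g ℝ.+ e ℝ.* f))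
          ≈⟨ neg _ _ ⟨
        a ℝ.* (d ℝ.* f ℝ.- e ℝ.* g) ℝ.- b ℝ.* (d ℝ.* g ℝ.+ e ℝ.* f) ∎
      imag = begin
        (a ℝ.* d ℝ.- b ℝ.* e) ℝ.* g ℝ.+ (a ℝ.* e ℝ.+ b ℝ.* d) ℝ.* f
          ≈⟨ ℝ.+-congʳ (ℝ.*-congʳ (neg _ _)) ⟩
        (a ℝ.* d ℝ.+ -1# ℝ.* (b ℝ.* e)) ℝ.* g ℝ.+ (a ℝ.* e ℝ.+ b ℝ.* d) ℝ.* f
          ≈⟨ solve 7 (λ a b d e f g m →
               (a :* d :+ m :* (b :* e)) :* g :+ (a :* e :+ b :* d) :* f
               := a :* (d :* g :+ e :* f) :+ b :* (d :* f :+ m :* (e :* g)))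
               ℝ.refl a b d e f g -1# ⟩
        a ℝ.* (d ℝ.* g ℝ.+ e ℝ.* f) ℝ.+ b ℝ.* (d ℝ.* f ℝ.+ -1# ℝ.* (e ℝ.* g))
          ≈⟨ ℝ.+-congˡ (ℝ.*-congˡ (neg _ _)) ⟨
        a ℝ.* (d ℝ.* g ℝ.+ e ℝ.* f) ℝ.+ b ℝ.* (d ℝ.* f ℝ.- e ℝ.* g) ∎

    *-identityˡ : ∀ x → 1ℂ * x ≈ x
    *-identityˡ (a +i b) =
        (begin
          ℝ.1# ℝ.* a ℝ.- ℝ.0# ℝ.* b     ≈⟨ neg _ _ ⟩
          ℝ.1# ℝ.* a ℝ.+ -1# ℝ.* (ℝ.0# ℝ.* b)
            ≈⟨ solve 3 (λ a b m → con 1 :* a :+ m :* (con 0 :* b) := a) ℝ.refl a b -1# ⟩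
          a ∎)
      , solve 2 (λ a b → con 1 :* b :+ con 0 :* a := b) ℝ.refl a b

    distribˡ : ∀ x y z → x * (y + z) ≈ x * y + x * z
    distribˡ (a +i b) (d +i e) (f +i g) =
        (begin
          a ℝ.* (d ℝ.+ f) ℝ.- b ℝ.* (e ℝ.+ g)                         ≈⟨ neg _ _ ⟩
          a ℝ.* (d ℝ.+ f) ℝ.+ -1# ℝ.* (b ℝ.* (e ℝ.+ g))
            ≈⟨ solve 7 (λ a b d e f g m →
                 a :* (d :+ f) :+ m :* (b :* (e :+ g))
                 := (a :* d :+ m :* (b :* e)) :+ (a :* f :+ m :* (b :* g)))
                 ℝ.refl a b d e f g -1# ⟩
          (a ℝ.* d ℝ.+ -1# ℝ.* (b ℝ.* e)) ℝ.+ (a ℝ.* f ℝ.+ -1# ℝ.* (b ℝ.* g))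
            ≈⟨ ℝ.+-cong (neg _ _) (neg _ _) ⟨
          (a ℝ.* d ℝ.- b ℝ.* e) ℝ.+ (a ℝ.* f ℝ.- b ℝ.* g) ∎)
      , solve 6 (λ a b d e f g →
          a :* (e :+ g) :+ b :* (d :+ f)
          := (a :* e :+ b :* d) :+ (a :* g :+ b :* f))
          ℝ.refl a b d e f g

    trans : ∀ {x y z} → x ≈ y → y ≈ z → x ≈ z
    trans (p , q) (r , s) = ℝ.trans p r , ℝ.trans q s

    +-cong : ∀ {x y z w} → x ≈ y → z ≈ w → x + z ≈ y + w
    +-cong (p , q) (r , s) = ℝ.+-cong p r , ℝ.+-cong q s

  ℂ-commutativeRing : CommutativeRing c ℓ
  ℂ-commutativeRing = record
    { Carrier = ℂ ; _≈_ = _≈_ ; _+_ = _+_ ; _*_ = _*_ ; -_ = -_ ; 0# = 0ℂ ; 1# = 1ℂ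
    ; isCommutativeRing = record
      { isRing = record
        { +-isAbelianGroup = record
          { isGroup = record
            { isMonoid = record
              { isSemigroup = record
                { isMagma = record
                  { isEquivalence = record
                    { refl  = ℝ.refl , ℝ.refl
                    ; sym   = λ (p , q) → ℝ.sym p , ℝ.sym q
                    ; trans = trans
                    }
                  ; ∙-cong = +-cong
                  }
                ; assoc = λ _ _ _ → ℝ.+-assoc _ _ _ , ℝ.+-assoc _ _ _
                }
              ; identity = (λ _ → ℝ.+-identityˡ _ , ℝ.+-identityˡ _)
                         , (λ _ → ℝ.+-identityʳ _ , ℝ.+-identityʳ _)
              }
            ; inverse = (λ _ → ℝ.-‿inverseˡ _ , ℝ.-‿inverseˡ _)
                      , (λ _ → ℝ.-‿inverseʳ _ , ℝ.-‿inverseʳ _)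
            ; ⁻¹-cong = λ (p , q) → ℝ.-‿cong p , ℝ.-‿cong q
            }
          ; comm = λ _ _ → ℝ.+-comm _ _ , ℝ.+-comm _ _
          }
        ; *-cong     = *-cong
        ; *-assoc    = *-assoc
        ; *-identity = *-identityˡ , λ x → trans (*-comm x 1ℂ) (*-identityˡ x)
        ; distrib    = distribˡ , λ x y z → trans (*-comm (y + z) x)
                         (trans (distribˡ x y z) (+-cong (*-comm x y) (*-comm x z)))
        }
      ; *-comm = *-comm
      }
    }

  private
    open ℝ.Order using (compare; irrefl; <-respʳ-≈; <-respˡ-≈) renaming (trans to <-trans; _≟_ to _≟ℝ_)

    neg-pos : ∀ {x} → x ℝ.< ℝ.0# → ℝ.0# ℝ.< ℝ.- x
    neg-pos {x} x<0 = <-respˡ-≈ (ℝ.-‿inverseˡ x)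
      (<-respʳ-≈ (ℝ.+-identityʳ (ℝ.- x)) (ℝ.+-monoʳ-< (ℝ.- x) x<0))

    square-pos : ∀ x → ¬ x ℝ.≈ ℝ.0# → ℝ.0# ℝ.< x ℝ.* x
    square-pos x x≉0 with compare x ℝ.0#
    ... | tri≈ _ x≈0 _ = contradiction x≈0 x≉0
    ... | tri> _ _ 0<x = ℝ.*-pos 0<x 0<x
    ... | tri< x<0 _ _ = <-respʳ-≈ -x*-x≈x*x (ℝ.*-pos (neg-pos x<0) (neg-pos x<0))
      where
      -x*-x≈x*x : (ℝ.- x) ℝ.* (ℝ.- x) ℝ.≈ x ℝ.* x
      -x*-x≈x*x = begin
        (ℝ.- x) ℝ.* (ℝ.- x)     ≈⟨ ℝ-Prop.-‿distribˡ-* x (ℝ.- x) ⟨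
        ℝ.- (x ℝ.* (ℝ.- x))     ≈⟨ ℝ.-‿cong (ℝ-Prop.-‿distribʳ-* x x) ⟨
        ℝ.- (ℝ.- (x ℝ.* x))     ≈⟨ ℝ-Prop.-‿involutive _ ⟩
        x ℝ.* x                 ∎

    zero-square : ∀ {x} → x ℝ.≈ ℝ.0# → x ℝ.* x ℝ.≈ ℝ.0#
    zero-square {x} x≈0 = ℝ.trans (ℝ.*-congʳ x≈0) (ℝ.zeroˡ x)

    normSq≉0 : ∀ z → ¬ z ≈ 0ℂ → ¬ normSq z ℝ.≈ ℝ.0#
    normSq≉0 (a +i b) z≉0 N≈0 with a ≟ℝ ℝ.0# | b ≟ℝ ℝ.0#
    ... | yes a≈0 | yes b≈0 = z≉0 (a≈0 , b≈0)
    ... | yes a≈0 | no  b≉0 = irrefl (ℝ.sym (begin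
            b ℝ.* b                ≈⟨ ℝ.+-identityˡ _ ⟨
            ℝ.0# ℝ.+ b ℝ.* b       ≈⟨ ℝ.+-congʳ (zero-square a≈0) ⟨
            a ℝ.* a ℝ.+ b ℝ.* b    ≈⟨ N≈0 ⟩
            ℝ.0#                   ∎)) (square-pos b b≉0)
    ... | no  a≉0 | yes b≈0 = irrefl (ℝ.sym (begin
            a ℝ.* a                ≈⟨ ℝ.+-identityʳ _ ⟨
            a ℝ.* a ℝ.+ ℝ.0#       ≈⟨ ℝ.+-congˡ (zero-square b≈0) ⟨
            a ℝ.* a ℝ.+ b ℝ.* b    ≈⟨ N≈0 ⟩
            ℝ.0#                   ∎)) (square-pos a a≉0)
    ... | no  a≉0 | no  b≉0 = irrefl (ℝ.sym N≈0)
            (<-trans (square-pos a a≉0)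
              (<-respˡ-≈ (ℝ.+-identityʳ _) (ℝ.+-monoʳ-< (a ℝ.* a) (square-pos b b≉0))))

  ℂ-inverse : ∀ z → ¬ z ≈ 0ℂ → ∃[ w ] z * w ≈ 1ℂ
  ℂ-inverse z@(a +i b) z≉0 with ℝ.inverse (normSq z) (normSq≉0 z z≉0)
  ... | t , Nt≈1 = ((a ℝ.* t) +i (ℝ.- (b ℝ.* t))) , real , imag
    where
    real = begin
      a ℝ.* (a ℝ.* t) ℝ.- b ℝ.* (ℝ.- (b ℝ.* t))
        ≈⟨ ℝ.+-congˡ (ℝ.-‿cong (ℝ.sym (ℝ-Prop.-‿distribʳ-* _ _))) ⟩
      a ℝ.* (a ℝ.* t) ℝ.- (ℝ.- (b ℝ.* (b ℝ.* t)))
        ≈⟨ ℝ.+-congˡ (ℝ-Prop.-‿involutive _) ⟩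
      a ℝ.* (a ℝ.* t) ℝ.+ b ℝ.* (b ℝ.* t)
        ≈⟨ solve 3 (λ a b t → a :* (a :* t) :+ b :* (b :* t)
                              := (a :* a :+ b :* b) :* t) ℝ.refl a b t ⟩
      (a ℝ.* a ℝ.+ b ℝ.* b) ℝ.* t   ≈⟨ Nt≈1 ⟩
      ℝ.1# ∎
    imag = begin
      a ℝ.* (ℝ.- (b ℝ.* t)) ℝ.+ b ℝ.* (a ℝ.* t)
        ≈⟨ ℝ.+-cong (ℝ.sym (ℝ-Prop.-‿distribʳ-* _ _))
             (solve 3 (λ a b t → b :* (a :* t) := a :* (b :* t)) ℝ.refl a b t) ⟩
      ℝ.- (a ℝ.* (b ℝ.* t)) ℝ.+ a ℝ.* (b ℝ.* t)   ≈⟨ ℝ.-‿inverseˡ _ ⟩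
      ℝ.0# ∎

  ℂ-field : DiscreteField c ℓ
  ℂ-field = record
    { commutativeRing = ℂ-commutativeRing
    ; _≟_             = λ z w → (re z ≟ℝ re w) ×-dec (im z ≟ℝ im w)
    ; 1≉0             = λ (1≈0 , _) → irrefl (ℝ.sym 1≈0) ℝ.0<1
    ; inverse         = ℂ-inverse
    }

------------------------------------------------------------------------
-- Rank of a matrix over a field

module Rank (F : DiscreteField c ℓ) where

  open DiscreteField F hiding (zero)
  open SemiringSum semiring

  Matrix : ℕ → ℕ → Set c
  Matrix m n = Fin m → Fin n → Carrier

  -- The columns of A with index in S are linearly independent.
  Independent : Matrix m n → Subset n → Set (c ⊔ ℓ)
  Independent {n = n} A S =
    (x : Vector Carrier n) → (∀ j → j ∉ S → x j ≈ 0#) →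
    (∀ i → ∑[ j < n ] (A i j * x j) ≈ 0#) → ∀ j → x j ≈ 0#

  -- r is the maximal number of linearly independent columns of A.
  IsRank : Matrix m n → ℕ → Set (c ⊔ ℓ)
  IsRank A r = (∃[ S ] Independent A S × ∣ S ∣ ≡ r)
             × (∀ S → Independent A S → ∣ S ∣ ℕ.≤ r)

  private
    open RingProperties ring
    open SetoidReasoning setoid

    tailRow : Matrix m (suc n) → Vector Carrier n → Fin m → Carrier
    tailRow {n = n} A x i = ∑[ j < n ] (A i (suc j) * x j)

    columnTail : Matrix m (suc n) → Matrix m n
    columnTail A i j = A i (suc j)

    outside-⇔ : (A : Matrix m (suc n)) (S : Subset n) →
                Independent (columnTail A) S ⇔ Independent A (outside ∷ S)
    outside-⇔ A S = mk⇔ to from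
      where
      to : Independent (columnTail A) S → Independent A (outside ∷ S)
      to ind x supp Ax≈0 = λ where
          zero    → x₀≈0
          (suc j) → ind (x ∘ suc) (λ j j∉S → supp (suc j) (j∉S ∘ drop-there))
            (λ i → begin
              tailRow A (x ∘ suc) i                        ≈⟨ +-identityˡ _ ⟨
              0# + tailRow A (x ∘ suc) i
                ≈⟨ +-congʳ (trans (*-congˡ x₀≈0) (zeroʳ _)) ⟨
              A i zero * x zero + tailRow A (x ∘ suc) i    ≈⟨ Ax≈0 i ⟩
              0#                                           ∎) j
        where
        x₀≈0 : x zero ≈ 0#
        x₀≈0 = supp zero λ ()
      from : Independent A (outside ∷ S) → Independent (columnTail A) S
      from ind x supp Ax≈0 j = ind (0# V.∷ x)
        (λ { zero _ → refl ; (suc j) j∉S → supp j (j∉S ∘ there) })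
        (λ i → trans (+-cong (zeroʳ _) (Ax≈0 i)) (+-identityˡ _)) (suc j)

    zero-column : (A : Matrix m (suc n)) (S : Subset n) → (∀ i → A i zero ≈ 0#) →
                  ¬ Independent A (inside ∷ S)
    zero-column {n = n} A S A₀≈0 ind = 1≉0 (ind (1# V.∷ V.replicate n 0#)
      (λ { zero 0∉S → contradiction here 0∉S ; (suc j) _ → refl })
      (λ i → begin
        A i zero * 1# + ∑[ j < n ] (A i (suc j) * 0#)
          ≈⟨ +-cong (trans (*-congʳ (A₀≈0 i)) (zeroˡ 1#))
                    (trans (sum-cong-≋ {n} (λ j → zeroʳ (A i (suc j)))) (sum-replicate-zero n)) ⟩
        0# + 0#  ≈⟨ +-identityˡ 0# ⟩
        0#       ∎) zero)

    -- Elimination of the first column with the pivot in row p.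
    eliminate : Matrix m (suc n) → Fin m → Carrier → Matrix m n
    eliminate A p b i j = A i (suc j) + - (A i zero * b) * A p (suc j)

    module _ (A : Matrix m (suc n)) (S : Subset n) (p : Fin m) (b : Carrier)
             (ab≈1 : A p zero * b ≈ 1#) where

      eliminate-row : ∀ x i → ∑[ j < n ] (eliminate A p b i j * x j)
                      ≈ tailRow A x i + - (A i zero * (b * tailRow A x p))
      eliminate-row x i = begin
        ∑[ j < n ] (eliminate A p b i j * x j)
          ≈⟨ sum-cong-≋ {n} (λ j → trans (distribʳ _ _ _) (+-congˡ (*-assoc _ _ _))) ⟩
        ∑[ j < n ] (A i (suc j) * x j + k * (A p (suc j) * x j))
          ≈⟨ ∑-distrib-+ {n} _ _ ⟩
        tailRow A x i + ∑[ j < n ] (k * (A p (suc j) * x j))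
          ≈⟨ +-congˡ (*-distribˡ-sum {n} k _) ⟨
        tailRow A x i + k * tailRow A x p
          ≈⟨ +-congˡ (-‿distribˡ-* _ _) ⟨
        tailRow A x i + - (A i zero * b * tailRow A x p)
          ≈⟨ +-congˡ (-‿cong (*-assoc _ _ _)) ⟩
        tailRow A x i + - (A i zero * (b * tailRow A x p)) ∎
        where k = - (A i zero * b)

      b*[a*x] : ∀ x → b * (A p zero * x) ≈ x
      b*[a*x] x = begin
        b * (A p zero * x)  ≈⟨ *-assoc _ _ _ ⟨
        b * A p zero * x    ≈⟨ *-congʳ (trans (*-comm _ _) ab≈1) ⟩
        1# * x              ≈⟨ *-identityˡ x ⟩
        x                   ∎

      inside-⇔ : Independent (eliminate A p b) S ⇔ Independent A (inside ∷ S)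
      inside-⇔ = mk⇔ to from
        where
        to : Independent (eliminate A p b) S → Independent A (inside ∷ S)
        to ind x supp Ax≈0 = λ { zero → x₀≈0 ; (suc j) → xⱼ≈0 j }
          where
          t = tailRow A (x ∘ suc)
          bt≈-x₀ : b * t p ≈ - x zero
          bt≈-x₀ = +-inverseʳ-unique (x zero) (b * t p) (begin
            x zero + b * t p                      ≈⟨ +-congʳ (b*[a*x] _) ⟨
            b * (A p zero * x zero) + b * t p     ≈⟨ distribˡ _ _ _ ⟨
            b * (A p zero * x zero + t p)         ≈⟨ *-congˡ (Ax≈0 p) ⟩
            b * 0#                                ≈⟨ zeroʳ b ⟩
            0#                                    ∎)
          xⱼ≈0 : ∀ j → x (suc j) ≈ 0#
          xⱼ≈0 = ind (x ∘ suc) (λ j j∉S → supp (suc j) (j∉S ∘ drop-there)) λ i → begin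
            ∑[ j < n ] (eliminate A p b i j * x (suc j))  ≈⟨ eliminate-row (x ∘ suc) i ⟩
            t i + - (A i zero * (b * t p))      ≈⟨ +-congˡ (-‿cong (*-congˡ bt≈-x₀)) ⟩
            t i + - (A i zero * - x zero)       ≈⟨ +-congˡ (-‿cong (-‿distribʳ-* _ _)) ⟨
            t i + - (- (A i zero * x zero))     ≈⟨ +-congˡ (-‿involutive _) ⟩
            t i + A i zero * x zero             ≈⟨ +-comm _ _ ⟩
            A i zero * x zero + t i             ≈⟨ Ax≈0 i ⟩
            0#                                  ∎
          x₀≈0 : x zero ≈ 0#
          x₀≈0 = begin
            x zero                    ≈⟨ -‿involutive _ ⟨
            - (- x zero)              ≈⟨ -‿cong bt≈-x₀ ⟨
            - (b * t p)
              ≈⟨ -‿cong (*-congˡ (trans (sum-cong-≋ {n} (λ j → trans (*-congˡ (xⱼ≈0 j)) (zeroʳ _)))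
                                        (sum-replicate-zero n))) ⟩
            - (b * 0#)                ≈⟨ -‿cong (zeroʳ b) ⟩
            - 0#                      ≈⟨ -0#≈0# ⟩
            0#                        ∎
        from : Independent A (inside ∷ S) → Independent (eliminate A p b) S
        from ind x supp Ex≈0 j = ind ((- (b * tailRow A x p)) V.∷ x)
          (λ { zero 0∉S → contradiction here 0∉S ; (suc j) j∉S → supp j (j∉S ∘ there) })
          (λ i → begin
            A i zero * - (b * tailRow A x p) + tailRow A x i  ≈⟨ +-comm _ _ ⟩
            tailRow A x i + A i zero * - (b * tailRow A x p)  ≈⟨ +-congˡ (-‿distribʳ-* _ _) ⟨
            tailRow A x i + - (A i zero * (b * tailRow A x p))  ≈⟨ eliminate-row x i ⟨
            ∑[ j < n ] (eliminate A p b i j * x j)            ≈⟨ Ex≈0 i ⟩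
            0#                                                ∎) (suc j)

  independent? : (A : Matrix m n) (S : Subset n) → Dec (Independent A S)
  independent? A []            = yes λ _ _ _ ()
  independent? A (outside ∷ S) = Dec.map (outside-⇔ A S) (independent? (columnTail A) S)
  independent? A (inside ∷ S)  with Fin.all? (λ i → A i zero ≟ 0#)
  ... | yes A₀≈0 = no (zero-column A S A₀≈0)
  ... | no  A₀≉0 with Fin.¬∀⟶∃¬ _ _ (λ i → A i zero ≟ 0#) A₀≉0
  ... | p , a≉0 with inverse (A p zero) a≉0
  ... | b , ab≈1 = Dec.map (inside-⇔ A S p b ab≈1) (independent? (eliminate A p b) S)

  private
    greatest : (P : Pred ℕ (c ⊔ ℓ)) → (∀ k → Dec (P k)) → P 0 → ∀ b →
               (∀ k → P k → k ℕ.≤ b) → ∃[ r ] P r × (∀ k → P k → k ℕ.≤ r)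
    greatest P P? P0 zero    bound = 0 , P0 , bound
    greatest P P? P0 (suc b) bound with P? (suc b)
    ... | yes Pb = suc b , Pb , bound
    ... | no ¬Pb = greatest P P? P0 b λ k Pk →
            ℕ.≤-pred (ℕ.≤∧≢⇒< (bound k Pk) λ { ≡.refl → ¬Pb Pk })

  rank-exists : (A : Matrix m n) → ∃ (IsRank A)
  rank-exists {n = n} A
    with r , attained , maximal ← greatest
           (λ k → ∃[ S ] Independent A S × ∣ S ∣ ≡ k)
           (λ k → anySubset? λ S → independent? A S ×-dec (∣ S ∣ ℕ.≟ k))
           (⊥ , (λ x supp _ j → supp j ∉⊥) , ∣⊥∣≡0 n)
           n (λ { k (S , _ , ≡.refl) → ∣p∣≤n S })
    = r , attained , λ S ind → maximal ∣ S ∣ (S , ind , ≡.refl)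

  rank : Matrix m n → ℕ
  rank A = proj₁ (rank-exists A)

------------------------------------------------------------------------
-- Finite simple graphs

record Graph (n : ℕ) : Set₁ where
  field
    Adj        : Rel (Fin n) 0ℓ
    Adj?       : Decidable Adj
    Adj-sym    : Symmetric Adj
    Adj-irrefl : Irreflexive _≡_ Adj

module _ (G : Graph n) where

  open Graph G

  edges : List (Fin n × Fin n)
  edges = filter (λ (i , j) → (i Fin.<? j) ×-dec Adj? i j)
                 (cartesianProduct (allFin n) (allFin n))

  Connected : Rel (Fin n) 0ℓ
  Connected = Star Adj

  private
    -- i and j are joined by a walk whose inner vertices are in xs.
    Via : List (Fin n) → Rel (Fin n) 0ℓ
    Via []       i j = i ≡ j ⊎ Adj i j
    Via (x ∷ xs) i j = Via xs i j ⊎ (Via xs i x × Via xs x j)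

    via? : ∀ xs → Decidable (Via xs)
    via? []       i j = (i Fin.≟ j) ⊎-dec Adj? i j
    via? (x ∷ xs) i j = via? xs i j ⊎-dec (via? xs i x ×-dec via? xs x j)

    via⇒star : ∀ xs {i j} → Via xs i j → Star Adj i j
    via⇒star []       (inj₁ ≡.refl)  = ε
    via⇒star []       (inj₂ e)       = return e
    via⇒star (x ∷ xs) (inj₁ p)       = via⇒star xs p
    via⇒star (x ∷ xs) (inj₂ (p , q)) = via⇒star xs p ◅◅ via⇒star xs q

    via-base : ∀ xs {i j} → i ≡ j ⊎ Adj i j → Via xs i j
    via-base []       p = p
    via-base (x ∷ xs) p = inj₁ (via-base xs p)

    via-to : ∀ x xs {i} → Via (x ∷ xs) i x → Via xs i x
    via-to x xs (inj₁ p)       = p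
    via-to x xs (inj₂ (p , _)) = p

    via-from : ∀ x xs {j} → Via (x ∷ xs) x j → Via xs x j
    via-from x xs (inj₁ p)       = p
    via-from x xs (inj₂ (_ , p)) = p

    via-trans : ∀ xs {i x j} → x ∈ˡ xs → Via xs i x → Via xs x j → Via xs i j
    via-trans (x ∷ xs) (here ≡.refl) p q = inj₂ (via-to x xs p , via-from x xs q)
    via-trans (y ∷ xs) (there x∈xs) (inj₁ p) (inj₁ q) = inj₁ (via-trans xs x∈xs p q)
    via-trans (y ∷ xs) (there x∈xs) (inj₁ p) (inj₂ (q , r)) = inj₂ (via-trans xs x∈xs p q , r)
    via-trans (y ∷ xs) (there x∈xs) (inj₂ (p , q)) (inj₁ r) = inj₂ (p , via-trans xs x∈xs q r)
    via-trans (y ∷ xs) (there x∈xs) (inj₂ (p , _)) (inj₂ (_ , r)) = inj₂ (p , r)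

    star⇒via : ∀ {i j} → Star Adj i j → Via (allFin n) i j
    star⇒via ε              = via-base (allFin n) (inj₁ ≡.refl)
    star⇒via (_◅_ {j = k} e s) = via-trans (allFin n) (∈-allFin k)
      (via-base (allFin n) (inj₂ e)) (star⇒via s)

  connected? : Decidable Connected
  connected? i j = Dec.map′ (via⇒star (allFin n)) star⇒via (via? (allFin n) i j)

  -- The list retains one vertex of each connected component.
  ω : ℕ
  ω = length (deduplicate connected? (allFin n))

  θ : ℤ
  θ = + length edges -ℤ + n +ℤ + ω

  record Cycle : Set where
    field
      order-3   : ℕ
    order : ℕ
    order = 3 ℕ.+ order-3
    next : Fin order → Fin order
    next k = suc (toℕ k) mod order
    field
      vertex    : Fin order → Fin n
      injective : Injective _≡_ _≡_ vertex
      adjacent  : ∀ k → Adj (vertex k) (vertex (next k))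

  open Cycle

  CycleEdge : Cycle → Rel (Fin n) 0ℓ
  CycleEdge C i j = ∃[ k ] ((vertex C k ≡ i × vertex C (next C k) ≡ j)
                          ⊎ (vertex C k ≡ j × vertex C (next C k) ≡ i))

  -- A cycle is a subgraph; it has one `Cycle` for each choice of a starting
  -- vertex and of a direction.
  SameCycle : Rel Cycle 0ℓ
  SameCycle C D = ∀ i j → CycleEdge C i j ⇔ CycleEdge D i j

  Disjoint : Rel Cycle 0ℓ
  Disjoint C D = ∀ k l → vertex C k ≢ vertex D l

  CyclesPairwiseDisjoint : Set
  CyclesPairwiseDisjoint = ∀ C D → ¬ SameCycle C D → Disjoint C D

  -- Deleting vertices leaves an induced subgraph, which is represented by its
  -- set of vertices.

  neighbours : Fin n → Subset n
  neighbours i = Vec.tabulate λ j → does (Adj? i j)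

  degree : Subset n → Fin n → ℕ
  degree S i = ∣ neighbours i ∩ S ∣

  Pendant : Subset n → Pred (Fin n) 0ℓ
  Pendant S i = i ∈ S × degree S i ≡ 1

  data δ-Transformation (S : Subset n) : Subset n → Set where
    delete : ∀ {i j} → Pendant S i → j ∈ S → Adj i j → δ-Transformation S (S - i - j)

  Crucial : Pred (Subset n) 0ℓ
  Crucial S = Star δ-Transformation ⊤ S × (∀ i → ¬ Pendant S i)

  -- The subgraph induced on S is the disjoint union of k cycles and some
  -- isolated vertices: a vertex of S on none of the cycles is isolated since
  -- every edge lies on one of them.
  record CyclesAndIsolatedVertices (S : Subset n) (k : ℕ) : Set where
    field
      cycle    : Fin k → Cycle
      within   : ∀ a l → vertex (cycle a) l ∈ S
      disjoint : ∀ a b → a ≢ b → Disjoint (cycle a) (cycle b)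
      covers   : ∀ i j → i ∈ S → j ∈ S → Adj i j → ∃[ a ] CycleEdge (cycle a) i j

------------------------------------------------------------------------
-- Complex unit gain graphs

module _ (ℝ : Reals c ℓ) where

  open Complex ℝ
  open Rank ℂ-field

  -- The values of `gain` off the edges are irrelevant.
  record GainGraph (n : ℕ) : Set (lsuc 0ℓ ⊔ c ⊔ ℓ) where
    field
      graph : Graph n
    open Graph graph public
    field
      gain            : Fin n → Fin n → ℂ
      gain-unimodular : ∀ {i j} → Adj i j → Unimodular (gain i j)
      gain-conj       : ∀ {i j} → Adj i j → gain j i ≈ conj (gain i j)

  adjacencyMatrix : Graph n → Matrix n n
  adjacencyMatrix G i j with Graph.Adj? G i j
  ... | yes _ = 1ℂ
  ... | no  _ = 0ℂ

  gainAdjacencyMatrix : GainGraph n → Matrix n n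
  gainAdjacencyMatrix Φ i j with GainGraph.Adj? Φ i j
  ... | yes _ = GainGraph.gain Φ i j
  ... | no  _ = 0ℂ

  graphRank : Graph n → ℕ
  graphRank G = rank (adjacencyMatrix G)

  gainGraphRank : GainGraph n → ℕ
  gainGraphRank Φ = rank (gainAdjacencyMatrix Φ)

  module _ (Φ : GainGraph n) where

    open GainGraph Φ
    open Cycle
    private
      module Product = MonoidSum (CommutativeRing.*-commutativeMonoid ℂ-commutativeRing)
      open SemiringExp (CommutativeRing.semiring ℂ-commutativeRing) using (_^_)

    cycleGain : Cycle graph → ℂ
    cycleGain C = Product.sum λ k → gain (vertex C k) (vertex C (next C k))

    TypeB : Pred (Cycle graph) ℓ
    TypeB C = ∃[ h ] order C ≡ 2 ℕ.* h × ¬ cycleGain C ≈ (- 1ℂ) ^ h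

{-# OPTIONS --safe #-}
module Submission where

-- For a set S of vertices let ν(S) be the nullity of the corresponding principal submatrix
-- and τ(S) the cyclomatic number of the induced subgraph; the rank equation says
-- ν(G) = ν(Φ) + 2τ on the whole vertex set.  Deleting a vertex x changes ν by −1, 0 or 1: by −1
-- iff some kernel vector on S is nonzero at x, by 1 iff the row of x is nonzero on the kernel of
-- S − x, and never both since the matrix is Hermitian.  As δ-transformations change neither
-- nullity and deleting a vertex of a cycle lowers τ, ν(G) ≤ ν(Φ) + 2τ for every S.
--
-- Call S tight if equality holds.  A δ-transformation keeps S tight with the same τ, so it
-- destroys no cycle; and if x lies on a cycle of a tight S, then S − x is tight and x has the
-- extreme effect −1 on ν(G) and 1 on ν(Φ).  In a tight S without pendant vertices, a third
-- neighbour of a vertex on a cycle would start a walk, alternating as for a maximum matching,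
-- that can only end in a pendant vertex; so S is a disjoint union of cycles and isolated
-- vertices.  Along such a cycle a kernel vector, scaled by the gains, satisfies x(t+2) = −x(t),
-- and the extreme effects amount to 4 dividing the order and the cycle being of Type B.

open import Defs
import Algebra.Properties.CommutativeMonoid.Sum as MonoidSum
import Algebra.Properties.Ring as RingProperties
import Algebra.Properties.Semiring.Exp as SemiringExp
import Algebra.Properties.Semiring.Sum as SemiringSum
open import Data.Empty using (⊥)
open import Data.Fin.Base as Fin using (Fin; zero; suc; toℕ)
import Data.Fin.Properties as Fin
open import Data.Fin.Subset as Subset
  using (Subset; inside; outside; _∈_; _∉_; _⊆_; _∩_; _-_; ∣_∣; ⊤; ⁅_⁆)
open import Data.Fin.Subset.Properties as Subset
  using (_∈?_; p─q⊆p; x∈p∧x≢y⇒x∈p-y; x∈p⇒∣p-x∣<∣p∣; p─x─y≡p─y─x; drop-there)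
open import Data.Integer.Base as ℤ using (+_)
import Data.Integer.Properties as ℤ
open import Data.List.Base as List
  using (List; []; _∷_; _++_; allFin; cartesianProduct; deduplicate; filter; length)
open import Data.List.Membership.Propositional using () renaming (_∈_ to _∈ˡ_)
open import Data.List.Membership.Propositional.Properties
  using (∈-allFin; ∈-cartesianProduct⁺; ∈-∃++)
import Data.List.Properties as List
open import Data.List.Relation.Unary.All as All using (All; []; _∷_)
open import Data.List.Relation.Unary.AllPairs using (AllPairs; []; _∷_)
open import Data.List.Relation.Unary.Any as Any using (Any; here; there)
import Data.List.Relation.Unary.Any.Properties as Any
import Data.List.Relation.Unary.Unique.DecSetoid.Properties as Unique
import Data.List.Relation.Unary.Unique.Propositional.Properties as Uniqueₚ
open import Data.Nat.Base as ℕ using (ℕ; zero; suc; _≤_; _<_; z≤n; s≤s)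
open import Data.Nat.Divisibility using (_∣_; divides)
open import Data.Nat.DivMod
  using (_%_; _/_; _mod_; m%n<n; m%n%n≡m%n; m<n⇒m%n≡m; n%n≡0; [m+n]%n≡m%n; [m+kn]%n≡m%n;
         m≡m%n+[m/n]*n; %-distribˡ-+)
import Data.Nat.Properties as ℕ
open import Data.Product.Base using (Σ; ∃; ∃-syntax; _×_; _,_; proj₁; proj₂)
open import Data.Sum.Base using (_⊎_; inj₁; inj₂; [_,_]′)
open import Data.Vec.Base as Vec using ([]; _∷_; here; there)
open import Data.Vec.Functional using (Vector)
open import Function.Base using (_∘_; id; case_of_)
open import Function.Bundles using (_⇔_; mk⇔)
open import Level using (Level; _⊔_; 0ℓ) renaming (suc to lsuc)
open import Relation.Binary.Bundles using (DecSetoid)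
open import Relation.Binary.Construct.Closure.ReflexiveTransitive
  using (Star; ε; _◅_; _◅◅_; return)
import Relation.Binary.Construct.Closure.ReflexiveTransitive as Star
open import Relation.Binary.Core using (Rel)
open import Relation.Binary.Definitions using (tri<; tri≈; tri>)
open import Relation.Binary.PropositionalEquality as ≡ using (_≡_; _≢_; refl)
import Relation.Binary.Reasoning.Setoid as SetoidReasoning
open import Relation.Nullary using (¬_; Dec; yes; no; does; contradiction)
open import Relation.Nullary.Decidable using (_×-dec_; _⊎-dec_; ¬?; decidable-stable)
open import Relation.Unary using (Pred)

-- On a tight set the difference D = ν(G) - ν(Φ) sits at its upper bound 2τ. That is why tightness
-- propagates: a deletion that does not lower D cannot lower τ, or the bound would fail on what
-- remains, and the remaining set is tight with the same τ. The obstacle is a vertex w at which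
-- every kernel vector of G is zero. It could be neutral, and then nothing would follow for Φ. In a
-- forest this is impossible: ∣S∣ - ν is even, being twice the matching number, so each deletion
-- changes ν by exactly one. A tight set inherits this from a forest, because its cycle vertices
-- lower ν(G) when deleted, and such deletions enlarge no kernel. Once w is known to raise ν(G),
-- keeping D at its maximum forces it to raise ν(Φ) as well, and the vector of Φ that witnesses this
-- is nonzero at some neighbour v of w. Deleting v lowers both nullities. The walk thus alternates
-- between vertices that raise both nullities and vertices that lower both; the two matrices are
-- compared through nullities only, never through common vectors.

private
  variable
    c ℓ ℓ₀ ℓ₁ ℓ₂ : Level
    A : Set ℓ₀
    m n : ℕ

-- Subsets of a finite set

∈-remove⁻ : (S : Subset n) {i j : Fin n} → j ∈ S - i → j ∈ S
∈-remove⁻ S {i} = p─q⊆p S ⁅ i ⁆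

∉-remove : (S : Subset n) (i : Fin n) → i ∉ S - i
∉-remove (_ ∷ S) zero    ()
∉-remove (_ ∷ S) (suc i) (there i∈) = ∉-remove S i i∈

∈-remove⇒≢ : (S : Subset n) {i j : Fin n} → j ∈ S - i → j ≢ i
∈-remove⇒≢ S j∈ refl = ∉-remove S _ j∈

remove-mono : {S T : Subset n} (i : Fin n) → T ⊆ S → (T - i) ⊆ (S - i)
remove-mono {S = S} {T} i T⊆S j∈ =
  x∈p∧x≢y⇒x∈p-y (T⊆S (∈-remove⁻ T j∈)) (∈-remove⇒≢ T j∈)

∣remove∣ : (S : Subset n) {i : Fin n} → i ∈ S → ∣ S ∣ ≡ suc ∣ S - i ∣
∣remove∣ (_ ∷ S) here = ≡.cong (suc ∘ ∣_∣) (≡.sym (Subset.p─⊥≡p S))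
∣remove∣ (outside ∷ S) (there i∈S) = ∣remove∣ S i∈S
∣remove∣ (inside  ∷ S) (there i∈S) = ≡.cong suc (∣remove∣ S i∈S)

∣p∣≡1⇒unique : (S : Subset n) → ∣ S ∣ ≡ 1 → ∀ {i j} → i ∈ S → j ∈ S → i ≡ j
∣p∣≡1⇒unique S ∣S∣≡1 {i} {j} i∈S j∈S with i Fin.≟ j
... | yes i≡j = i≡j
... | no  i≢j = contradiction
  (≡.trans (≡.sym ∣S∣≡1) (≡.trans (∣remove∣ S i∈S)
    (≡.cong suc (∣remove∣ (S - i) (x∈p∧x≢y⇒x∈p-y j∈S (i≢j ∘ ≡.sym)))))) λ ()

unique⇒∣p∣≡1 : (S : Subset n) {i : Fin n} → i ∈ S → (∀ {j} → j ∈ S → j ≡ i) → ∣ S ∣ ≡ 1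
unique⇒∣p∣≡1 {n} S {i} i∈S unique = ≡.trans (∣remove∣ S i∈S) (≡.cong suc
  (≡.trans (≡.cong ∣_∣ (Subset.Empty-unique {p = S - i} λ (j , j∈) →
      ∈-remove⇒≢ S j∈ (unique (∈-remove⁻ S j∈)))) (Subset.∣⊥∣≡0 n)))

-- `neighbours` unfolds to an instance of this, so the two membership lemmas below also serve for
-- degrees.
fromDec : {P : Pred (Fin n) ℓ} → (∀ i → Dec (P i)) → Subset n
fromDec P? = Vec.tabulate λ i → does (P? i)

∈-fromDec⁺ : {P : Pred (Fin n) ℓ} (P? : ∀ i → Dec (P i)) {i : Fin n} → P i → i ∈ fromDec P?
∈-fromDec⁺ P? {zero} p with P? zero
... | yes _ = here
... | no ¬p = contradiction p ¬p
∈-fromDec⁺ P? {suc i} p = there (∈-fromDec⁺ (P? ∘ suc) p)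

∈-fromDec⁻ : {P : Pred (Fin n) ℓ} (P? : ∀ i → Dec (P i)) {i : Fin n} → i ∈ fromDec P? → P i
∈-fromDec⁻ P? {zero} i∈ with P? zero | i∈
... | yes p | here = p
∈-fromDec⁻ P? {suc i} (there i∈) = ∈-fromDec⁻ (P? ∘ suc) i∈

-- Dimension of subspaces, rank and nullity

-- A subspace V has dimension d when d suitable linear functionals cut it down to zero
-- and each of them is nonzero on what the previous ones left.
module Dimension (F : DiscreteField c ℓ) where

  open DiscreteField F hiding (zero; refl; _-_)
  open DiscreteField F using () renaming (refl to ≈-refl)
  open RingProperties ring
  open SemiringSum semiring
  open SetoidReasoning setoid

  Vec′ : ℕ → Set c
  Vec′ n = Vector Carrier n

  _⊕_ : Vec′ n → Vec′ n → Vec′ n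
  (x ⊕ y) i = x i + y i

  _⊙_ : Carrier → Vec′ n → Vec′ n
  (a ⊙ x) i = a * x i

  record Functional (n : ℕ) : Set (c ⊔ ℓ) where
    no-eta-equality
    field
      ⟦_⟧         : Vec′ n → Carrier
      respects    : ∀ {x y} → (∀ i → x i ≈ y i) → ⟦ x ⟧ ≈ ⟦ y ⟧
      additive    : ∀ x y → ⟦ x ⊕ y ⟧ ≈ ⟦ x ⟧ + ⟦ y ⟧
      homogeneous : ∀ a x → ⟦ a ⊙ x ⟧ ≈ a * ⟦ x ⟧
  open Functional public

  record Subspace (n : ℕ) : Set (c ⊔ lsuc ℓ) where
    no-eta-equality
    field
      Member   : Pred (Vec′ n) ℓ
      ⊕-closed : ∀ {x y} → Member x → Member y → Member (x ⊕ y)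
      ⊙-closed : ∀ a {x} → Member x → Member (a ⊙ x)
  open Subspace public

  _⊑_ : Subspace n → Subspace n → Set (c ⊔ ℓ)
  V ⊑ W = ∀ {x} → Member V x → Member W x

  infixl 6 _∧_
  _∧_ : Subspace n → Functional n → Subspace n
  Member (V ∧ f) x = Member V x × ⟦ f ⟧ x ≈ 0#
  ⊕-closed (V ∧ f) (x∈ , fx) (y∈ , fy) = ⊕-closed V x∈ y∈ ,
    trans (additive f _ _) (trans (+-cong fx fy) (+-identityˡ 0#))
  ⊙-closed (V ∧ f) a (x∈ , fx) = ⊙-closed V a x∈ ,
    trans (homogeneous f a _) (trans (*-congˡ fx) (zeroʳ a))

  data Dim {n} (V : Subspace n) : ℕ → Set (c ⊔ ℓ) where
    trivial : (∀ {x} → Member V x → ∀ i → x i ≈ 0#) → Dim V 0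
    cut     : ∀ {d} (f : Functional n) {v} → Member V v → ¬ ⟦ f ⟧ v ≈ 0# →
              Dim (V ∧ f) d → Dim V (suc d)

  Vanishes : Functional n → Subspace n → Set (c ⊔ ℓ)
  Vanishes f V = ∀ {x} → Member V x → ⟦ f ⟧ x ≈ 0#

  dim-resp : ∀ {V W : Subspace n} {d} → V ⊑ W → W ⊑ V → Dim V d → Dim W d
  dim-resp V⊑W W⊑V (trivial V≈0) = trivial λ x∈ → V≈0 (W⊑V x∈)
  dim-resp V⊑W W⊑V (cut f v∈ fv≉0 D) = cut f (V⊑W v∈) fv≉0
    (dim-resp (λ (x∈ , fx) → V⊑W x∈ , fx) (λ (x∈ , fx) → W⊑V x∈ , fx) D)

  -- x - (g x / g w) w
  project : (g : Functional n) (w : Vec′ n) (b : Carrier) → Vec′ n → Vec′ n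
  project g w b x = x ⊕ ((- (⟦ g ⟧ x * b)) ⊙ w)

  module _ (V : Subspace n) (g : Functional n) {w : Vec′ n} {b : Carrier}
           (w∈V : Member V w) (gb≈1 : ⟦ g ⟧ w * b ≈ 1#) where

    project-value : (f : Functional n) (x : Vec′ n) →
                    ⟦ f ⟧ (project g w b x) ≈ ⟦ f ⟧ x + - (⟦ g ⟧ x * b) * ⟦ f ⟧ w
    project-value f x = trans (additive f _ _) (+-congˡ (homogeneous f _ _))

    project∈ : ∀ {x} → Member V x → Member V (project g w b x)
    project∈ x∈ = ⊕-closed V x∈ (⊙-closed V _ w∈V)

    project-kills : ∀ x → ⟦ g ⟧ (project g w b x) ≈ 0#
    project-kills x = begin
      ⟦ g ⟧ (project g w b x)             ≈⟨ project-value g x ⟩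
      gx + - (gx * b) * gw                ≈⟨ +-congˡ (-‿distribˡ-* _ _) ⟨
      gx + - (gx * b * gw)                ≈⟨ +-congˡ (-‿cong (*-assoc _ _ _)) ⟩
      gx + - (gx * (b * gw))              ≈⟨ +-congˡ (-‿cong (*-congˡ (trans (*-comm _ _) gb≈1))) ⟩
      gx + - (gx * 1#)                    ≈⟨ +-congˡ (-‿cong (*-identityʳ gx)) ⟩
      gx + - gx                           ≈⟨ -‿inverseʳ gx ⟩
      0#                                  ∎
      where gx = ⟦ g ⟧ x ; gw = ⟦ g ⟧ w

    project-fixes : ∀ (f : Functional n) x → ⟦ f ⟧ w ≈ 0# → ⟦ f ⟧ (project g w b x) ≈ ⟦ f ⟧ x
    project-fixes f x fw≈0 = begin
      ⟦ f ⟧ (project g w b x)             ≈⟨ project-value f x ⟩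
      ⟦ f ⟧ x + - (⟦ g ⟧ x * b) * ⟦ f ⟧ w ≈⟨ +-congˡ (trans (*-congˡ fw≈0) (zeroʳ _)) ⟩
      ⟦ f ⟧ x + 0#                        ≈⟨ +-identityʳ _ ⟩
      ⟦ f ⟧ x                             ∎

    -- The projection of `x` along `w` lies in `V ∧ g`, where `f` is zero. So on `V` the functional
    -- `f` is the multiple `f w / g w` of `g`.
    vanishes-at-pivot : (f : Functional n) → Vanishes f (V ∧ g) → ∀ {x} → Member V x →
                        ⟦ f ⟧ x ≈ ⟦ g ⟧ x * b * ⟦ f ⟧ w
    vanishes-at-pivot f van {x} x∈ = begin
      ⟦ f ⟧ x                              ≈⟨ +-identityʳ _ ⟨
      ⟦ f ⟧ x + 0#                         ≈⟨ +-congˡ (-‿inverseˡ q) ⟨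
      ⟦ f ⟧ x + (- q + q)                  ≈⟨ +-assoc _ _ _ ⟨
      ⟦ f ⟧ x + - q + q                    ≈⟨ +-congʳ (+-congˡ (-‿distribˡ-* _ _)) ⟩
      ⟦ f ⟧ x + - (⟦ g ⟧ x * b) * ⟦ f ⟧ w + q ≈⟨ +-congʳ (project-value f x) ⟨
      ⟦ f ⟧ (project g w b x) + q          ≈⟨ +-congʳ (van (project∈ x∈ , project-kills x)) ⟩
      0# + q                               ≈⟨ +-identityˡ q ⟩
      q                                    ∎
      where q = ⟦ g ⟧ x * b * ⟦ f ⟧ w

  data Hyperplane (V : Subspace n) (g : Functional n) : ℕ → Set (c ⊔ ℓ) where
    flat   : ∀ {d} → Vanishes g V → Dim (V ∧ g) d → Hyperplane V g d
    proper : ∀ {d w} → Member V w → ¬ ⟦ g ⟧ w ≈ 0# → Dim (V ∧ g) d → Hyperplane V g (suc d)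

  functional-zero : (g : Functional n) {x : Vec′ n} → (∀ i → x i ≈ 0#) → ⟦ g ⟧ x ≈ 0#
  functional-zero g {x} x≈0 = begin
    ⟦ g ⟧ x          ≈⟨ respects g (λ i → trans (x≈0 i) (sym (zeroˡ _))) ⟩
    ⟦ g ⟧ (0# ⊙ x)   ≈⟨ homogeneous g 0# x ⟩
    0# * ⟦ g ⟧ x     ≈⟨ zeroˡ _ ⟩
    0#               ∎

  product-zero : ∀ {a b} → a * b ≈ 0# → ¬ b ≈ 0# → a ≈ 0#
  product-zero {a} {b} ab≈0 b≉0 with d , bd≈1 ← inverse b b≉0 = begin
    a             ≈⟨ *-identityʳ a ⟨
    a * 1#        ≈⟨ *-congˡ bd≈1 ⟨
    a * (b * d)   ≈⟨ *-assoc _ _ _ ⟨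
    a * b * d     ≈⟨ trans (*-congʳ ab≈0) (zeroˡ d) ⟩
    0#            ∎

  unit≉0 : ∀ {a b} → a * b ≈ 1# → ¬ b ≈ 0#
  unit≉0 {a} ab≈1 b≈0 = 1≉0 (trans (sym ab≈1) (trans (*-congˡ b≈0) (zeroʳ a)))

  -- Exchange argument: the cut by `g` is moved past the cuts that witness the dimension, from the
  -- innermost outwards.
  hyperplane : ∀ {V : Subspace n} {d} (g : Functional n) → Dim V d → Hyperplane V g d
  hyperplane g (trivial V≈0) =
    flat (functional-zero g ∘ V≈0) (trivial (V≈0 ∘ proj₁))
  hyperplane {V = V} g D₀@(cut f {v} v∈ fv≉0 D) with hyperplane g D
  -- As `f w` is zero, shifting `v` by a multiple of `w` makes `g` vanish on it without changing
  -- `f v`, so the cut by `f` stays proper after the cut by `g`.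
  ... | proper {w = w} (w∈ , fw≈0) gw≉0 D′ with b , gb≈1 ← inverse _ gw≉0 =
    proper w∈ gw≉0 (cut f (project∈ V g w∈ gb≈1 v∈ , project-kills V g w∈ gb≈1 v)
      (λ f≈0 → fv≉0 (trans (sym (project-fixes V g w∈ gb≈1 f v fw≈0)) f≈0))
      (dim-resp (λ ((x∈ , fx) , gx) → (x∈ , gx) , fx) (λ ((x∈ , gx) , fx) → (x∈ , fx) , gx) D′))
  -- Here `g` is a multiple of `f` on `V`: it vanishes throughout if `g v` is zero, and otherwise
  -- has the same zeros as `f`.
  ... | flat g≈0 D′ with b , fb≈1 ← inverse _ fv≉0 | ⟦ g ⟧ v ≟ 0#
  ...   | yes gv≈0 = flat van (dim-resp (λ x∈ → x∈ , van x∈) proj₁ D₀)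
    where
    van : Vanishes g V
    van x∈ = trans (vanishes-at-pivot V f v∈ fb≈1 g g≈0 x∈) (trans (*-congˡ gv≈0) (zeroʳ _))
  ...   | no gv≉0 = proper v∈ gv≉0 (dim-resp
      (λ x∈@(x∈V , _) → x∈V , g≈0 x∈)
      (λ (x∈V , gx) → x∈V , product-zero
        (product-zero (trans (sym (vanishes-at-pivot V f v∈ fb≈1 g g≈0 x∈V)) gx) gv≉0)
        (unit≉0 fb≈1)) D)

  -- A functional that cuts `V` properly also cuts `W` properly, with the same vector as witness.
  dim-mono : ∀ {V W : Subspace n} {d e} → V ⊑ W → Dim V d → Dim W e → d ≤ e
  dim-mono V⊑W (trivial _) _ = z≤n
  dim-mono V⊑W (cut f v∈ fv≉0 D) E with hyperplane f E
  ... | flat f≈0 _    = contradiction (f≈0 (V⊑W v∈)) fv≉0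
  ... | proper _ _ E′ = s≤s (dim-mono (λ (x∈ , fx) → V⊑W x∈ , fx) D E′)

  dim-unique : ∀ {V W : Subspace n} {d e} → V ⊑ W → W ⊑ V → Dim V d → Dim W e → d ≡ e
  dim-unique V⊑W W⊑V D E = ℕ.≤-antisym (dim-mono V⊑W D E) (dim-mono W⊑V E D)

  dim-trivial : ∀ {V : Subspace n} {d} → (∀ {x} → Member V x → ∀ i → x i ≈ 0#) → Dim V d → d ≡ 0
  dim-trivial {V = V} V≈0 D = dim-unique {V = V} {V} id id D (trivial V≈0)

  coordinate : Fin n → Functional n
  ⟦ coordinate j ⟧ x            = x j
  respects (coordinate j) x≈y   = x≈y j
  additive (coordinate j) x y   = ≈-refl
  homogeneous (coordinate j) a x = ≈-refl

  unitVector : Fin n → Vec′ n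
  unitVector j i with i Fin.≟ j
  ... | yes _ = 1#
  ... | no  _ = 0#

  unitVector-self : (j : Fin n) → unitVector j j ≈ 1#
  unitVector-self j with j Fin.≟ j
  ... | yes _  = ≈-refl
  ... | no j≢j = contradiction ≡.refl j≢j

  unitVector-other : {i j : Fin n} → i ≢ j → unitVector j i ≈ 0#
  unitVector-other {i = i} {j} i≢j with i Fin.≟ j
  ... | yes i≡j = contradiction i≡j i≢j
  ... | no _    = ≈-refl

  supported : Subset n → Subspace n
  Member (supported S) x = ∀ j → j ∉ S → x j ≈ 0#
  ⊕-closed (supported S) x∈ y∈ j j∉ = trans (+-cong (x∈ j j∉) (y∈ j j∉)) (+-identityˡ 0#)
  ⊙-closed (supported S) a x∈ j j∉ = trans (*-congˡ (x∈ j j∉)) (zeroʳ a)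

  unitVector∈ : {S : Subset n} {j : Fin n} → j ∈ S → Member (supported S) (unitVector j)
  unitVector∈ j∈S i i∉S = unitVector-other {i = i} λ { refl → i∉S j∈S }

  dim-supported : (S : Subset n) → Dim (supported S) ∣ S ∣
  dim-supported {n} S = go ∣ S ∣ S refl
    where
    go : ∀ s (S : Subset n) → ∣ S ∣ ≡ s → Dim (supported S) s
    go zero S ∣S∣≡0 = trivial λ x∈ j → x∈ j λ j∈S →
      contradiction (≡.trans (≡.sym ∣S∣≡0) (∣remove∣ S j∈S)) λ ()
    go (suc s) S ∣S∣≡ with Subset.nonempty? S
    ... | no empty = contradiction (≡.trans (≡.sym ∣S∣≡)
      (≡.trans (≡.cong ∣_∣ (Subset.Empty-unique empty)) (Subset.∣⊥∣≡0 n))) λ ()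
    ... | yes (j , j∈S) = cut (coordinate j) (unitVector∈ j∈S)
      (λ 1≈0 → 1≉0 (trans (sym (unitVector-self j)) 1≈0))
      (dim-resp to from (go s (S - j) (ℕ.suc-injective (≡.trans (≡.sym (∣remove∣ S j∈S)) ∣S∣≡))))
      where
      to : supported (S - j) ⊑ (supported S ∧ coordinate j)
      to x∈ = (λ i i∉S → x∈ i (i∉S ∘ ∈-remove⁻ S)) , x∈ j (∉-remove S j)
      from : (supported S ∧ coordinate j) ⊑ supported (S - j)
      from (x∈ , xj) i i∉ with i Fin.≟ j
      ... | yes refl = xj
      ... | no i≢j   = x∈ i λ i∈S → i∉ (x∈p∧x≢y⇒x∈p-y i∈S i≢j)

  Solutions : Pred (Fin m) 0ℓ → (Fin m → Functional n) → Subspace n → Subspace n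
  Member (Solutions P g V) x = Member V x × (∀ i → P i → ⟦ g i ⟧ x ≈ 0#)
  ⊕-closed (Solutions P g V) (x∈ , gx) (y∈ , gy) = ⊕-closed V x∈ y∈ , λ i p →
    trans (additive (g i) _ _) (trans (+-cong (gx i p) (gy i p)) (+-identityˡ 0#))
  ⊙-closed (Solutions P g V) a (x∈ , gx) = ⊙-closed V a x∈ , λ i p →
    trans (homogeneous (g i) a _) (trans (*-congˡ (gx i p)) (zeroʳ a))

  solutions-cons : ∀ {P : Pred (Fin (suc m)) 0ℓ} {g : Fin (suc m) → Functional n} {V : Subspace n} {d} →
    P zero → Dim (Solutions (P ∘ suc) (g ∘ suc) (V ∧ g zero)) d → Dim (Solutions P g V) d
  solutions-cons p = dim-resp
    (λ ((x∈ , g₀x) , gx) → x∈ , λ { zero _ → g₀x ; (suc i) → gx i })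
    (λ (x∈ , gx) → (x∈ , gx zero p) , gx ∘ suc)

  solutions-skip : ∀ {P : Pred (Fin (suc m)) 0ℓ} {g : Fin (suc m) → Functional n} {V : Subspace n} {d} →
    ¬ P zero → Dim (Solutions (P ∘ suc) (g ∘ suc) V) d → Dim (Solutions P g V) d
  solutions-skip ¬p = dim-resp
    (λ (x∈ , gx) → x∈ , λ { zero p → contradiction p ¬p ; (suc i) → gx i })
    (λ (x∈ , gx) → x∈ , gx ∘ suc)

  solutions-nil : ∀ {P : Pred (Fin 0) 0ℓ} {g : Fin 0 → Functional n} {V : Subspace n} {d} →
    Dim V d → Dim (Solutions P g V) d
  solutions-nil = dim-resp (λ x∈ → x∈ , λ ()) proj₁

  dim-cut : ∀ {V : Subspace n} {d} (g : Functional n) → Dim V d → ∃[ e ] Dim (V ∧ g) e × d ≤ suc e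
  dim-cut g D with hyperplane g D
  ... | flat _ E     = _ , E , ℕ.n≤1+n _
  ... | proper _ _ E = _ , E , ℕ.≤-refl

  dim-solutions : ∀ m {P : Pred (Fin m) 0ℓ} → (∀ i → Dec (P i)) → (g : Fin m → Functional n) →
    ∀ {V : Subspace n} {d} → Dim V d → ∃ (Dim (Solutions P g V))
  dim-solutions zero    P? g D = _ , solutions-nil D
  dim-solutions (suc m) P? g D with P? zero
  ... | yes p with _ , E , _ ← dim-cut (g zero) D
              with e , E′ ← dim-solutions m (P? ∘ suc) (g ∘ suc) E = e , solutions-cons p E′
  dim-solutions (suc m) P? g D | no ¬p
              with e , E′ ← dim-solutions m (P? ∘ suc) (g ∘ suc) D = e , solutions-skip ¬p E′

  -- Each of the m - ∣T∣ coordinates outside `T` costs at most one dimension; written additively to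
  -- avoid truncated subtraction.
  dim-vanish-outside : ∀ {m} (ι : Fin m → Fin n) (T : Subset m) {V : Subspace n} {d} → Dim V d →
    ∃[ e ] Dim (Solutions (_∉ T) (coordinate ∘ ι) V) e × d ℕ.+ ∣ T ∣ ≤ e ℕ.+ m
  dim-vanish-outside ι [] D = _ , solutions-nil D , ℕ.≤-refl
  dim-vanish-outside ι (outside ∷ T) D
    with d′ , E , d≤ ← dim-cut (coordinate (ι zero)) D
    with e , E′ , d′≤ ← dim-vanish-outside (ι ∘ suc) T E =
    e , solutions-cons (λ ()) (dim-resp
          (λ (x∈ , gx) → x∈ , λ i i∉ → gx i (i∉ ∘ there))
          (λ (x∈ , gx) → x∈ , λ i i∉ → gx i (i∉ ∘ drop-there)) E′)
      , ℕ.≤-trans (ℕ.+-monoˡ-≤ ∣ T ∣ d≤) (ℕ.≤-trans (s≤s d′≤) (ℕ.≤-reflexive (≡.sym (ℕ.+-suc e _))))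
  dim-vanish-outside ι (inside ∷ T) D
    with e , E′ , d≤ ← dim-vanish-outside (ι ∘ suc) T D =
    e , solutions-skip (λ 0∉ → 0∉ here) (dim-resp
          (λ (x∈ , gx) → x∈ , λ i i∉ → gx i (i∉ ∘ there))
          (λ (x∈ , gx) → x∈ , λ i i∉ → gx i (i∉ ∘ drop-there)) E′)
      , ℕ.≤-trans (ℕ.≤-reflexive (ℕ.+-suc _ _)) (ℕ.≤-trans (s≤s d≤) (ℕ.≤-reflexive (≡.sym (ℕ.+-suc e _))))

  -- The complement of T consists of the coordinates that, taken in turn, are not
  -- yet zero on the space.
  pivots : ∀ {m} (ι : Fin m → Fin n) {V : Subspace n} {d} → Dim V d →
    ∃[ T ] ∃[ e ] Dim (Solutions (_∉ T) (coordinate ∘ ι) V) e × e ℕ.+ m ≤ d ℕ.+ ∣ T ∣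
      × (∀ {x} → Member (Solutions (_∉ T) (coordinate ∘ ι) V) x → ∀ j → x (ι j) ≈ 0#)
  pivots {m = zero}  ι D = [] , _ , solutions-nil D , ℕ.≤-refl , λ _ ()
  pivots {m = suc m} ι {V} {d} D with hyperplane (coordinate (ι zero)) D
  ... | flat x₀≈0 _ with T , e , E , e≤ , van ← pivots (ι ∘ suc) D =
    inside ∷ T , e
      , solutions-skip (λ 0∉ → 0∉ here) (dim-resp
          (λ (x∈ , gx) → x∈ , λ i i∉ → gx i (i∉ ∘ there))
          (λ (x∈ , gx) → x∈ , λ i i∉ → gx i (i∉ ∘ drop-there)) E)
      , ℕ.≤-trans (ℕ.≤-reflexive (ℕ.+-suc e m)) (ℕ.≤-trans (s≤s e≤) (ℕ.≤-reflexive (≡.sym (ℕ.+-suc d _))))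
      , λ { (x∈ , gx) zero → x₀≈0 x∈
          ; (x∈ , gx) (suc j) → van (x∈ , λ i i∉ → gx (suc i) (i∉ ∘ drop-there)) j }
  ... | proper {d′} _ _ D′ with T , e , E , e≤ , van ← pivots (ι ∘ suc) D′ =
    outside ∷ T , e
      , solutions-cons (λ ()) (dim-resp
          (λ (x∈ , gx) → x∈ , λ i i∉ → gx i (i∉ ∘ there))
          (λ (x∈ , gx) → x∈ , λ i i∉ → gx i (i∉ ∘ drop-there)) E)
      , ℕ.≤-trans (ℕ.≤-reflexive (ℕ.+-suc e m)) (s≤s e≤)
      , λ { (x∈ , gx) zero → gx zero λ ()
          ; (x∈ , gx) (suc j) → van ((x∈ , gx zero λ ()) , λ i i∉ → gx (suc i) (i∉ ∘ drop-there)) j }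

  open Rank F using (Matrix; Independent; IsRank)

  row : Matrix m n → Fin m → Functional n
  ⟦ row {n = n} A i ⟧ x           = ∑[ j < n ] (A i j * x j)
  respects (row {n = n} A i) x≈y  = sum-cong-≋ {n} λ j → *-congˡ (x≈y j)
  additive (row {n = n} A i) x y  = trans (sum-cong-≋ {n} λ j → distribˡ _ _ _) (∑-distrib-+ {n} _ _)
  homogeneous (row {n = n} A i) a x = trans
    (sum-cong-≋ {n} λ j → trans (sym (*-assoc _ _ _)) (trans (*-congʳ (*-comm _ _)) (*-assoc _ _ _)))
    (sym (*-distribˡ-sum {n} a _))

  kernel : Matrix n n → Subset n → Subspace n
  kernel A S = Solutions (_∈ S) (row A) (supported S)

  nullity-exists : (A : Matrix n n) (S : Subset n) → ∃ (Dim (kernel A S))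
  nullity-exists {n} A S = dim-solutions n (_∈? S) (row A) (dim-supported S)

  nullity : Matrix n n → Subset n → ℕ
  nullity A S = proj₁ (nullity-exists A S)

  dim-kernel : (A : Matrix n n) (S : Subset n) → Dim (kernel A S) (nullity A S)
  dim-kernel A S = proj₂ (nullity-exists A S)

  -- If the columns in `S` are independent, forcing the other n - ∣S∣ coordinates to be zero kills
  -- the kernel, so the nullity is at most n - ∣S∣. Conversely the columns that are not pivots of
  -- the kernel are independent, and there are at least n - ν of them.
  rank+nullity : (A : Matrix n n) {r : ℕ} → IsRank A r → r ℕ.+ nullity A ⊤ ≡ n
  rank+nullity {n} A {r} ((S , ind , refl) , maximal) = ℕ.≤-antisym upper lower
    where
    D = dim-kernel A ⊤
    upper : ∣ S ∣ ℕ.+ nullity A ⊤ ≤ n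
    upper with e , E , ν+∣S∣≤ ← dim-vanish-outside id S D
      with refl ← dim-trivial (λ {x} ((_ , Ax) , x∉) → ind x x∉ λ i → Ax i Subset.∈⊤) E
      = ℕ.≤-trans (ℕ.≤-reflexive (ℕ.+-comm ∣ S ∣ _)) ν+∣S∣≤
    lower : n ≤ ∣ S ∣ ℕ.+ nullity A ⊤
    lower with T , e , _ , e≤ , van ← pivots id D = ℕ.≤-trans (ℕ.m≤n+m n e) (ℕ.≤-trans e≤
      (ℕ.≤-trans (ℕ.≤-reflexive (ℕ.+-comm _ ∣ T ∣)) (ℕ.+-monoˡ-≤ _ (maximal T
        λ x supp Ax → van (((λ j j∉ → contradiction Subset.∈⊤ j∉) , λ i _ → Ax i) , supp)))))

-- Comparing lengths of lists

∈-find : {P : Pred A ℓ₁} {xs : List A} → Any P xs → ∃[ x ] x ∈ˡ xs × P x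
∈-find (here px)  = _ , here refl , px
∈-find (there i) with x , x∈ , px ← ∈-find i = x , there x∈ , px

drop-middle : {P : Pred A ℓ₁} (xs : List A) {y : A} {zs : List A} →
              Any P (xs ++ y ∷ zs) → ¬ P y → Any P (xs ++ zs)
drop-middle xs i ¬py with Any.++⁻ xs i
... | inj₁ j          = Any.++⁺ˡ j
... | inj₂ (here py)  = contradiction py ¬py
... | inj₂ (there j)  = Any.++⁺ʳ xs j

length-middle : (xs : List A) {y : A} {zs : List A} →
                length (xs ++ y ∷ zs) ≡ suc (length (xs ++ zs))
length-middle []       = refl
length-middle (_ ∷ xs) = ≡.cong suc (length-middle xs)

-- Two unrelated elements have no common partner, so each `x` may strike its own partner from `ys`.
-- With `R` as connectedness this counts components.
pigeonhole : {R : Rel A ℓ₁} → (∀ {x y} → R x y → R y x) → (∀ {x y z} → R x y → R y z → R x z) →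
             ∀ xs {ys} → AllPairs (λ x y → ¬ R x y) xs → All (λ x → Any (R x) ys) xs →
             length xs ≤ length ys
pigeonhole R-sym R-trans [] _ _ = z≤n
pigeonhole R-sym R-trans (x ∷ xs) (x≁xs ∷ xs≁) (i ∷ is)
  with y , y∈ys , Rxy ← ∈-find i
  with as , bs , refl ← ∈-∃++ y∈ys = ℕ.≤-trans
  (s≤s (pigeonhole R-sym R-trans xs xs≁ (All.zipWith (λ (x≁z , j) →
    drop-middle as j λ Rzy → x≁z (R-trans Rxy (R-sym Rzy))) (x≁xs , is))))
  (ℕ.≤-reflexive (≡.sym (length-middle as)))

filter-mono : {P : Pred A ℓ₁} {Q : Pred A ℓ₂} (P? : ∀ x → Dec (P x)) (Q? : ∀ x → Dec (Q x)) →
              (∀ {x} → P x → Q x) → ∀ xs → length (filter P? xs) ≤ length (filter Q? xs)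
filter-mono P? Q? P⊆Q [] = z≤n
filter-mono P? Q? P⊆Q (x ∷ xs) with ih ← filter-mono P? Q? P⊆Q xs | P? x | Q? x
... | yes _  | yes _  = s≤s ih
... | yes px | no ¬qx = contradiction (P⊆Q px) ¬qx
... | no _   | yes _  = ℕ.m≤n⇒m≤1+n ih
... | no _   | no _   = ih

filter-strict : {P : Pred A ℓ₁} {Q : Pred A ℓ₂} (P? : ∀ x → Dec (P x)) (Q? : ∀ x → Dec (Q x)) →
                (∀ {x} → P x → Q x) → ∀ {y xs} → y ∈ˡ xs → Q y → ¬ P y →
                length (filter P? xs) < length (filter Q? xs)
filter-strict P? Q? P⊆Q {y} {_ ∷ xs} (here refl) qy ¬py with P? y | Q? y
... | yes py | _      = contradiction py ¬py
... | no _   | no ¬qy = contradiction qy ¬qy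
... | no _   | yes _  = s≤s (filter-mono P? Q? P⊆Q xs)
filter-strict P? Q? P⊆Q {y} {x ∷ xs} (there y∈) qy ¬py
  with ih ← filter-strict P? Q? P⊆Q y∈ qy ¬py | P? x | Q? x
... | yes _  | yes _  = s≤s ih
... | yes px | no ¬qx = contradiction (P⊆Q px) ¬qx
... | no _   | yes _  = ℕ.m≤n⇒m≤1+n ih
... | no _   | no _   = ih

-- Edges, components and the cyclomatic number

module _ {n : ℕ} where

  open Graph

  _⊑ᴳ_ : Graph n → Graph n → Set
  H ⊑ᴳ G = ∀ {i j} → Adj H i j → Adj G i j

  connected-sym : (G : Graph n) {i j : Fin n} → Connected G i j → Connected G j i
  connected-sym G = Star.reverse (Adj-sym G)

  connected-decSetoid : Graph n → DecSetoid 0ℓ 0ℓ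
  connected-decSetoid G = record
    { _≈_              = Connected G
    ; isDecEquivalence = record
      { isEquivalence = record { refl = ε ; sym = connected-sym G ; trans = _◅◅_ }
      ; _≟_           = connected? G
      }
    }

  representatives : Graph n → List (Fin n)
  representatives G = deduplicate (connected? G) (allFin n)

  represented : (G : Graph n) (i : Fin n) → Any (Connected G i) (representatives G)
  represented G i = Any.deduplicate⁺ (connected? G)
    (λ y~x i~x → i~x ◅◅ connected-sym G y~x)
    (Any.map (λ { refl → ε }) (∈-allFin i))

  ω≤ : (G : Graph n) (xs : List (Fin n)) → (∀ i → Any (Connected G i) xs) → ω G ≤ length xs
  ω≤ G xs covered = pigeonhole (connected-sym G) _◅◅_ _
    (Unique.deduplicate-! (connected-decSetoid G) (allFin n)) (All.universal covered _)

  ω-mono : (G H : Graph n) → (∀ {i j} → Adj G i j → Connected H i j) → ω H ≤ ω G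
  ω-mono G H G⊆H = ω≤ H (representatives G) λ i → Any.map (Star.kleisliStar id G⊆H) (represented G i)

  pairs : List (Fin n × Fin n)
  pairs = cartesianProduct (allFin n) (allFin n)

  edge? : (G : Graph n) ((i , j) : Fin n × Fin n) → Dec (i Fin.< j × Adj G i j)
  edge? G (i , j) = (i Fin.<? j) ×-dec Adj? G i j

  edges-mono : (H G : Graph n) → H ⊑ᴳ G → length (edges H) ≤ length (edges G)
  edges-mono H G H⊑G = filter-mono (edge? H) (edge? G) (λ (i<j , e) → i<j , H⊑G e) pairs

  edges-strict : (H G : Graph n) → H ⊑ᴳ G → ∀ {u v} → Adj G u v → ¬ Adj H u v →
                 length (edges H) < length (edges G)
  edges-strict H G H⊑G {u} {v} uv ¬uv with Fin.<-cmp u v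
  ... | tri< u<v _ _ = filter-strict (edge? H) (edge? G) (λ (i<j , e) → i<j , H⊑G e)
    (∈-cartesianProduct⁺ (∈-allFin u) (∈-allFin v)) (u<v , uv) (¬uv ∘ proj₂)
  ... | tri≈ _ u≡v _ = contradiction uv (Adj-irrefl G u≡v)
  ... | tri> _ _ v<u = filter-strict (edge? H) (edge? G) (λ (i<j , e) → i<j , H⊑G e)
    (∈-cartesianProduct⁺ (∈-allFin v) (∈-allFin u)) (v<u , Adj-sym G uv) (¬uv ∘ Adj-sym H ∘ proj₂)

  Joins : Fin n → Fin n → Rel (Fin n) 0ℓ
  Joins u v i j = (i ≡ u × j ≡ v) ⊎ (i ≡ v × j ≡ u)

  addEdge : (H : Graph n) (u v : Fin n) → u ≢ v → Graph n
  addEdge H u v u≢v = record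
    { Adj        = λ i j → Adj H i j ⊎ Joins u v i j
    ; Adj?       = λ i j → Adj? H i j ⊎-dec
                     (((i Fin.≟ u) ×-dec (j Fin.≟ v)) ⊎-dec ((i Fin.≟ v) ×-dec (j Fin.≟ u)))
    ; Adj-sym    = λ { (inj₁ e) → inj₁ (Adj-sym H e)
                     ; (inj₂ (inj₁ (p , q))) → inj₂ (inj₂ (q , p))
                     ; (inj₂ (inj₂ (p , q))) → inj₂ (inj₁ (q , p)) }
    ; Adj-irrefl = λ { refl (inj₁ e) → Adj-irrefl H refl e
                     ; refl (inj₂ (inj₁ (refl , u≡v))) → u≢v u≡v
                     ; refl (inj₂ (inj₂ (refl , v≡u))) → u≢v (≡.sym v≡u) }
    }

  -- A walk that uses the new edge reaches an end of that edge beforehand.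
  addEdge-connected : (H : Graph n) {u v : Fin n} (u≢v : u ≢ v) {i j : Fin n} →
    Connected (addEdge H u v u≢v) i j → Connected H i j ⊎ (Connected H i u ⊎ Connected H i v)
  addEdge-connected H u≢v ε = inj₁ ε
  addEdge-connected H u≢v (inj₂ (inj₁ (refl , _)) ◅ _) = inj₂ (inj₁ ε)
  addEdge-connected H u≢v (inj₂ (inj₂ (refl , _)) ◅ _) = inj₂ (inj₂ ε)
  addEdge-connected H u≢v (inj₁ e ◅ w) with addEdge-connected H u≢v w
  ... | inj₁ p        = inj₁ (e ◅ p)
  ... | inj₂ (inj₁ p) = inj₂ (inj₁ (e ◅ p))
  ... | inj₂ (inj₂ p) = inj₂ (inj₂ (e ◅ p))

  -- In a list of representatives for the larger graph, replace the one standing for the component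
  -- of the new edge by both ends `u` and `v`; the result meets every component of `H`.
  ω-addEdge : (H : Graph n) {u v : Fin n} (u≢v : u ≢ v) → ω H ≤ suc (ω (addEdge H u v u≢v))
  ω-addEdge H {u} {v} u≢v
    with r , r∈ , u~r ← ∈-find (represented (addEdge H u v u≢v) u)
    with as , bs , reps≡ ← ∈-∃++ r∈ = ℕ.≤-trans (ω≤ H (u ∷ v ∷ as ++ bs) cover)
      (s≤s (ℕ.≤-reflexive (≡.sym (≡.trans (≡.cong length reps≡) (length-middle as)))))
    where
    H⁺ = addEdge H u v u≢v
    ends : ∀ {i j} → Connected H i j ⊎ (Connected H i u ⊎ Connected H i v) → ¬ Connected H i j →
           Any (Connected H i) (u ∷ v ∷ as ++ bs)
    ends (inj₁ p) ¬p = contradiction p ¬p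
    ends (inj₂ (inj₁ p)) _ = here p
    ends (inj₂ (inj₂ p)) _ = there (here p)
    to-u : ∀ {i} → Connected H⁺ i u → Any (Connected H i) (u ∷ v ∷ as ++ bs)
    to-u p with addEdge-connected H u≢v p
    ... | inj₁ q        = here q
    ... | inj₂ (inj₁ q) = here q
    ... | inj₂ (inj₂ q) = there (here q)
    cover : ∀ i → Any (Connected H i) (u ∷ v ∷ as ++ bs)
    cover i with connected? H⁺ i u
    ... | yes p = to-u p
    ... | no ¬p with s , s∈ , i~s ← ∈-find (drop-middle as
                       (≡.subst (Any (Connected H⁺ i)) reps≡ (represented H⁺ i))
                       λ i~r → ¬p (i~r ◅◅ connected-sym H⁺ u~r))
                with addEdge-connected H u≢v i~s
    ...   | inj₁ q        = there (there (Any.map (λ { refl → q }) s∈))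
    ...   | inj₂ (inj₁ q) = here q
    ...   | inj₂ (inj₂ q) = there (here q)

  -- The cyclomatic number shifted by the constant n. A new edge adds one to the edge count and
  -- merges at most two components, hence never lowers it.
  weight : Graph n → ℕ
  weight G = length (edges G) ℕ.+ ω G

  weight-ext : (H G : Graph n) → H ⊑ᴳ G → G ⊑ᴳ H → weight H ≤ weight G
  weight-ext H G H⊑G G⊑H = ℕ.+-mono-≤ (edges-mono H G H⊑G) (ω-mono G H (return ∘ G⊑H))

  weight-cycle : (H : Graph n) {u v : Fin n} (u≢v : u ≢ v) → ¬ Adj H u v → Connected H u v →
                 weight H < weight (addEdge H u v u≢v)
  weight-cycle H {u} {v} u≢v ¬uv u~v = ℕ.+-mono-≤
    (edges-strict H (addEdge H u v u≢v) inj₁ (inj₂ (inj₁ (refl , refl))) ¬uv)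
    (ω-mono _ H λ { (inj₁ e) → return e
                  ; (inj₂ (inj₁ (refl , refl))) → u~v
                  ; (inj₂ (inj₂ (refl , refl))) → connected-sym H u~v })

  weight-addEdge : (H : Graph n) {u v : Fin n} (u≢v : u ≢ v) → weight H ≤ weight (addEdge H u v u≢v)
  weight-addEdge H {u} {v} u≢v with Adj? H u v
  ... | yes uv = weight-ext H _ inj₁ λ { (inj₁ e) → e
                                       ; (inj₂ (inj₁ (refl , refl))) → uv
                                       ; (inj₂ (inj₂ (refl , refl))) → Adj-sym H uv }
  ... | no ¬uv = ℕ.≤-trans (ℕ.+-monoʳ-≤ _ (ω-addEdge H u≢v)) (ℕ.≤-trans
    (ℕ.≤-reflexive (ℕ.+-suc _ _))
    (ℕ.+-monoˡ-≤ _ (edges-strict H (addEdge H u v u≢v) inj₁ (inj₂ (inj₁ (refl , refl))) ¬uv)))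

  -- Interpolates between `H` and `G` edge by edge, which reduces monotonicity of the weight to a
  -- single added edge. Edges already present, or listed in both directions, do no harm.
  addEdges : (H G : Graph n) → List (Fin n × Fin n) → Graph n
  addEdges H G [] = H
  addEdges H G ((u , v) ∷ es) with Adj? G u v
  ... | yes uv = addEdge (addEdges H G es) u v λ u≡v → Adj-irrefl G u≡v uv
  ... | no  _  = addEdges H G es

  weight-addEdges : (H G : Graph n) (es : List (Fin n × Fin n)) → weight H ≤ weight (addEdges H G es)
  weight-addEdges H G [] = ℕ.≤-refl
  weight-addEdges H G ((u , v) ∷ es) with Adj? G u v
  ... | yes uv = ℕ.≤-trans (weight-addEdges H G es) (weight-addEdge (addEdges H G es) λ u≡v → Adj-irrefl G u≡v uv)
  ... | no  _  = weight-addEdges H G es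

  addEdges-⊑ : (H G : Graph n) → H ⊑ᴳ G → ∀ es → addEdges H G es ⊑ᴳ G
  addEdges-⊑ H G H⊑G [] e = H⊑G e
  addEdges-⊑ H G H⊑G ((u , v) ∷ es) e with Adj? G u v | e
  ... | no _   | e′      = addEdges-⊑ H G H⊑G es e′
  ... | yes _  | inj₁ e′ = addEdges-⊑ H G H⊑G es e′
  ... | yes uv | inj₂ (inj₁ (refl , refl)) = uv
  ... | yes uv | inj₂ (inj₂ (refl , refl)) = Adj-sym G uv

  addEdges-∋ : (H G : Graph n) → ∀ {es i j} → (i , j) ∈ˡ es → Adj G i j → Adj (addEdges H G es) i j
  addEdges-∋ H G {(u , v) ∷ es} i∈ ij with Adj? G u v | i∈
  ... | yes _ | here refl = inj₂ (inj₁ (refl , refl))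
  ... | no ¬e | here refl = contradiction ij ¬e
  ... | yes _ | there i∈′ = inj₁ (addEdges-∋ H G i∈′ ij)
  ... | no _  | there i∈′ = addEdges-∋ H G i∈′ ij

  weight-mono : (H G : Graph n) → H ⊑ᴳ G → weight H ≤ weight G
  weight-mono H G H⊑G = ℕ.≤-trans (weight-addEdges H G pairs) (weight-ext (addEdges H G pairs) G (addEdges-⊑ H G H⊑G pairs)
    (addEdges-∋ H G (∈-cartesianProduct⁺ (∈-allFin _) (∈-allFin _))))

  weight-strict : (H G : Graph n) → H ⊑ᴳ G → ∀ {u v} → Adj G u v → ¬ Adj H u v → Connected H u v →
                  weight H < weight G
  weight-strict H G H⊑G uv ¬uv u~v = ℕ.≤-trans (weight-cycle H u≢v ¬uv u~v)
    (weight-mono (addEdge H _ _ u≢v) G λ { (inj₁ e) → H⊑G e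
                       ; (inj₂ (inj₁ (refl , refl))) → uv
                       ; (inj₂ (inj₂ (refl , refl))) → Adj-sym G uv })
    where u≢v = λ u≡v → Adj-irrefl G u≡v uv

  edgeless : Graph n
  edgeless = record { Adj = λ _ _ → ⊥ ; Adj? = λ _ _ → no id ; Adj-sym = id ; Adj-irrefl = λ _ () }

  -- The edgeless graph has n components, and adding edges does not lower the weight. This makes the
  -- truncated subtraction in `cyclomatic` exact.
  n≤weight : (G : Graph n) → n ≤ weight G
  n≤weight G = ℕ.≤-trans n≤ω (ℕ.≤-trans (ℕ.m≤n+m _ _) (weight-mono edgeless G λ ()))
    where
    trivial : ∀ {i j} → Connected edgeless i j → i ≡ j
    trivial ε = refl
    n≤ω : n ≤ ω edgeless
    n≤ω = ℕ.≤-trans (ℕ.≤-reflexive (≡.sym (List.length-tabulate {n = n} id)))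
      (pigeonhole {R = _≡_} ≡.sym ≡.trans (allFin n) (Uniqueₚ.allFin⁺ n)
        (All.universal (λ i → Any.map trivial (represented edgeless i)) (allFin n)))

  cyclomatic : Graph n → ℕ
  cyclomatic G = weight G ℕ.∸ n

  θ≡cyclomatic : (G : Graph n) → θ G ≡ + cyclomatic G
  θ≡cyclomatic G = begin
    + e ℤ.- + n ℤ.+ + w       ≡⟨ ℤ.+-assoc (+ e) (ℤ.- + n) (+ w) ⟩
    + e ℤ.+ (ℤ.- + n ℤ.+ + w) ≡⟨ ≡.cong (λ z → + e ℤ.+ z) (ℤ.+-comm (ℤ.- + n) (+ w)) ⟩
    + e ℤ.+ (+ w ℤ.- + n)     ≡⟨ ℤ.+-assoc (+ e) (+ w) (ℤ.- + n) ⟨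
    + (e ℕ.+ w) ℤ.- + n       ≡⟨ ℤ.m-n≡m⊖n (e ℕ.+ w) n ⟩
    (e ℕ.+ w) ℤ.⊖ n           ≡⟨ ℤ.⊖-≥ (n≤weight G) ⟩
    + (e ℕ.+ w ℕ.∸ n)         ∎
    where
    open ≡.≡-Reasoning
    e = length (edges G)
    w = ω G

  cyclomatic-mono : (H G : Graph n) → H ⊑ᴳ G → cyclomatic H ≤ cyclomatic G
  cyclomatic-mono H G H⊑G = ℕ.∸-monoˡ-≤ n (weight-mono H G H⊑G)

  cyclomatic-strict : (H G : Graph n) → H ⊑ᴳ G → ∀ {u v} → Adj G u v → ¬ Adj H u v → Connected H u v →
                      cyclomatic H < cyclomatic G
  cyclomatic-strict H G H⊑G uv ¬uv u~v = ℕ.≤-trans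
    (ℕ.≤-reflexive (≡.sym (ℕ.+-∸-assoc 1 (n≤weight H))))
    (ℕ.∸-monoˡ-≤ n (weight-strict H G H⊑G uv ¬uv u~v))

  -- All n vertices are kept: a deleted vertex stays as an isolated one, which adds one both to the
  -- order and to ω and so leaves the cyclomatic number unaffected.
  induced : Graph n → Subset n → Graph n
  induced G S = record
    { Adj        = λ i j → i ∈ S × j ∈ S × Adj G i j
    ; Adj?       = λ i j → (i ∈? S) ×-dec ((j ∈? S) ×-dec Adj? G i j)
    ; Adj-sym    = λ (i∈ , j∈ , e) → j∈ , i∈ , Adj-sym G e
    ; Adj-irrefl = λ { refl (_ , _ , e) → Adj-irrefl G refl e }
    }

-- Induced subgraphs and their cycles

module Subgraphs {n : ℕ} (G : Graph n) where

  open Graph G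

  Walk : Subset n → Fin n → Fin n → Set
  Walk S = Connected (induced G S)

  τ : Subset n → ℕ
  τ S = cyclomatic (induced G S)

  walk-sym : ∀ S {i j} → Walk S i j → Walk S j i
  walk-sym S = connected-sym (induced G S)

  induced-mono : ∀ {S T} → T ⊆ S → induced G T ⊑ᴳ induced G S
  induced-mono T⊆S (i∈ , j∈ , e) = T⊆S i∈ , T⊆S j∈ , e

  walk-mono : ∀ {S T i j} → T ⊆ S → Walk T i j → Walk S i j
  walk-mono {S} {T} T⊆S = Star.map (induced-mono {S} {T} T⊆S)

  walk-end∈ : ∀ {S i j} → i ∈ S → Walk S i j → j ∈ S
  walk-end∈ i∈ ε = i∈
  walk-end∈ i∈ ((_ , k∈ , _) ◅ w) = walk-end∈ k∈ w

  adj⇒≢ : ∀ {i j} → Adj i j → i ≢ j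
  adj⇒≢ e i≡j = Adj-irrefl i≡j e

  nbr∈remove : ∀ S {x y} → Adj x y → y ∈ S → y ∈ S - x
  nbr∈remove S e y∈ = x∈p∧x≢y⇒x∈p-y y∈ (adj⇒≢ (Adj-sym e))

  -- Removing x separates neither of two distinct neighbours a and b from the other,
  -- so x lies on a cycle of the subgraph through a and b.
  record OnCycle (S : Subset n) (x : Fin n) : Set where
    constructor onCycle
    field
      {a b} : Fin n
      x∈    : x ∈ S
      a≢b   : a ≢ b
      a∈    : a ∈ S
      b∈    : b ∈ S
      xa    : Adj x a
      xb    : Adj x b
      walk  : Walk (S - x) a b

  onCycle-mono : ∀ {S T x} → T ⊆ S → OnCycle T x → OnCycle S x
  onCycle-mono {S} {T} {x} T⊆S (onCycle x∈ a≢b a∈ b∈ xa xb w) =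
    onCycle (T⊆S x∈) a≢b (T⊆S a∈) (T⊆S b∈) xa xb (walk-mono {S - x} {T - x} (remove-mono x T⊆S) w)

  onCycle? : ∀ S x → Dec (OnCycle S x)
  onCycle? S x with x ∈? S | Fin.any? (λ a → Fin.any? λ b → ¬? (a Fin.≟ b) ×-dec ((a ∈? S) ×-dec
    ((b ∈? S) ×-dec (Adj? x a ×-dec (Adj? x b ×-dec connected? (induced G (S - x)) a b)))))
  ... | no x∉  | _ = no (x∉ ∘ OnCycle.x∈)
  ... | yes x∈ | yes (a , b , a≢b , a∈ , b∈ , xa , xb , w) = yes (onCycle x∈ a≢b a∈ b∈ xa xb w)
  ... | yes _  | no none = no λ (onCycle {a} {b} _ a≢b a∈ b∈ xa xb w) →
    none (a , b , a≢b , a∈ , b∈ , xa , xb , w)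

  τ-mono : ∀ {S T} → T ⊆ S → τ T ≤ τ S
  τ-mono {S} {T} T⊆S = cyclomatic-mono (induced G T) (induced G S) (induced-mono {S} {T} T⊆S)

  τ-remove : ∀ S x → τ (S - x) ≤ τ S
  τ-remove S x = τ-mono {S} {S - x} (∈-remove⁻ S)

  private
    x∉-edge : ∀ S {x y} → ¬ Graph.Adj (induced G (S - x)) x y
    x∉-edge S (x∈ , _) = ∉-remove S _ x∈

    star : (H : Graph n) {x : Fin n} {y : Fin n} → Adj x y → Graph n
    star H {x} {y} xy = addEdge H x y (adj⇒≢ xy)

    star⊑ : ∀ {S H x y} (xy : Adj x y) → x ∈ S → y ∈ S → H ⊑ᴳ induced G S → star H xy ⊑ᴳ induced G S
    star⊑ xy x∈ y∈ H⊑ (inj₁ e) = H⊑ e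
    star⊑ xy x∈ y∈ H⊑ (inj₂ (inj₁ (refl , refl))) = x∈ , y∈ , xy
    star⊑ xy x∈ y∈ H⊑ (inj₂ (inj₂ (refl , refl))) = y∈ , x∈ , Adj-sym xy

    star-new : ∀ {H x y z} (xy : Adj x y) → ¬ Graph.Adj H x z → z ≢ y → ¬ Graph.Adj (star H xy) x z
    star-new xy ¬e z≢y (inj₁ e) = ¬e e
    star-new xy ¬e z≢y (inj₂ (inj₁ (_ , z≡y))) = z≢y z≡y
    star-new xy ¬e z≢y (inj₂ (inj₂ (refl , _))) = adj⇒≢ xy refl

    star-edge : ∀ {H x y} (xy : Adj x y) → Graph.Adj (star H xy) x y
    star-edge xy = inj₂ (inj₁ (refl , refl))

  -- Reinsert the edges at `x` one by one: once `xa` is present, `a` already connects `x` to `b`, so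
  -- `xb` closes a cycle.
  τ-onCycle : ∀ {S x} → OnCycle S x → τ (S - x) < τ S
  τ-onCycle {S} {x} (onCycle x∈ a≢b a∈ b∈ xa xb w) = ℕ.≤-trans
    (s≤s (cyclomatic-mono H H₁ inj₁))
    (cyclomatic-strict H₁ (induced G S) (star⊑ {S} {H} xa x∈ a∈ (induced-mono {S} {S - x} (∈-remove⁻ S)))
      (x∈ , b∈ , xb) (star-new {H} xa (x∉-edge S) (a≢b ∘ ≡.sym)) (star-edge {H} xa ◅ Star.map inj₁ w))
    where
    H  = induced G (S - x)
    H₁ = star H xa

  -- Reinserting `xa`, `xb`, `xd`, `xc` in this order, both `xb` and `xc` close a cycle.
  τ-onCycle₂ : ∀ {S x} (o : OnCycle S x) → ∀ {c d} → c ≢ OnCycle.a o → c ≢ OnCycle.b o → c ≢ d →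
               c ∈ S → d ∈ S → Adj x c → Adj x d → Walk (S - x) c d → suc (τ (S - x)) < τ S
  τ-onCycle₂ {S} {x} (onCycle x∈ a≢b a∈ b∈ xa xb w) c≢a c≢b c≢d c∈ d∈ xc xd w′ = ℕ.≤-trans
    (s≤s (s≤s (cyclomatic-mono H H₁ inj₁))) (ℕ.≤-trans
    (s≤s (cyclomatic-strict H₁ H₂ inj₁ (star-edge {H₁} xb)
      (star-new {H} xa (x∉-edge S) (a≢b ∘ ≡.sym)) (star-edge {H} xa ◅ Star.map inj₁ w))) (ℕ.≤-trans
    -- The vertex `d` may coincide with `a` or `b`, so the edge `xd` contributes monotonicity only.
    (s≤s (cyclomatic-mono H₂ H₃ inj₁))
    (cyclomatic-strict H₃ (induced G S)
      (star⊑ {S} {H₂} xd x∈ d∈ (star⊑ {S} {H₁} xb x∈ b∈ (star⊑ {S} {H} xa x∈ a∈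
        (induced-mono {S} {S - x} (∈-remove⁻ S)))))
      (x∈ , c∈ , xc)
      (star-new {H₂} xd (star-new {H₁} xb (star-new {H} xa (x∉-edge S) c≢a) c≢b) c≢d)
      (star-edge {H₂} xd ◅ Star.map (inj₁ ∘ inj₁ ∘ inj₁) (walk-sym (S - x) w′)))))
    where
    H  = induced G (S - x)
    H₁ = star H xa
    H₂ = star H₁ xb
    H₃ = star H₂ xd

  _Within_ : Cycle G → Subset n → Set
  C Within S = ∀ k → Cycle.vertex C k ∈ S

  -- Indexing by all natural numbers turns rotation into addition, and lets recurrences along the
  -- cycle run past its closing edge.
  module Periodic (C : Cycle G) where

    open Cycle C

    at : ℕ → Fin n
    at t = vertex (t mod order)

    toℕ-mod : ∀ t → toℕ (t mod order) ≡ t % order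
    toℕ-mod t = Fin.toℕ-fromℕ< (m%n<n t order)

    mod-cong : ∀ {s t} → s % order ≡ t % order → s mod order ≡ t mod order
    mod-cong {s} {t} eq = Fin.toℕ-injective (≡.trans (toℕ-mod s) (≡.trans eq (≡.sym (toℕ-mod t))))

    at-cong : ∀ {s t} → s % order ≡ t % order → at s ≡ at t
    at-cong {s} {t} eq = ≡.cong vertex (mod-cong {s} {t} eq)

    at-injective : ∀ {s t} → at s ≡ at t → s % order ≡ t % order
    at-injective {s} {t} eq = ≡.trans (≡.sym (toℕ-mod s))
      (≡.trans (≡.cong toℕ (injective eq)) (toℕ-mod t))

    %-shift : ∀ d {s t} → s % order ≡ t % order → (d ℕ.+ s) % order ≡ (d ℕ.+ t) % order
    %-shift d {s} {t} eq = ≡.trans (%-distribˡ-+ d s order)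
      (≡.trans (≡.cong (λ r → (d % order ℕ.+ r) % order) eq) (≡.sym (%-distribˡ-+ d t order)))

    at-shift : ∀ d s t → at s ≡ at t → at (d ℕ.+ s) ≡ at (d ℕ.+ t)
    at-shift d s t eq = at-cong {d ℕ.+ s} {d ℕ.+ t} (%-shift d {s} {t} (at-injective {s} {t} eq))

    at-period : ∀ t → at (t ℕ.+ order) ≡ at t
    at-period t = at-cong {t ℕ.+ order} {t} ([m+n]%n≡m%n t order)

    at-toℕ : ∀ k → at (toℕ k) ≡ vertex k
    at-toℕ k = ≡.cong vertex (Fin.toℕ-injective
      (≡.trans (toℕ-mod (toℕ k)) (m<n⇒m%n≡m (Fin.toℕ<n k))))

    at-next : ∀ t → vertex (next (t mod order)) ≡ at (suc t)
    at-next t = at-cong {suc (toℕ (t mod order))} {suc t}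
      (≡.trans (≡.cong (λ r → suc r % order) (toℕ-mod t)) (%-shift 1 {t % order} {t} (m%n%n≡m%n t order)))

    at-adjacent : ∀ t → Adj (at t) (at (suc t))
    at-adjacent t = ≡.subst (Adj (at t)) (at-next t) (adjacent (t mod order))

    at-suc-injective : ∀ s t → at (suc s) ≡ at (suc t) → at s ≡ at t
    at-suc-injective s t eq = ≡.trans (≡.sym (back s))
      (≡.trans (at-shift (2 ℕ.+ order-3) (suc s) (suc t) eq) (back t))
      where
      -- A further `order` - 1 steps complete the single step to a full round.
      back : ∀ r → at (2 ℕ.+ order-3 ℕ.+ suc r) ≡ at r
      back r = ≡.trans (≡.cong at (≡.trans (ℕ.+-suc _ r) (ℕ.+-comm _ r))) (at-period r)

    -- Going `order` - 1 steps forward instead of one step back needs no case for index 0.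
    predecessor : Fin order → ℕ
    predecessor k = toℕ k ℕ.+ (2 ℕ.+ order-3)

    at-predecessor : ∀ k → at (suc (predecessor k)) ≡ vertex k
    at-predecessor k = ≡.trans (≡.cong at (≡.sym (ℕ.+-suc (toℕ k) _)))
      (≡.trans (at-period (toℕ k)) (at-toℕ k))

    at-≢ : ∀ d t → 0 < d → d < order → at (d ℕ.+ t) ≢ at t
    at-≢ (suc d) t _ d<p eq = contradiction
      (≡.trans (≡.sym (m<n⇒m%n≡m d<p)) (≡.trans (≡.sym shifted) (≡.trans (at-injective {e ℕ.+ (suc d ℕ.+ t)} {e ℕ.+ t}
        (at-shift e (suc d ℕ.+ t) t eq)) unshifted))) λ ()
      where
      -- Chosen so that `e` + `t` is a multiple of `order`: the shift moves `t` to residue 0 and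
      -- leaves a nonzero residue to compare with.
      e = t ℕ.* (2 ℕ.+ order-3)
      round : e ℕ.+ t ≡ t ℕ.* order
      round = ≡.trans (ℕ.+-comm e t) (≡.sym (ℕ.*-suc t (2 ℕ.+ order-3)))
      shifted : (e ℕ.+ (suc d ℕ.+ t)) % order ≡ suc d % order
      shifted = ≡.trans (≡.cong (_% order) (≡.trans (ℕ.+-comm e _) (≡.trans (ℕ.+-assoc (suc d) t e)
        (≡.cong (suc d ℕ.+_) (≡.trans (ℕ.+-comm t e) round))))) ([m+kn]%n≡m%n (suc d) t order)
      unshifted : (e ℕ.+ t) % order ≡ 0
      unshifted = ≡.trans (≡.cong (_% order) round) ([m+kn]%n≡m%n 0 t order)

    at-skip : ∀ t → at t ≢ at (2 ℕ.+ t)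
    at-skip t eq = at-≢ 2 t (s≤s z≤n) (s≤s (s≤s (s≤s z≤n))) (≡.sym eq)

    at-onCycle : ∀ {S} → C Within S → ∀ t → OnCycle S (at (suc t))
    at-onCycle {S} C⊆S t = onCycle (C⊆S _) (at-skip t) (C⊆S _) (C⊆S _)
      (Adj-sym (at-adjacent t)) (at-adjacent (suc t))
      (walk-sym (S - x) (≡.subst (Walk (S - x) (at (2 ℕ.+ t))) (≡.trans
          (≡.cong at (ℕ.+-comm order t)) (at-period t))
        -- From index 2 + `t` it takes `order` - 2 steps to reach `order` + `t`, which is `t` again,
        -- without meeting `x`.
        (around (suc order-3) (s≤s (s≤s ℕ.≤-refl)))))
      where
      x = at (suc t)
      avoids : ∀ i → 2 ℕ.+ i ≤ order → at (2 ℕ.+ i ℕ.+ t) ∈ S - x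
      avoids i i< = x∈p∧x≢y⇒x∈p-y (C⊆S _)
        (≡.subst (λ s → at s ≢ x) (ℕ.+-suc (suc i) t) (at-≢ (suc i) (suc t) (s≤s z≤n) i<))
      around : ∀ i → 2 ℕ.+ i ≤ order → Walk (S - x) (at (2 ℕ.+ t)) (at (2 ℕ.+ i ℕ.+ t))
      around zero    _  = ε
      around (suc i) i< = around i i≤ ◅◅ return (avoids i i≤ , avoids (suc i) i< , at-adjacent (2 ℕ.+ i ℕ.+ t))
        where i≤ = ℕ.≤-trans (ℕ.n≤1+n _) i<

    vertex-onCycle : ∀ {S} → C Within S → ∀ k → OnCycle S (vertex k)
    vertex-onCycle {S} C⊆S k = ≡.subst (OnCycle S) (at-predecessor k) (at-onCycle C⊆S (predecessor k))

  Isolated : Subset n → Fin n → Set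
  Isolated S i = i ∈ S × (∀ {j} → j ∈ S → ¬ Adj i j)

  Leaf : Subset n → Fin n → Fin n → Set
  Leaf S i j = i ∈ S × j ∈ S × Adj i j × (∀ {k} → k ∈ S → Adj i k → k ≡ j)

  Branching : Subset n → Fin n → Set
  Branching S i = ∃[ a ] ∃[ b ] a ≢ b × a ∈ S × b ∈ S × Adj i a × Adj i b

  classify : ∀ S {i} → i ∈ S → Isolated S i ⊎ ((∃[ j ] Leaf S i j) ⊎ Branching S i)
  classify S {i} i∈ with Fin.any? (λ j → (j ∈? S) ×-dec Adj? i j)
  ... | no none = inj₁ (i∈ , λ j∈ ij → none (_ , j∈ , ij))
  ... | yes (j , j∈ , ij) with Fin.any? (λ k → ¬? (j Fin.≟ k) ×-dec ((k ∈? S) ×-dec Adj? i k))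
  ...   | yes (k , j≢k , k∈ , ik) = inj₂ (inj₂ (j , k , j≢k , j∈ , k∈ , ij , ik))
  ...   | no none = inj₂ (inj₁ (j , i∈ , j∈ , ij , unique))
    where
    unique : ∀ {k} → k ∈ S → Adj i k → k ≡ j
    unique {k} k∈ ik with j Fin.≟ k
    ... | yes j≡k = ≡.sym j≡k
    ... | no j≢k  = contradiction (k , j≢k , k∈ , ik) none

  private
    -- The path is grown at the end `f 0`; values of `f` beyond `m` are fillers.
    record Path (S : Subset n) (m : ℕ) : Set where
      field
        f     : ℕ → Fin n
        f∈    : ∀ i → f i ∈ S
        f-inj : ∀ {i j} → i ≤ m → j ≤ m → f i ≡ f j → i ≡ j
        f-adj : ∀ {i} → i < m → Adj (f i) (f (suc i))

    path-bound : ∀ {S m} → Path S m → m < n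
    path-bound P = Fin.injective⇒≤ {f = λ k → f (toℕ k)} λ {k} {l} eq →
      Fin.toℕ-injective (f-inj (ℕ.≤-pred (Fin.toℕ<n k)) (ℕ.≤-pred (Fin.toℕ<n l)) eq)
      where open Path P

    close : ∀ {S m} (P : Path S m) {u} k → 2 ℕ.+ k ≤ m → Path.f P (2 ℕ.+ k) ≡ u → Adj (Path.f P 0) u →
            Σ (Cycle G) (_Within S)
    close {S} {m} P {u} k k≤m fk≡u 0u = C , λ l → f∈ (toℕ l)
      where
      open Path P
      below : ∀ (l : Fin (3 ℕ.+ k)) → toℕ l ≤ m
      below l = ℕ.≤-trans (ℕ.≤-pred (Fin.toℕ<n l)) k≤m
      step : ∀ (l : Fin (3 ℕ.+ k)) → Adj (f (toℕ l)) (f (toℕ (suc (toℕ l) mod (3 ℕ.+ k))))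
      step l with ℕ.m≤n⇒m<n∨m≡n (Fin.toℕ<n l)
      ... | inj₁ l< = ≡.subst (Adj (f (toℕ l)) ∘ f)
              (≡.sym (≡.trans (Fin.toℕ-fromℕ< (m%n<n (suc (toℕ l)) (3 ℕ.+ k))) (m<n⇒m%n≡m l<)))
              (f-adj (ℕ.≤-trans (ℕ.≤-pred l<) k≤m))
      ... | inj₂ l≡ = ≡.subst₂ (λ s t → Adj (f s) (f t)) (≡.sym (ℕ.suc-injective l≡))
              (≡.sym (≡.trans (Fin.toℕ-fromℕ< (m%n<n (suc (toℕ l)) (3 ℕ.+ k)))
                (≡.trans (≡.cong (_% (3 ℕ.+ k)) l≡) (n%n≡0 (3 ℕ.+ k)))))
              (≡.subst (λ v → Adj v (f 0)) (≡.sym fk≡u) (Adj-sym 0u))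
      C : Cycle G
      C = record
        { order-3   = k
        ; vertex    = λ l → f (toℕ l)
        ; injective = λ {l} {l′} eq → Fin.toℕ-injective (f-inj (below l) (below l′) eq)
        ; adjacent  = step
        }

    extend : ∀ {S m} (P : Path S m) {u} → u ∈ S → Adj (Path.f P 0) u →
             (∀ k → k ≤ m → Path.f P k ≢ u) → Path S (suc m)
    extend {S} {m} P {u} u∈ 0u new = record { f = f′ ; f∈ = f′∈ ; f-inj = inj ; f-adj = adj }
      where
      open Path P
      f′ : ℕ → Fin n
      f′ zero    = u
      f′ (suc i) = f i
      f′∈ : ∀ i → f′ i ∈ S
      f′∈ zero    = u∈
      f′∈ (suc i) = f∈ i
      inj : ∀ {i j} → i ≤ suc m → j ≤ suc m → f′ i ≡ f′ j → i ≡ j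
      inj {zero}  {zero}  _ _ _ = refl
      inj {zero}  {suc j} _ (s≤s j≤) eq = contradiction (≡.sym eq) (new j j≤)
      inj {suc i} {zero}  (s≤s i≤) _ eq = contradiction eq (new i i≤)
      inj {suc i} {suc j} (s≤s i≤) (s≤s j≤) eq = ≡.cong suc (f-inj i≤ j≤ eq)
      adj : ∀ {i} → i < suc m → Adj (f′ i) (f′ (suc i))
      adj {zero}  _ = Adj-sym 0u
      adj {suc i} (s≤s i<) = f-adj i<

  -- A path that cannot be extended closes up.
  branching⇒cycle : ∀ S {i} → i ∈ S → (∀ {i} → i ∈ S → Branching S i) → Σ (Cycle G) (_Within S)
  branching⇒cycle S {i₀} i₀∈ branch = grow n 0 (ℕ.≤-reflexive (≡.sym (ℕ.+-identityʳ n))) start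
    where
    start : Path S 0
    start = record { f = λ _ → i₀ ; f∈ = λ _ → i₀∈ ; f-inj = λ { z≤n z≤n _ → refl } ; f-adj = λ () }
    -- Avoiding `f 1` keeps the path from turning straight back, so a repeated vertex closes a cycle
    -- of length at least three.
    onward : ∀ {m} (P : Path S m) → ∃[ u ] u ∈ S × Adj (Path.f P 0) u × u ≢ Path.f P 1
    onward P with a , b , a≢b , a∈ , b∈ , xa , xb ← branch (Path.f∈ P 0) | a Fin.≟ Path.f P 1
    ... | yes a≡ = b , b∈ , xb , λ b≡ → a≢b (≡.trans a≡ (≡.sym b≡))
    ... | no a≢  = a , a∈ , xa , a≢
    grow : ∀ fuel m → n ≤ fuel ℕ.+ m → Path S m → Σ (Cycle G) (_Within S)
    grow zero m n≤m P = contradiction n≤m (ℕ.<⇒≱ (path-bound P))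
    grow (suc fuel) m n≤ P with u , u∈ , 0u , u≢ ← onward P
                           with Fin.any? (λ (k : Fin (suc m)) → Path.f P (toℕ k) Fin.≟ u)
    ... | no new = grow fuel (suc m) (ℕ.≤-trans n≤ (ℕ.≤-reflexive (≡.sym (ℕ.+-suc fuel m))))
            (extend P u∈ 0u λ k k≤ eq → new (Fin.fromℕ< (s≤s k≤) ,
              ≡.trans (≡.cong (Path.f P) (Fin.toℕ-fromℕ< (s≤s k≤))) eq))
    ... | yes (k , eq) with toℕ k | ℕ.≤-pred (Fin.toℕ<n k)
    ...   | 0           | _  = contradiction (≡.sym eq) (adj⇒≢ (Adj-sym 0u))
    ...   | 1           | _  = contradiction (≡.sym eq) u≢
    ...   | suc (suc l) | l≤ = close P l l≤ eq 0u

-- Hermitian weights and deletion of a vertex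

record InvolutiveField c ℓ : Set (lsuc (c ⊔ ℓ)) where
  field
    field′ : DiscreteField c ℓ
  open DiscreteField field′ public
  field
    conj            : Carrier → Carrier
    conj-cong       : ∀ {x y} → x ≈ y → conj x ≈ conj y
    conj-+          : ∀ x y → conj (x + y) ≈ conj x + conj y
    conj-*          : ∀ x y → conj (x * y) ≈ conj x * conj y
    conj-0          : conj 0# ≈ 0#
    conj-involutive : ∀ x → conj (conj x) ≈ x
    2≉0             : ¬ 1# + 1# ≈ 0#

module Weights (K : InvolutiveField c ℓ) {n : ℕ} (G : Graph n) where

  open InvolutiveField K hiding (zero; refl; _-_)
  open InvolutiveField K using () renaming (refl to ≈-refl)
  open SemiringSum semiring
  open SetoidReasoning setoid
  open Dimension field′
  open Graph G
  open Subgraphs G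

  sum-zero : ∀ {m} (f : Fin m → Carrier) → (∀ i → f i ≈ 0#) → sum f ≈ 0#
  sum-zero {m} f f≈0 = trans (sum-cong-≋ {m} f≈0) (sum-replicate-zero m)

  sum-single : ∀ {m} (f : Fin m → Carrier) (k : Fin m) → (∀ i → i ≢ k → f i ≈ 0#) → sum f ≈ f k
  sum-single f zero f≈0 = trans
    (+-congˡ (sum-zero (f ∘ suc) λ i → f≈0 (suc i) λ ())) (+-identityʳ _)
  sum-single f (suc k) f≈0 = trans
    (+-cong (f≈0 zero λ ()) (sum-single (f ∘ suc) k λ i i≢k → f≈0 (suc i) (i≢k ∘ Fin.suc-injective)))
    (+-identityˡ _)

  sum-pair : ∀ {m} (f : Fin m → Carrier) (k l : Fin m) → k ≢ l →
             (∀ i → i ≢ k → i ≢ l → f i ≈ 0#) → sum f ≈ f k + f l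
  sum-pair f zero zero k≢l _ = contradiction refl k≢l
  sum-pair f zero (suc l) _ f≈0 = +-congˡ (sum-single (f ∘ suc) l
    λ i i≢l → f≈0 (suc i) (λ ()) (i≢l ∘ Fin.suc-injective))
  sum-pair f (suc k) zero _ f≈0 = trans (+-congˡ (sum-single (f ∘ suc) k
    λ i i≢k → f≈0 (suc i) (i≢k ∘ Fin.suc-injective) λ ())) (+-comm _ _)
  sum-pair f (suc k) (suc l) k≢l f≈0 = trans
    (+-cong (f≈0 zero (λ ()) λ ()) (sum-pair (f ∘ suc) k l (k≢l ∘ ≡.cong suc)
      λ i i≢k i≢l → f≈0 (suc i) (i≢k ∘ Fin.suc-injective) (i≢l ∘ Fin.suc-injective)))
    (+-identityˡ _)

  conj-sum : ∀ {m} (f : Fin m → Carrier) → conj (sum f) ≈ sum (conj ∘ f)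
  conj-sum {zero}  f = conj-0
  conj-sum {suc m} f = trans (conj-+ _ _) (+-congˡ (conj-sum (f ∘ suc)))

  conj≉0 : ∀ {x} → ¬ x ≈ 0# → ¬ conj x ≈ 0#
  conj≉0 x≉0 x̄≈0 = x≉0 (trans (sym (conj-involutive _)) (trans (conj-cong x̄≈0) conj-0))

  -- Common form of both adjacency matrices: for a number of modulus 1 the conjugate is the inverse,
  -- which is all that `on-edge` retains of the gains.
  record Weight : Set (c ⊔ ℓ) where
    field
      entry     : Fin n → Fin n → Carrier
      hermitian : ∀ i j → entry j i ≈ conj (entry i j)
      off-edge  : ∀ {i j} → ¬ Adj i j → entry i j ≈ 0#
      on-edge   : ∀ {i j} → Adj i j → entry i j * entry j i ≈ 1#

  module Nullity (W : Weight) where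

    open Weight W

    ker : Subset n → Subspace n
    ker = kernel entry

    infix 10 _·_
    _·_ : Fin n → Vec′ n → Carrier
    i · x = ⟦ row entry i ⟧ x

    ν : Subset n → ℕ
    ν = nullity entry

    Ker : Subset n → Vec′ n → Set ℓ
    Ker S = Member (ker S)

    entry≉0 : ∀ {i j} → Adj i j → ¬ entry i j ≈ 0#
    entry≉0 e = unit≉0 (trans (*-comm _ _) (on-edge e))

    vanishing-term : ∀ {i j} (x : Vec′ n) → (Adj i j → x j ≈ 0#) → entry i j * x j ≈ 0#
    vanishing-term {i} {j} x x≈0 with Adj? i j
    ... | yes e = trans (*-congˡ (x≈0 e)) (zeroʳ _)
    ... | no ¬e = trans (*-congʳ (off-edge ¬e)) (zeroˡ _)

    row-zero : ∀ i {x : Vec′ n} → (∀ j → Adj i j → x j ≈ 0#) → i · x ≈ 0#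
    row-zero i {x} x≈0 = sum-zero _ λ j → vanishing-term x (x≈0 j)

    row-cong : ∀ i {x y : Vec′ n} → (∀ j → Adj i j → x j ≈ y j) → i · x ≈ i · y
    row-cong i {x} {y} x≈y = sum-cong-≋ {n} λ j → term j
      where
      term : ∀ j → entry i j * x j ≈ entry i j * y j
      term j with Adj? i j
      ... | yes e = *-congˡ (x≈y j e)
      ... | no ¬e = trans (trans (*-congʳ (off-edge ¬e)) (zeroˡ _)) (sym (trans (*-congʳ (off-edge ¬e)) (zeroˡ _)))

    row-single : ∀ i k {x : Vec′ n} → (∀ j → Adj i j → j ≢ k → x j ≈ 0#) → i · x ≈ entry i k * x k
    row-single i k {x} x≈0 = sum-single _ k λ j j≢k → vanishing-term x λ e → x≈0 j e j≢k

    row-pair : ∀ i k l {x : Vec′ n} → k ≢ l → (∀ j → Adj i j → j ≢ k → j ≢ l → x j ≈ 0#) →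
               i · x ≈ entry i k * x k + entry i l * x l
    row-pair i k l {x} k≢l x≈0 = sum-pair _ k l k≢l λ j j≢k j≢l → vanishing-term x λ e → x≈0 j e j≢k j≢l

    -- Terms from the theory of eigenvalue multiplicities. The witnessing vectors are kept because
    -- later arguments transport them between vertex sets.
    Downer Parter : Subset n → Fin n → Set (c ⊔ ℓ)
    Downer S x = ∃[ z ] Ker S z × ¬ z x ≈ 0#
    Parter S x = ∃[ y ] Ker (S - x) y × ¬ x · y ≈ 0#

    -- Evaluate the Hermitian form at z and y in two ways.
    orthogonal : ∀ S {x y z} → Ker S z → Ker (S - x) y → conj (z x) * (x · y) ≈ 0#
    orthogonal S {x} {y} {z} (z-supp , Az) (y-supp , Ay) = begin
      conj (z x) * (x · y)
        ≈⟨ sum-single _ x vanish ⟨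
      ∑[ i < n ] (conj (z i) * (i · y))
        ≈⟨ sum-cong-≋ {n} (λ i → *-distribˡ-sum {n} (conj (z i)) _) ⟩
      ∑[ i < n ] ∑[ j < n ] (conj (z i) * (entry i j * y j))
        ≈⟨ ∑-comm {n} {n} (λ i j → conj (z i) * (entry i j * y j)) ⟩
      ∑[ j < n ] ∑[ i < n ] (conj (z i) * (entry i j * y j))
        ≈⟨ sum-zero _ column ⟩
      0# ∎
      where
      vanish : ∀ i → i ≢ x → conj (z i) * (i · y) ≈ 0#
      vanish i i≢x with i ∈? S
      ... | yes i∈ = trans (*-congˡ (Ay i (x∈p∧x≢y⇒x∈p-y i∈ i≢x))) (zeroʳ _)
      ... | no i∉  = trans (*-congʳ (trans (conj-cong (z-supp i i∉)) conj-0)) (zeroˡ _)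
      column : ∀ j → ∑[ i < n ] (conj (z i) * (entry i j * y j)) ≈ 0#
      column j = begin
        ∑[ i < n ] (conj (z i) * (entry i j * y j))
          ≈⟨ sum-cong-≋ {n} (λ i → trans (sym (*-assoc _ _ _)) (*-congʳ
               (trans (*-congˡ (hermitian j i)) (trans (sym (conj-* _ _)) (conj-cong (*-comm _ _)))))) ⟩
        ∑[ i < n ] (conj (entry j i * z i) * y j)
          ≈⟨ *-distribʳ-sum {n} (y j) _ ⟨
        ∑[ i < n ] conj (entry j i * z i) * y j
          ≈⟨ *-congʳ (conj-sum {n} _) ⟨
        conj (j · z) * y j
          ≈⟨ last ⟩
        0# ∎
        where
        last : conj (j · z) * y j ≈ 0#
        last with j ∈? S
        ... | yes j∈ = trans (*-congʳ (trans (conj-cong (Az j j∈)) conj-0)) (zeroˡ _)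
        ... | no j∉  = trans (*-congˡ (y-supp j (j∉ ∘ ∈-remove⁻ S))) (zeroʳ _)

    downer⇒row-vanishes : ∀ S {x} → Downer S x → ∀ {y} → Ker (S - x) y → x · y ≈ 0#
    downer⇒row-vanishes S (z , z∈ , z≉0) y∈ = product-zero (trans (*-comm _ _) (orthogonal S z∈ y∈)) (conj≉0 z≉0)

    parter⇒¬downer : ∀ S {x} → Parter S x → ¬ Downer S x
    parter⇒¬downer S (y , y∈ , y≉0) d = y≉0 (downer⇒row-vanishes S d y∈)

    data Step (S : Subset n) (x : Fin n) : Set (c ⊔ ℓ) where
      downer  : Downer S x → ν S ≡ suc (ν (S - x)) → Step S x
      neutral : ¬ Downer S x → ¬ Parter S x → ν S ≡ ν (S - x) → Step S x
      parter  : Parter S x → ν (S - x) ≡ suc (ν S) → Step S x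

    extend-kernel : ∀ S {x y} → Ker (S - x) y → x · y ≈ 0# → Ker S y
    extend-kernel S {x} {y} (supp , Ay) Ayₓ = (λ j j∉ → supp j (j∉ ∘ ∈-remove⁻ S)) , rows
      where
      rows : ∀ i → i ∈ S → i · y ≈ 0#
      rows i i∈ with i Fin.≟ x
      ... | yes refl = Ayₓ
      ... | no i≢x   = Ay i (x∈p∧x≢y⇒x∈p-y i∈ i≢x)

    restrict-kernel : ∀ S {x z} → Ker S z → z x ≈ 0# → Ker (S - x) z
    restrict-kernel S {x} {z} (supp , Az) zₓ = supp′ , λ i i∈ → Az i (∈-remove⁻ S i∈)
      where
      supp′ : ∀ j → j ∉ S - x → z j ≈ 0#
      supp′ j j∉ with j Fin.≟ x
      ... | yes refl = zₓ
      ... | no j≢x   = supp j λ j∈ → j∉ (x∈p∧x≢y⇒x∈p-y j∈ j≢x)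

    -- The kernel vectors on `S` that vanish at `x` are the kernel vectors on `S - x` that satisfy
    -- the row of `x`. This common space has codimension 0 or 1 in each kernel, and `orthogonal`
    -- forbids 1 in both.
    step : ∀ S {x} → x ∈ S → Step S x
    step S {x} x∈ = go refl refl (hyperplane (coordinate x) (dim-kernel entry S))
                                 (hyperplane (row entry x) (dim-kernel entry (S - x)))
      where
      same : ∀ {d e} → Dim (ker S ∧ coordinate x) d → Dim (ker (S - x) ∧ row entry x) e → d ≡ e
      same = dim-unique (λ (z∈ , zₓ) → restrict-kernel S z∈ zₓ , proj₂ z∈ x x∈)
                        (λ (y∈ , Ayₓ) → extend-kernel S y∈ Ayₓ , proj₁ y∈ x (∉-remove S x))
      go : ∀ {d e} → ν S ≡ d → ν (S - x) ≡ e → Hyperplane (ker S) (coordinate x) d →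
           Hyperplane (ker (S - x)) (row entry x) e → Step S x
      go d≡ e≡ (flat van D) (flat van′ E) =
        neutral (λ (z , z∈ , z≉0) → z≉0 (van z∈)) (λ (y , y∈ , y≉0) → y≉0 (van′ y∈)) (≡.trans d≡ (≡.trans (same D E) (≡.sym e≡)))
      go d≡ e≡ (proper z∈ z≉0 D) (flat _ E) =
        downer (_ , z∈ , z≉0) (≡.trans d≡ (≡.cong suc (≡.trans (same D E) (≡.sym e≡))))
      go d≡ e≡ (flat _ D) (proper y∈ y≉0 E) =
        parter (_ , y∈ , y≉0) (≡.trans e≡ (≡.cong suc (≡.trans (≡.sym (same D E)) (≡.sym d≡))))
      go d≡ e≡ (proper z∈ z≉0 _) (proper y∈ y≉0 _) =
        contradiction (_ , z∈ , z≉0) (parter⇒¬downer S (_ , y∈ , y≉0))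

    downer⇒ν : ∀ S {x} → x ∈ S → Downer S x → ν S ≡ suc (ν (S - x))
    downer⇒ν S x∈ d with step S x∈
    ... | downer _ eq   = eq
    ... | neutral ¬d _ _ = contradiction d ¬d
    ... | parter p _    = contradiction d (parter⇒¬downer S p)

    parter⇒ν : ∀ S {x} → x ∈ S → Parter S x → ν (S - x) ≡ suc (ν S)
    parter⇒ν S x∈ p with step S x∈
    ... | downer d _     = contradiction d (parter⇒¬downer S p)
    ... | neutral _ ¬p _ = contradiction p ¬p
    ... | parter _ eq    = eq

    ν⇒downer : ∀ S {x} → x ∈ S → suc (ν (S - x)) ≤ ν S → Downer S x
    ν⇒downer S x∈ ν< with step S x∈
    ... | downer d _     = d
    ... | neutral _ _ eq = contradiction (≡.sym eq) (ℕ.<⇒≢ ν<)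
    ... | parter _ eq    = contradiction (ℕ.≤-trans (ℕ.n≤1+n _) ν<) (ℕ.<⇒≱ (ℕ.≤-reflexive (≡.sym eq)))

    ν⇒parter : ∀ S {x} → x ∈ S → suc (ν S) ≤ ν (S - x) → Parter S x
    ν⇒parter S x∈ ν< with step S x∈
    ... | downer _ eq    = contradiction (ℕ.≤-trans (ℕ.n≤1+n _) ν<) (ℕ.<⇒≱ (ℕ.≤-reflexive (≡.sym eq)))
    ... | neutral _ _ eq = contradiction eq (ℕ.<⇒≢ ν<)
    ... | parter p _     = p

    ν-remove-≤ : ∀ S {x} → x ∈ S → ν S ≤ suc (ν (S - x))
    ν-remove-≤ S x∈ with step S x∈
    ... | downer _ eq    = ℕ.≤-reflexive eq
    ... | neutral _ _ eq = ℕ.m≤n⇒m≤1+n (ℕ.≤-reflexive eq)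
    ... | parter _ eq    = ℕ.m≤n⇒m≤1+n (ℕ.≤-trans (ℕ.n≤1+n _) (ℕ.≤-reflexive (≡.sym eq)))

    ν-remove-≥ : ∀ S {x} → x ∈ S → ν (S - x) ≤ suc (ν S)
    ν-remove-≥ S x∈ with step S x∈
    ... | downer _ eq    = ℕ.m≤n⇒m≤1+n (ℕ.≤-trans (ℕ.n≤1+n _) (ℕ.≤-reflexive (≡.sym eq)))
    ... | neutral _ _ eq = ℕ.m≤n⇒m≤1+n (ℕ.≤-reflexive (≡.sym eq))
    ... | parter _ eq    = ℕ.≤-reflexive eq

    unit·≈0 : ∀ {i k} → ¬ Adj k i → k · unitVector i ≈ 0#
    unit·≈0 {i} {k} ¬e = row-zero k λ j e → unitVector-other {i = j} λ { refl → ¬e e }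

    unit∈ker : ∀ S {i} → Isolated S i → Ker S (unitVector i)
    unit∈ker S (i∈ , alone) = unitVector∈ i∈ , λ k k∈ → unit·≈0 (alone k∈ ∘ Adj-sym)

    unit-downer : ∀ S {i} → Isolated S i → Downer S i
    unit-downer S {i} iso = unitVector i , unit∈ker S iso
      , λ 1≈0 → 1≉0 (trans (sym (unitVector-self i)) 1≈0)

    ν-isolated : ∀ S {i} → Isolated S i → ν S ≡ suc (ν (S - i))
    ν-isolated S iso@(i∈ , _) = downer⇒ν S i∈ (unit-downer S iso)

    leaf⇒isolated : ∀ S {i j} → Leaf S i j → Isolated (S - j) i
    leaf⇒isolated S (i∈ , j∈ , ij , only) = x∈p∧x≢y⇒x∈p-y i∈ (adj⇒≢ ij) ,
      λ k∈ ik → ∈-remove⇒≢ S k∈ (only (∈-remove⁻ S k∈) ik)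

    -- Delete `j` first: this isolates `i`, whose unit vector violates row `j`, so the nullity rises
    -- by one. Deleting the isolated `i` lowers it again.
    ν-leaf : ∀ S {i j} → Leaf S i j → ν (S - i - j) ≡ ν S
    ν-leaf S {i} {j} leaf@(i∈ , j∈ , ij , _) = ℕ.suc-injective (≡.trans
      (≡.cong (suc ∘ ν) (p─x─y≡p─y─x S i j))
      (≡.trans (≡.sym (ν-isolated (S - j) iso)) (parter⇒ν S j∈ p)))
      where
      iso = leaf⇒isolated S leaf
      p : Parter S j
      p = unitVector i , unit∈ker (S - j) iso , λ e≈0 →
        entry≉0 (Adj-sym ij) (trans (sym (*-identityʳ _)) (trans (*-congˡ (sym (unitVector-self i)))
          (trans (sym (row-single j i λ _ _ k≢i → unitVector-other k≢i)) e≈0)))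

    ν-empty : ∀ S → (∀ {i} → i ∉ S) → ν S ≡ 0
    ν-empty S empty = dim-trivial (λ (supp , _) j → supp j empty) (dim-kernel entry S)

-- Induction on vertex sets

subset-induction : (P : Subset n → Set ℓ) →
                   (∀ S → (∀ T → ∣ T ∣ < ∣ S ∣ → P T) → P S) → ∀ S → P S
subset-induction P ind S = go (suc ∣ S ∣) S ℕ.≤-refl
  where
  go : ∀ s S → ∣ S ∣ < s → P S
  go (suc s) S ∣S∣≤s = ind S λ T ∣T∣<∣S∣ → go s T (ℕ.≤-trans ∣T∣<∣S∣ (ℕ.≤-pred ∣S∣≤s))

∣remove₂∣< : (S : Subset n) {i j : Fin n} → i ∈ S → j ∈ S - i → ∣ S - i - j ∣ < ∣ S ∣
∣remove₂∣< S i∈ j∈ = ℕ.≤-trans (x∈p⇒∣p-x∣<∣p∣ j∈) (ℕ.≤-trans (ℕ.n≤1+n _) (x∈p⇒∣p-x∣<∣p∣ i∈))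

module Shapes {n : ℕ} (G : Graph n) where

  open Graph G
  open Subgraphs G

  branching? : ∀ S i → Dec (Branching S i)
  branching? S i = Fin.any? λ a → Fin.any? λ b → ¬? (a Fin.≟ b) ×-dec
    ((a ∈? S) ×-dec ((b ∈? S) ×-dec (Adj? i a ×-dec Adj? i b)))

  -- The cases of the inductions below: when every vertex has two neighbours in a nonempty `S`,
  -- there is a cycle.
  data Shape (S : Subset n) : Set where
    empty    : (∀ {i} → i ∉ S) → Shape S
    isolated : ∀ {i} → Isolated S i → Shape S
    leaf     : ∀ {i j} → Leaf S i j → Shape S
    cyclic   : (C : Cycle G) → C Within S → Shape S

  shape : ∀ S → Shape S
  shape S with Subset.nonempty? S | Fin.any? (λ i → (i ∈? S) ×-dec ¬? (branching? S i))
  ... | no none      | _ = empty λ i∈ → none (_ , i∈)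
  ... | yes (_ , i∈) | no none
        with C , C⊆S ← branching⇒cycle S i∈ (λ {i} i∈ → decidable-stable (branching? S i)
               λ ¬b → none (i , i∈ , ¬b)) = cyclic C C⊆S
  ... | yes _        | yes (i , i∈ , ¬b) with classify S i∈
  ...   | inj₁ iso            = isolated iso
  ...   | inj₂ (inj₁ (_ , l)) = leaf l
  ...   | inj₂ (inj₂ b)       = contradiction b ¬b

  leaf-nbr∈ : ∀ {S i j} → Leaf S i j → j ∈ S - i
  leaf-nbr∈ {S} (_ , j∈ , ij , _) = nbr∈remove S ij j∈

  remove₂⊆ : ∀ (S : Subset n) i j → S - i - j ⊆ S
  remove₂⊆ S i j = ∈-remove⁻ S ∘ ∈-remove⁻ (S - i)

-- Arithmetic of the bound g ≤ f + 2t

double-suc : ∀ f t → f ℕ.+ (suc t ℕ.+ suc t) ≡ suc (suc (f ℕ.+ (t ℕ.+ t)))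
double-suc f t = ≡.trans (ℕ.+-suc f _) (≡.cong suc
  (≡.trans (≡.cong (f ℕ.+_) (ℕ.+-suc t t)) (ℕ.+-suc f _)))

double-mono : ∀ f {s t} → s ≤ t → f ℕ.+ (s ℕ.+ s) ≤ f ℕ.+ (t ℕ.+ t)
double-mono f s≤t = ℕ.+-monoʳ-≤ f (ℕ.+-mono-≤ s≤t s≤t)

double-cancel : ∀ f {s t} → f ℕ.+ (s ℕ.+ s) ≤ f ℕ.+ (t ℕ.+ t) → s ≤ t
double-cancel f {s} {t} le = ℕ.≮⇒≥ λ t<s →
  ℕ.<⇒≱ (ℕ.+-mono-< t<s t<s) (ℕ.+-cancelˡ-≤ f _ _ le)

-- Deletion of a cycle vertex: `g`, `f`, `t` stand for ν(G), ν(Φ), τ before it and the primed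
-- letters for the values after it. The loss in `g`, the gain in `f` and the drop of 2`t` just
-- balance, so equality before forces every estimate to be an equality.
module _ {g g′ f f′ t t′ : ℕ} (g≤ : g ≤ suc g′) (f′≤ : f′ ≤ suc f)
         (bound′ : g′ ≤ f′ ℕ.+ (t′ ℕ.+ t′)) (t> : t′ < t) where

  open ℕ.≤-Reasoning

  cut-bound : g ≤ f ℕ.+ (t ℕ.+ t)
  cut-bound = begin
    g                                  ≤⟨ g≤ ⟩
    suc g′                             ≤⟨ s≤s bound′ ⟩
    suc (f′ ℕ.+ (t′ ℕ.+ t′))           ≤⟨ s≤s (ℕ.+-monoˡ-≤ _ f′≤) ⟩
    suc (suc (f ℕ.+ (t′ ℕ.+ t′)))      ≡⟨ double-suc f t′ ⟨
    f ℕ.+ (suc t′ ℕ.+ suc t′)          ≤⟨ double-mono f t> ⟩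
    f ℕ.+ (t ℕ.+ t)                    ∎

  module _ (tight : g ≡ f ℕ.+ (t ℕ.+ t)) where

    private
      lower : suc (suc (f ℕ.+ (t′ ℕ.+ t′))) ≤ g
      lower = begin
        suc (suc (f ℕ.+ (t′ ℕ.+ t′)))  ≡⟨ double-suc f t′ ⟨
        f ℕ.+ (suc t′ ℕ.+ suc t′)      ≤⟨ double-mono f t> ⟩
        f ℕ.+ (t ℕ.+ t)                ≡⟨ tight ⟨
        g                              ∎

    cut-g : g ≡ suc g′
    cut-g = ℕ.≤-antisym g≤ (begin
      suc g′                           ≤⟨ s≤s bound′ ⟩
      suc (f′ ℕ.+ (t′ ℕ.+ t′))         ≤⟨ s≤s (ℕ.+-monoˡ-≤ _ f′≤) ⟩
      suc (suc (f ℕ.+ (t′ ℕ.+ t′)))    ≤⟨ lower ⟩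
      g                                ∎)

    cut-f : f′ ≡ suc f
    cut-f = ℕ.≤-antisym f′≤ (ℕ.+-cancelʳ-≤ (t′ ℕ.+ t′) _ _ (ℕ.≤-trans
      (ℕ.≤-pred (ℕ.≤-trans lower g≤)) bound′))

    cut-t : t ≡ suc t′
    cut-t = ℕ.≤-antisym (double-cancel f (begin
      f ℕ.+ (t ℕ.+ t)                  ≡⟨ tight ⟨
      g                                ≤⟨ g≤ ⟩
      suc g′                           ≤⟨ s≤s bound′ ⟩
      suc (f′ ℕ.+ (t′ ℕ.+ t′))         ≤⟨ s≤s (ℕ.+-monoˡ-≤ _ f′≤) ⟩
      suc (suc (f ℕ.+ (t′ ℕ.+ t′)))    ≡⟨ double-suc f t′ ⟨
      f ℕ.+ (suc t′ ℕ.+ suc t′)        ∎)) t>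

    cut-tight : g′ ≡ f′ ℕ.+ (t′ ℕ.+ t′)
    cut-tight = ℕ.≤-antisym bound′ (ℕ.≤-pred (begin
      suc (f′ ℕ.+ (t′ ℕ.+ t′))         ≤⟨ s≤s (ℕ.+-monoˡ-≤ _ f′≤) ⟩
      suc (suc (f ℕ.+ (t′ ℕ.+ t′)))    ≤⟨ lower ⟩
      g                                ≡⟨ cut-g ⟩
      suc g′                           ∎))

-- Keeping D = g − f from dropping while t does not grow preserves g = f + 2t.
module _ {g g′ f f′ t t′ : ℕ} (bound′ : g′ ≤ f′ ℕ.+ (t′ ℕ.+ t′)) (t′≤t : t′ ≤ t)
         (tight : g ≡ f ℕ.+ (t ℕ.+ t)) (D≤ : f′ ℕ.+ g ≤ f ℕ.+ g′) where

  open ℕ.≤-Reasoning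

  private
    chain : f′ ℕ.+ (f ℕ.+ (t ℕ.+ t)) ≤ f ℕ.+ g′
    chain = ℕ.≤-trans (ℕ.≤-reflexive (≡.cong (f′ ℕ.+_) (≡.sym tight))) D≤

    swap : ∀ u → f′ ℕ.+ (f ℕ.+ u) ≡ f ℕ.+ (f′ ℕ.+ u)
    swap u = ≡.trans (≡.sym (ℕ.+-assoc f′ f u))
      (≡.trans (≡.cong (ℕ._+ u) (ℕ.+-comm f′ f)) (ℕ.+-assoc f f′ u))

    lower : f′ ℕ.+ (t ℕ.+ t) ≤ g′
    lower = ℕ.+-cancelˡ-≤ f _ _ (ℕ.≤-trans (ℕ.≤-reflexive (≡.sym (swap _))) chain)

  keep-t : t ≡ t′
  keep-t = ℕ.≤-antisym (double-cancel f′ (ℕ.≤-trans lower bound′)) t′≤t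

  keep-tight : g′ ≡ f′ ℕ.+ (t′ ℕ.+ t′)
  keep-tight = ℕ.≤-antisym bound′ (ℕ.≤-trans (double-mono f′ t′≤t) lower)

  keep-D : f′ ℕ.+ g ≡ f ℕ.+ g′
  keep-D = ℕ.≤-antisym D≤ (begin
    f ℕ.+ g′                      ≤⟨ ℕ.+-monoʳ-≤ f bound′ ⟩
    f ℕ.+ (f′ ℕ.+ (t′ ℕ.+ t′))    ≡⟨ swap _ ⟨
    f′ ℕ.+ (f ℕ.+ (t′ ℕ.+ t′))    ≤⟨ ℕ.+-monoʳ-≤ f′ (double-mono f t′≤t) ⟩
    f′ ℕ.+ (f ℕ.+ (t ℕ.+ t))      ≡⟨ ≡.cong (f′ ℕ.+_) tight ⟨
    f′ ℕ.+ g                      ∎)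

-- Tight vertex sets

module Tightness (K : InvolutiveField c ℓ) {n : ℕ} (G : Graph n)
                 (weightΓ weightΦ : Weights.Weight K G) where

  open InvolutiveField K using (_≈_; 0#; *-congˡ; trans; sym; *-comm; _≟_)
    renaming (refl to ≈-refl)
  open Dimension (InvolutiveField.field′ K) using (Vec′; product-zero)
  open Graph G
  open Subgraphs G
  open Shapes G
  open Weights K G using (Weight; module Nullity)
  module Γ = Nullity weightΓ
  module Φ = Nullity weightΦ

  bound : ∀ S → Γ.ν S ≤ Φ.ν S ℕ.+ (τ S ℕ.+ τ S)
  bound = subset-induction _ go
    where
    open ℕ.≤-Reasoning
    go : ∀ S → (∀ T → ∣ T ∣ < ∣ S ∣ → Γ.ν T ≤ Φ.ν T ℕ.+ (τ T ℕ.+ τ T)) →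
         Γ.ν S ≤ Φ.ν S ℕ.+ (τ S ℕ.+ τ S)
    go S ih with shape S
    ... | empty ∉S = ℕ.≤-trans (ℕ.≤-reflexive (Γ.ν-empty S ∉S)) z≤n
    ... | isolated {i} iso@(i∈ , _) = begin
      Γ.ν S                            ≡⟨ Γ.ν-isolated S iso ⟩
      suc (Γ.ν (S - i))                ≤⟨ s≤s (ih (S - i) (x∈p⇒∣p-x∣<∣p∣ i∈)) ⟩
      suc (Φ.ν (S - i)) ℕ.+ _          ≡⟨ ≡.cong (ℕ._+ _) (Φ.ν-isolated S iso) ⟨
      Φ.ν S ℕ.+ _                      ≤⟨ double-mono (Φ.ν S) (τ-remove S i) ⟩
      Φ.ν S ℕ.+ (τ S ℕ.+ τ S)          ∎
    ... | leaf {i} {j} l@(i∈ , _) = begin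
      Γ.ν S                            ≡⟨ Γ.ν-leaf S l ⟨
      Γ.ν (S - i - j)                  ≤⟨ ih (S - i - j) (∣remove₂∣< S i∈ (leaf-nbr∈ l)) ⟩
      Φ.ν (S - i - j) ℕ.+ _            ≡⟨ ≡.cong (ℕ._+ _) (Φ.ν-leaf S l) ⟩
      Φ.ν S ℕ.+ _                      ≤⟨ double-mono (Φ.ν S) (τ-mono {S} {S - i - j} (remove₂⊆ S i j)) ⟩
      Φ.ν S ℕ.+ (τ S ℕ.+ τ S)          ∎
    ... | cyclic C C⊆S = cut-bound (Γ.ν-remove-≤ S x∈) (Φ.ν-remove-≥ S x∈)
        (ih (S - x) (x∈p⇒∣p-x∣<∣p∣ x∈)) (τ-onCycle (Periodic.vertex-onCycle C C⊆S zero))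
      where
      x = Cycle.vertex C zero
      x∈ = C⊆S zero

  Tight : Subset n → Set
  Tight S = Γ.ν S ≡ Φ.ν S ℕ.+ (τ S ℕ.+ τ S)

  module AtCycle {S x} (o : OnCycle S x) (tight : Tight S) where

    private
      x∈ = OnCycle.x∈ o
      hyp = cut-g (Γ.ν-remove-≤ S x∈) (Φ.ν-remove-≥ S x∈) (bound (S - x)) (τ-onCycle o) tight

    τ≡ : τ S ≡ suc (τ (S - x))
    τ≡ = cut-t (Γ.ν-remove-≤ S x∈) (Φ.ν-remove-≥ S x∈) (bound (S - x)) (τ-onCycle o) tight

    remains-tight : Tight (S - x)
    remains-tight = cut-tight (Γ.ν-remove-≤ S x∈) (Φ.ν-remove-≥ S x∈) (bound (S - x)) (τ-onCycle o) tight

    downerΓ : Γ.Downer S x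
    downerΓ = Γ.ν⇒downer S x∈ (ℕ.≤-reflexive (≡.sym hyp))

    parterΦ : Φ.Parter S x
    parterΦ = Φ.ν⇒parter S x∈ (ℕ.≤-reflexive (≡.sym
      (cut-f (Γ.ν-remove-≤ S x∈) (Φ.ν-remove-≥ S x∈) (bound (S - x)) (τ-onCycle o) tight)))

  module AtLeaf {S i j} (l : Leaf S i j) (tight : Tight S) where

    private
      D≤ : Φ.ν (S - i - j) ℕ.+ Γ.ν S ≤ Φ.ν S ℕ.+ Γ.ν (S - i - j)
      D≤ = ℕ.≤-reflexive (≡.cong₂ ℕ._+_ (Φ.ν-leaf S l) (≡.sym (Γ.ν-leaf S l)))
      τ≤ = τ-mono {S} {S - i - j} (remove₂⊆ S i j)

    remains-tight : Tight (S - i - j)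
    remains-tight = keep-tight (bound (S - i - j)) τ≤ tight D≤

    τ≡ : τ S ≡ τ (S - i - j)
    τ≡ = keep-t (bound (S - i - j)) τ≤ tight D≤

    leaf-not-onCycle : ¬ OnCycle S i
    leaf-not-onCycle (onCycle _ a≢b a∈ b∈ ia ib _) = a≢b (≡.trans (only a∈ ia) (≡.sym (only b∈ ib)))
      where only = proj₂ (proj₂ (proj₂ l))

    -- Otherwise deleting `j` would lower `τ`, which the removal of the pair preserves.
    nbr-not-onCycle : ¬ OnCycle S j
    nbr-not-onCycle o = ℕ.<⇒≢ (ℕ.≤-trans (s≤s (τ-mono {S - j} {S - i - j}
      (remove-mono j (∈-remove⁻ S)))) (τ-onCycle o)) (≡.sym τ≡)

  Acyclic : Subset n → Set
  Acyclic S = ∀ {x} → ¬ OnCycle S x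

  -- A forest is exhausted by removing isolated vertices and leaves with their neighbours; only the
  -- latter contribute to the rank, two at a time. The sum has the parity of the rank ∣S∣ - ν.
  acyclic-parity : ∀ S → Acyclic S → ∃[ k ] ∣ S ∣ ℕ.+ Γ.ν S ≡ 2 ℕ.* k
  acyclic-parity = subset-induction _ go
    where
    P : Subset n → Set
    P S = Acyclic S → ∃[ k ] ∣ S ∣ ℕ.+ Γ.ν S ≡ 2 ℕ.* k
    2+ : ∀ {m k} → m ≡ 2 ℕ.* k → 2 ℕ.+ m ≡ 2 ℕ.* suc k
    2+ {k = k} eq = ≡.trans (≡.cong (2 ℕ.+_) eq) (≡.sym (ℕ.*-suc 2 k))
    go : ∀ S → (∀ T → ∣ T ∣ < ∣ S ∣ → P T) → P S
    go S ih acyclic with shape S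
    ... | empty ∉S = 0 , ≡.cong₂ ℕ._+_
      (≡.trans (≡.cong ∣_∣ (Subset.Empty-unique λ (_ , i∈) → ∉S i∈)) (Subset.∣⊥∣≡0 n)) (Γ.ν-empty S ∉S)
    ... | isolated {i} iso@(i∈ , _)
          with k , eq ← ih (S - i) (x∈p⇒∣p-x∣<∣p∣ i∈) (acyclic ∘ onCycle-mono {S} {S - i} (∈-remove⁻ S)) =
      suc k , ≡.trans (≡.cong₂ ℕ._+_ (∣remove∣ S i∈) (Γ.ν-isolated S iso))
        (≡.trans (≡.cong suc (ℕ.+-suc _ _)) (2+ eq))
    ... | leaf {i} {j} l@(i∈ , _)
          with k , eq ← ih (S - i - j) (∣remove₂∣< S i∈ (leaf-nbr∈ l))
                 (acyclic ∘ onCycle-mono {S} {S - i - j} (remove₂⊆ S i j)) =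
      suc k , ≡.trans (≡.cong₂ ℕ._+_ (≡.trans (∣remove∣ S i∈)
        (≡.cong suc (∣remove∣ (S - i) (leaf-nbr∈ l)))) (≡.sym (Γ.ν-leaf S l))) (2+ eq)
    ... | cyclic C C⊆S = contradiction (Periodic.vertex-onCycle C C⊆S zero) acyclic

  -- In a forest this means that every maximum matching covers `w`.
  VanishesAt : Fin n → Subset n → Set _
  VanishesAt w S = ∀ {z} → Γ.Ker S z → z w ≈ 0#

  -- Deleting vertices of cycles reduces the claim to an acyclic S, where the parity of
  -- ∣ S ∣ + ν S excludes that w is neutral.
  vanishes⇒parter : ∀ S → Tight S → ∀ {w} → w ∈ S → VanishesAt w S → Γ.Parter S w
  vanishes⇒parter = subset-induction _ go
    where
    P : Subset n → Set _
    P S = Tight S → ∀ {w} → w ∈ S → VanishesAt w S → Γ.Parter S w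
    go : ∀ S → (∀ T → ∣ T ∣ < ∣ S ∣ → P T) → P S
    go S ih tight {w} w∈ vanish with Fin.any? (onCycle? S)
    ... | no acyclic with Γ.step S w∈
    ...   | Γ.downer (z , z∈ , z≉0) _ = contradiction (vanish z∈) z≉0
    ...   | Γ.parter p _ = p
    ...   | Γ.neutral _ _ ν≡
            with k , k≡ ← acyclic-parity S (λ o → acyclic (_ , o))
            with l , l≡ ← acyclic-parity (S - w) (λ o → acyclic (_ , onCycle-mono {S} {S - w} (∈-remove⁻ S) o)) =
      contradiction (≡.trans (≡.sym k≡) (≡.trans (≡.cong₂ ℕ._+_ (∣remove∣ S w∈) ν≡) (≡.cong suc l≡)))
        (ℕ.even≢odd k l)
    go S ih tight {w} w∈ vanish | yes (x , o)
      with z , z∈ , z≉0 ← AtCycle.downerΓ o tight = y , y∈ , y≉0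
      where
      w≢x : w ≢ x
      w≢x refl = z≉0 (vanish z∈)
      -- As `x` is a downer, kernel vectors on `S - x` are also kernel vectors on `S`, and so vanish
      -- at `w`.
      recurse : Γ.Parter (S - x) w
      recurse = ih (S - x) (x∈p⇒∣p-x∣<∣p∣ (OnCycle.x∈ o)) (AtCycle.remains-tight o tight)
        (x∈p∧x≢y⇒x∈p-y w∈ w≢x)
        λ u∈ → vanish (Γ.extend-kernel S u∈ (Γ.downer⇒row-vanishes S (z , z∈ , z≉0) u∈))
      y = proj₁ recurse
      y≉0 = proj₂ (proj₂ recurse)
      y∈′ : Γ.Ker (S - w - x) y
      y∈′ = ≡.subst (λ T → Γ.Ker T y) (p─x─y≡p─y─x S x w) (proj₁ (proj₂ recurse))
      -- The vector `z` is zero at `w`, hence survives on `S - w` and makes `x` a downer there too;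
      -- so `y` satisfies the row of `x`.
      y∈ : Γ.Ker (S - w) y
      y∈ = Γ.extend-kernel (S - w) y∈′ (Γ.downer⇒row-vanishes (S - w)
        (z , Γ.restrict-kernel S z∈ (vanish z∈) , z≉0) y∈′)

  -- Cutting a kernel vector down to the component of `u` leaves it in the kernel, since a row
  -- involves only neighbours.
  module Component (S : Subset n) {x u : Fin n} (u∈ : u ∈ S - x) (k : Vec′ n) where

    component : Vec′ n
    component j with connected? (induced G (S - x)) u j
    ... | yes _ = k j
    ... | no  _ = 0#

    component-inside : ∀ {j} → Walk (S - x) u j → component j ≈ k j
    component-inside {j} w with connected? (induced G (S - x)) u j
    ... | yes _ = ≈-refl
    ... | no ¬w = contradiction w ¬w

    component-outside : ∀ {j} → ¬ Walk (S - x) u j → component j ≈ 0#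
    component-outside {j} ¬w with connected? (induced G (S - x)) u j
    ... | yes w = contradiction w ¬w
    ... | no _  = ≈-refl

    component∈ : Γ.Ker (S - x) k → Γ.Ker (S - x) component
    component∈ (supp , Gk) = outside-zero , rows
      where
      outside-zero : ∀ j → j ∉ S - x → component j ≈ 0#
      outside-zero j j∉ = component-outside λ w → j∉ (walk-end∈ u∈ w)
      rows : ∀ i → i ∈ S - x → i Γ.· component ≈ 0#
      rows i i∈ with connected? (induced G (S - x)) u i
      ... | yes w = trans (Γ.row-cong i agree) (Gk i i∈)
        where
        agree : ∀ j → Adj i j → component j ≈ k j
        agree j ij with j ∈? (S - x)
        ... | yes j∈ = component-inside (w ◅◅ return (i∈ , j∈ , ij))
        ... | no j∉  = trans (outside-zero j j∉) (sym (supp j j∉))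
      ... | no ¬w = Γ.row-zero i λ j ij → component-outside λ w →
              ¬w (w ◅◅ return (walk-end∈ u∈ w , i∈ , Adj-sym ij))

  -- The edge from `x` to `u` is a bridge. Restricted to the component of `u`, a kernel vector
  -- leaves a single term in the row of `x`, and that row is zero because `x` is a downer.
  downer⇒vanishes : ∀ S {x u} → Γ.Downer S x → Adj x u → u ∈ S →
    (∀ {d} → d ∈ S → Adj x d → d ≢ u → ¬ Walk (S - x) u d) → VanishesAt u (S - x)
  downer⇒vanishes S {x} {u} d xu u∈ alone {k} k∈ = product-zero
    (trans (*-comm _ _) (trans (*-congˡ (sym (component-inside ε)))
      (trans (sym (Γ.row-single x u λ j xj j≢u → component-outside λ w →
         alone (∈-remove⁻ S (walk-end∈ u∈′ w)) xj j≢u w))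
      (Γ.downer⇒row-vanishes S d (component∈ k∈))))) (Γ.entry≉0 xu)
    where
    u∈′ = nbr∈remove S xu u∈
    open Component S u∈′ k

  -- The leaf must differ from `w`, since `w` regains a neighbour when the deleted vertices before
  -- it on the walk are put back.
  LeafBeyond : Subset n → Fin n → Set
  LeafBeyond S w = ∃[ p ] ∃[ q ] p ≢ w × Walk S w p × Leaf S p q

  -- One round `w`, `v`, `u` of the walk, in reverse: a leaf found beyond `u` is still a leaf once
  -- `w` and `v` return, or it would put one of them on a cycle.
  module TwoStep {S w v} (w∈ : w ∈ S) (wv : Adj w v) (v∈ : v ∈ S - w)
                 (w-not-onCycle : ¬ OnCycle S w) (v-not-onCycle : ¬ OnCycle (S - w) v) where

    private
      v∈S : v ∈ S
      v∈S = ∈-remove⁻ S v∈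

    stop : ¬ (∃[ u ] u ∈ S - w - v × Adj v u) → LeafBeyond S w
    stop none = v , w , ∈-remove⇒≢ S v∈ , return (w∈ , v∈S , wv) , v∈S , w∈ , Adj-sym wv , only
      where
      only : ∀ {k} → k ∈ S → Adj v k → k ≡ w
      only {k} k∈ vk = decidable-stable (k Fin.≟ w) λ k≢w →
        none (k , nbr∈remove (S - w) vk (x∈p∧x≢y⇒x∈p-y k∈ k≢w) , vk)

    go-on : ∀ {u} → u ∈ S - w - v → Adj v u → LeafBeyond (S - w - v) u → LeafBeyond S w
    go-on {u} u∈ vu (p , q , p≢u , walk , p∈ , q∈ , pq , only) =
      p , q , ∈-remove⇒≢ S p∈₁ ,
      (w∈ , v∈S , wv) ◅ (v∈S , ∈-remove⁻ S u∈₁ , vu) ◅ walk-mono {S} {S - w - v} (remove₂⊆ S w v) walk ,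
      ∈-remove⁻ S p∈₁ , remove₂⊆ S w v q∈ , pq , only′
      where
      p∈₁ : p ∈ S - w
      p∈₁ = ∈-remove⁻ (S - w) p∈
      u∈₁ : u ∈ S - w
      u∈₁ = ∈-remove⁻ (S - w) u∈
      -- The edge `pw` would close the cycle from `w` through `v`, `u` and the walk to `p`; likewise
      -- for `pv` below.
      not-w : ¬ Adj p w
      not-w pw = w-not-onCycle (onCycle w∈ (∈-remove⇒≢ (S - w) p∈ ∘ ≡.sym) v∈S (∈-remove⁻ S p∈₁) wv (Adj-sym pw)
        ((v∈ , u∈₁ , vu) ◅ walk-mono {S - w} {S - w - v} (∈-remove⁻ (S - w)) walk))
      not-v : ¬ Adj p v
      not-v pv = v-not-onCycle (onCycle v∈ (p≢u ∘ ≡.sym) u∈₁ p∈₁ vu (Adj-sym pv) walk)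
      only′ : ∀ {k} → k ∈ S → Adj p k → k ≡ q
      only′ {k} k∈ pk = only (x∈p∧x≢y⇒x∈p-y (x∈p∧x≢y⇒x∈p-y k∈ λ { refl → not-w pk }) λ { refl → not-v pk }) pk

  record Descent (S : Subset n) (w : Fin n) : Set (c ⊔ ℓ) where
    field
      w-not-onCycle : ¬ OnCycle S w
      {v}           : Fin n
      wv            : Adj w v
      v∈            : v ∈ S - w
      v-not-onCycle : ¬ OnCycle (S - w) v
      tight         : Tight (S - w - v)
      downer        : Γ.Downer (S - w) v

  -- Deleting `w` raises ν(G) by one and ν(Φ) by at most one, so tightness is kept and `w` is a
  -- Parter vertex of Φ too. Its witness `y` is nonzero at a neighbour `v`, which is thus a downer
  -- of Φ on `S - w`. Deleting `v` lowers ν(Φ) by one and ν(G) by at most one, so tightness is kept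
  -- again and `v` is a downer of G. It lies on no cycle, as cycle vertices of a tight set are
  -- Parter for Φ.
  descent : ∀ S → Tight S → ∀ {w} → w ∈ S → VanishesAt w S → Descent S w
  descent S tight {w} w∈ vanish = record
    { w-not-onCycle = w-not-onCycle ; wv = wv ; v∈ = v∈ ; v-not-onCycle = v-not-onCycle
    ; tight = tight₂ ; downer = downerΓ }
    where
    parterΓ : Γ.Parter S w
    parterΓ = vanishes⇒parter S tight w∈ vanish

    w-not-onCycle : ¬ OnCycle S w
    w-not-onCycle o = Γ.parter⇒¬downer S parterΓ (AtCycle.downerΓ o tight)

    D≤ : Φ.ν (S - w) ℕ.+ Γ.ν S ≤ Φ.ν S ℕ.+ Γ.ν (S - w)
    D≤ = ℕ.≤-trans (ℕ.+-monoˡ-≤ _ (Φ.ν-remove-≥ S w∈)) (ℕ.≤-trans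
      (ℕ.≤-reflexive (≡.sym (ℕ.+-suc _ _))) (ℕ.+-monoʳ-≤ _ (ℕ.≤-reflexive (≡.sym (Γ.parter⇒ν S w∈ parterΓ)))))

    tight₁ : Tight (S - w)
    tight₁ = keep-tight (bound (S - w)) (τ-remove S w) tight D≤

    parterΦ : Φ.Parter S w
    parterΦ = Φ.ν⇒parter S w∈ (ℕ.+-cancelʳ-≤ (Γ.ν S) _ _ (ℕ.≤-reflexive (≡.sym (≡.trans
      (keep-D (bound (S - w)) (τ-remove S w) tight D≤)
      (≡.trans (≡.cong (Φ.ν S ℕ.+_) (Γ.parter⇒ν S w∈ parterΓ)) (ℕ.+-suc _ _))))))

    y = proj₁ parterΦ
    y∈ = proj₁ (proj₂ parterΦ)

    pick : ∃[ v ] Adj w v × ¬ y v ≈ 0#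
    pick = decidable-stable (Fin.any? λ v → Adj? w v ×-dec ¬? (y v ≟ 0#)) λ none →
      proj₂ (proj₂ parterΦ) (Φ.row-zero w λ v wv → decidable-stable (y v ≟ 0#)
        λ y≉0 → none (v , wv , y≉0))

    v = proj₁ pick
    wv = proj₁ (proj₂ pick)
    v∈ : v ∈ S - w
    v∈ = decidable-stable (v ∈? (S - w)) λ v∉ → proj₂ (proj₂ pick) (proj₁ y∈ v v∉)

    T : Subset n
    T = S - w - v

    downerΦ : Φ.Downer (S - w) v
    downerΦ = y , y∈ , proj₂ (proj₂ pick)

    v-not-onCycle : ¬ OnCycle (S - w) v
    v-not-onCycle o = Φ.parter⇒¬downer (S - w) (AtCycle.parterΦ o tight₁) downerΦ

    D₂≤ : Φ.ν T ℕ.+ Γ.ν (S - w) ≤ Φ.ν (S - w) ℕ.+ Γ.ν T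
    D₂≤ = ℕ.≤-trans (ℕ.+-monoʳ-≤ _ (Γ.ν-remove-≤ (S - w) v∈)) (ℕ.≤-reflexive (≡.trans
      (ℕ.+-suc _ _) (≡.cong (ℕ._+ Γ.ν T) (≡.sym (Φ.downer⇒ν (S - w) v∈ downerΦ)))))

    tight₂ : Tight T
    tight₂ = keep-tight (bound T) (τ-remove (S - w) v) tight₁ D₂≤

    downerΓ : Γ.Downer (S - w) v
    downerΓ = Γ.ν⇒downer (S - w) v∈ (ℕ.+-cancelˡ-≤ (Φ.ν T) _ _ (ℕ.≤-reflexive (≡.sym (≡.trans
      (keep-D (bound T) (τ-remove (S - w) v) tight₁ D₂≤)
      (≡.trans (≡.cong (ℕ._+ Γ.ν T) (Φ.downer⇒ν (S - w) v∈ downerΦ)) (≡.sym (ℕ.+-suc _ _)))))))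

  -- Because `v` is a downer on no cycle of `S - w`, `downer⇒vanishes` applies to every further
  -- neighbour `u` of `v`, and the hypothesis recurs at `u` on a smaller tight set.
  vanishes⇒leaf : ∀ S → Tight S → ∀ {w} → w ∈ S → VanishesAt w S → LeafBeyond S w
  vanishes⇒leaf = subset-induction _ go
    where
    P : Subset n → Set _
    P S = Tight S → ∀ {w} → w ∈ S → VanishesAt w S → LeafBeyond S w
    conclude : ∀ S → (∀ T → ∣ T ∣ < ∣ S ∣ → P T) → ∀ {w} → w ∈ S → (d : Descent S w) →
               Dec (∃[ u ] u ∈ S - w - Descent.v d × Adj (Descent.v d) u) → LeafBeyond S w
    conclude S ih w∈ d (no none) = TwoStep.stop w∈ wv v∈ w-not-onCycle v-not-onCycle none
      where open Descent d
    conclude S ih {w} w∈ d (yes (u , u∈ , vu)) = TwoStep.go-on w∈ wv v∈ w-not-onCycle v-not-onCycle u∈ vu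
      (ih (S - w - v) (∣remove₂∣< S w∈ v∈) tight u∈
        (downer⇒vanishes (S - w) downer vu (∈-remove⁻ (S - w) u∈) λ d∈ vd d≢u walk →
          v-not-onCycle (onCycle v∈ (d≢u ∘ ≡.sym) (∈-remove⁻ (S - w) u∈) d∈ vu vd walk)))
      where open Descent d
    go : ∀ S → (∀ T → ∣ T ∣ < ∣ S ∣ → P T) → P S
    go S ih tight {w} w∈ vanish = conclude S ih w∈ d
      (Fin.any? λ u → (u ∈? (S - w - Descent.v d)) ×-dec Adj? (Descent.v d) u)
      where d = descent S tight w∈ vanish

  -- A third neighbour c of x would hang off x by a bridge; the matching-like walk of
  -- vanishes⇒leaf from c then ends in a leaf of S.
  tight⇒two-neighbours : ∀ S → Tight S → (∀ {i j} → ¬ Leaf S i j) → ∀ {x} (o : OnCycle S x) {c} →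
    c ∈ S → Adj x c → c ≡ OnCycle.a o ⊎ c ≡ OnCycle.b o
  tight⇒two-neighbours S tight leafless {x} o {c} c∈ xc with c Fin.≟ OnCycle.a o | c Fin.≟ OnCycle.b o
  ... | yes c≡a | _       = inj₁ c≡a
  ... | no _    | yes c≡b = inj₂ c≡b
  ... | no c≢a  | no c≢b  = contradiction (vanishes⇒leaf (S - x) (AtCycle.remains-tight o tight)
      (nbr∈remove S xc c∈) (downer⇒vanishes S (AtCycle.downerΓ o tight) xc c∈ alone)) no-leaf
    where
    -- A second edge from `x` into the component of `c` would make the deletion of `x` lower `τ` by
    -- two, but in a tight set it lowers `τ` by exactly one.
    alone : ∀ {d} → d ∈ S → Adj x d → d ≢ c → ¬ Walk (S - x) c d
    alone d∈ xd d≢c w = ℕ.<⇒≢ (τ-onCycle₂ o c≢a c≢b (d≢c ∘ ≡.sym) c∈ d∈ xc xd w)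
      (≡.sym (AtCycle.τ≡ o tight))
    no-leaf : ¬ LeafBeyond (S - x) c
    no-leaf (p , q , p≢c , walk , p∈ , q∈ , pq , only) =
      leafless (∈-remove⁻ S p∈ , ∈-remove⁻ S q∈ , pq , only′)
      where
      only′ : ∀ {k} → k ∈ S → Adj p k → k ≡ q
      only′ {k} k∈ pk = only (x∈p∧x≢y⇒x∈p-y k∈
        λ { refl → alone (∈-remove⁻ S p∈) (Adj-sym pk) p≢c walk }) pk

-- Kernel vectors along a cycle

parity : ∀ h → ∃[ m ] (h ≡ 2 ℕ.* m ⊎ h ≡ suc (2 ℕ.* m))
parity zero = 0 , inj₁ refl
parity (suc h) with parity h
... | m , inj₁ eq = m , inj₂ (≡.cong suc eq)
... | m , inj₂ eq = suc m , inj₁ (≡.trans (≡.cong suc eq) (≡.sym (ℕ.*-suc 2 m)))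

module Cycles (K : InvolutiveField c ℓ) {n : ℕ} (G : Graph n) where

  open InvolutiveField K hiding (zero; refl; _-_)
  open InvolutiveField K using () renaming (refl to ≈-refl)
  open RingProperties ring
  open SetoidReasoning setoid
  open SemiringExp semiring using (_^_)
  open Dimension field′
  open Graph G
  open Subgraphs G
  open Weights K G using (Weight; module Weight; module Nullity)

  σ : ℕ → Carrier
  σ h = (- 1#) ^ h

  -‿* : ∀ x y → (- x) * y ≈ - (x * y)
  -‿* x y = sym (-‿distribˡ-* x y)

  *-‿ : ∀ x y → x * (- y) ≈ - (x * y)
  *-‿ x y = sym (-‿distribʳ-* x y)

  σ-suc : ∀ h → σ (suc h) ≈ - σ h
  σ-suc h = trans (-‿* 1# _) (-‿cong (*-identityˡ _))

  σ-even : ∀ m → σ (2 ℕ.* m) ≈ 1#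
  σ-even zero    = ≈-refl
  σ-even (suc m) = begin
    σ (2 ℕ.* suc m)              ≡⟨ ≡.cong σ (ℕ.*-suc 2 m) ⟩
    σ (suc (suc (2 ℕ.* m)))      ≈⟨ trans (σ-suc (suc (2 ℕ.* m))) (-‿cong (σ-suc (2 ℕ.* m))) ⟩
    - (- σ (2 ℕ.* m))            ≈⟨ -‿involutive _ ⟩
    σ (2 ℕ.* m)                  ≈⟨ σ-even m ⟩
    1#                           ∎

  σ² : ∀ h → σ h * σ h ≈ 1#
  σ² zero    = *-identityˡ 1#
  σ² (suc h) = begin
    σ (suc h) * σ (suc h)  ≈⟨ *-cong (σ-suc h) (σ-suc h) ⟩
    (- σ h) * (- σ h)      ≈⟨ trans (-‿* _ _) (-‿cong (*-‿ _ _)) ⟩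
    - (- (σ h * σ h))      ≈⟨ -‿involutive _ ⟩
    σ h * σ h              ≈⟨ σ² h ⟩
    1#                     ∎

  1≉-1 : ¬ 1# ≈ - 1#
  1≉-1 1≈-1 = 2≉0 (trans (+-congˡ 1≈-1) (-‿inverseʳ 1#))

  σ≈1⇒even : ∀ h → σ h ≈ 1# → ∃[ m ] h ≡ 2 ℕ.* m
  σ≈1⇒even h σ≈1 with parity h
  ... | m , inj₁ eq   = m , eq
  ... | m , inj₂ refl = contradiction
    (trans (sym σ≈1) (trans (σ-suc (2 ℕ.* m)) (-‿cong (σ-even m)))) 1≉-1

  cancelʳ : ∀ {a b y} → a * y ≈ b * y → ¬ y ≈ 0# → a ≈ b
  cancelʳ {a} {b} {y} ay≈by y≉0 = begin
    a                ≈⟨ +-identityʳ a ⟨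
    a + 0#           ≈⟨ +-congˡ (-‿inverseˡ b) ⟨
    a + (- b + b)    ≈⟨ +-assoc _ _ _ ⟨
    a + - b + b      ≈⟨ +-congʳ (product-zero (trans (distribʳ y a (- b))
                          (trans (+-cong ay≈by (-‿* b y)) (-‿inverseʳ _))) y≉0) ⟩
    0# + b           ≈⟨ +-identityˡ b ⟩
    b                ∎

  alternate : (Y : ℕ → Carrier) → (∀ t → Y (2 ℕ.+ t) ≈ - Y t) → ∀ h t → Y (2 ℕ.* h ℕ.+ t) ≈ σ h * Y t
  alternate Y Y-step zero    t = sym (*-identityˡ _)
  alternate Y Y-step (suc h) t = begin
    Y (2 ℕ.* suc h ℕ.+ t)        ≡⟨ ≡.cong (λ s → Y (s ℕ.+ t)) (ℕ.*-suc 2 h) ⟩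
    Y (2 ℕ.+ (2 ℕ.* h ℕ.+ t))    ≈⟨ Y-step _ ⟩
    - Y (2 ℕ.* h ℕ.+ t)          ≈⟨ -‿cong (alternate Y Y-step h t) ⟩
    - (σ h * Y t)                ≈⟨ -‿* _ _ ⟨
    (- σ h) * Y t                ≈⟨ *-congʳ (σ-suc h) ⟨
    σ (suc h) * Y t              ∎

  OnVertices : Cycle G → Fin n → Set
  OnVertices C j = ∃[ k ] Cycle.vertex C k ≡ j

  onVertices? : ∀ C j → Dec (OnVertices C j)
  onVertices? C j = Fin.any? λ k → Cycle.vertex C k Fin.≟ j

  outside? : ∀ S C j → Dec (j ∈ S × ¬ OnVertices C j)
  outside? S C j = (j ∈? S) ×-dec ¬? (onVertices? C j)

  infixl 5 _∖_
  _∖_ : Subset n → Cycle G → Subset n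
  S ∖ C = fromDec (outside? S C)

  -- The cycle is chordless and forms a whole connected component of the subgraph on `S`.
  record Component (S : Subset n) (C : Cycle G) : Set where
    field
      within : C Within S
    open Periodic C
    field
      closed : ∀ t {j} → j ∈ S → Adj (at (suc t)) j → j ≡ at t ⊎ j ≡ at (2 ℕ.+ t)

    closed-vertices : ∀ {i j} → OnVertices C i → j ∈ S → Adj i j → OnVertices C j
    closed-vertices (k , refl) j∈ ij
      with closed (predecessor k) j∈ (≡.subst (λ v → Adj v _) (≡.sym (at-predecessor k)) ij)
    ... | inj₁ j≡ = _ , ≡.sym j≡
    ... | inj₂ j≡ = _ , ≡.sym j≡

  module CycleGain (W : Weight) (C : Cycle G) where

    open Weight W
    open Cycle C using (order)
    open Periodic C

    γ γ⁻ : ℕ → Carrier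
    γ  t = entry (at t) (at (suc t))
    γ⁻ t = entry (at (suc t)) (at t)

    γγ⁻ : ∀ t → γ t * γ⁻ t ≈ 1#
    γγ⁻ t = on-edge (at-adjacent t)

    -- The gain of the walk along the first `t` edges; after one round it is the gain of the cycle.
    prefix : (ℕ → Carrier) → ℕ → Carrier
    prefix f zero    = 1#
    prefix f (suc t) = prefix f t * f t

    holonomy : Carrier
    holonomy = prefix γ order

    prefix-inverse : ∀ t → prefix γ t * prefix γ⁻ t ≈ 1#
    prefix-inverse zero    = *-identityˡ 1#
    prefix-inverse (suc t) = begin
      prefix γ t * γ t * (prefix γ⁻ t * γ⁻ t)    ≈⟨ *-assoc _ _ _ ⟩
      prefix γ t * (γ t * (prefix γ⁻ t * γ⁻ t))  ≈⟨ *-congˡ (trans (sym (*-assoc _ _ _)) (trans (*-congʳ (*-comm _ _)) (*-assoc _ _ _))) ⟩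
      prefix γ t * (prefix γ⁻ t * (γ t * γ⁻ t))  ≈⟨ *-congˡ (trans (*-congˡ (γγ⁻ t)) (*-identityʳ _)) ⟩
      prefix γ t * prefix γ⁻ t                   ≈⟨ prefix-inverse t ⟩
      1#                                         ∎

    prefix≉0 : ∀ t → ¬ prefix γ t ≈ 0#
    prefix≉0 t = unit≉0 (trans (*-comm _ _) (prefix-inverse t))

    prefix-period : (f : ℕ → Carrier) → (∀ t → f (t ℕ.+ order) ≈ f t) →
                    ∀ t → prefix f (t ℕ.+ order) ≈ prefix f order * prefix f t
    prefix-period f f-period zero    = sym (*-identityʳ _)
    prefix-period f f-period (suc t) =
      trans (*-cong (prefix-period f f-period t) (f-period t)) (*-assoc _ _ _)

    γ-period : ∀ t → γ (t ℕ.+ order) ≈ γ t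
    γ-period t = reflexive (≡.cong₂ entry (at-period t) (at-period (suc t)))

    γ⁻-period : ∀ t → γ⁻ (t ℕ.+ order) ≈ γ⁻ t
    γ⁻-period t = reflexive (≡.cong₂ entry (at-period (suc t)) (at-period t))

  module CycleKernel (W : Weight) (S : Subset n) (C : Cycle G) (comp : Component S C) where

    open Weight W
    open Nullity W
    open CycleGain W C
    open Cycle C using (order)
    open Periodic C
    open Component comp

    row-at : ∀ t {x : Vec′ n} → Member (supported S) x →
             at (suc t) · x ≈ γ⁻ t * x (at t) + γ (suc t) * x (at (2 ℕ.+ t))
    row-at t {x} supp = row-pair (at (suc t)) (at t) (at (2 ℕ.+ t)) (at-skip t) rest
      where
      rest : ∀ j → Adj (at (suc t)) j → j ≢ at t → j ≢ at (2 ℕ.+ t) → x j ≈ 0#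
      rest j e j≢ j≢′ = supp j λ j∈ → [ j≢ , j≢′ ]′ (closed t j∈ e)

    -- Scaled by the gains accumulated along the cycle, a kernel vector changes sign
    -- every two steps.
    scaled : Vec′ n → ℕ → Carrier
    scaled x t = prefix γ t * x (at t)

    scaled-step : ∀ {x} → Ker S x → ∀ t → scaled x (2 ℕ.+ t) ≈ - scaled x t
    scaled-step {x} (supp , Wx) t = begin
      P * γ t * γ (suc t) * x (at (2 ℕ.+ t))       ≈⟨ *-assoc _ _ _ ⟩
      P * γ t * (γ (suc t) * x (at (2 ℕ.+ t)))     ≈⟨ *-congˡ (+-inverseʳ-unique _ _
                                                        (trans (sym (row-at t supp)) (Wx _ (within _)))) ⟩
      P * γ t * - (γ⁻ t * x (at t))                ≈⟨ *-‿ _ _ ⟩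
      - (P * γ t * (γ⁻ t * x (at t)))              ≈⟨ -‿cong (trans (sym (*-assoc _ _ _)) (*-congʳ
                                                        (trans (*-assoc _ _ _) (trans (*-congˡ (γγ⁻ t)) (*-identityʳ _))))) ⟩
      - (P * x (at t))                             ∎
      where P = prefix γ t

    scaled-period : ∀ x t → scaled x (t ℕ.+ order) ≈ holonomy * scaled x t
    scaled-period x t = trans (*-cong (prefix-period γ γ-period t) (reflexive (≡.cong x (at-period t))))
      (*-assoc _ _ _)

    scaled≈0 : ∀ x t → scaled x t ≈ 0# → x (at t) ≈ 0#
    scaled≈0 x t eq = product-zero (trans (*-comm _ _) eq) (prefix≉0 t)

    at≈0⇒vertices≈0 : ∀ {x : Vec′ n} → (∀ t → x (at t) ≈ 0#) → ∀ {j} → OnVertices C j → x j ≈ 0#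
    at≈0⇒vertices≈0 {x} x≈0 (k , refl) = ≡.subst (λ v → x v ≈ 0#) (at-toℕ k) (x≈0 (toℕ k))

    -- One round multiplies the scaled vector by `holonomy`, but also by a factor -1 for every two
    -- steps, that is by `σ h`. If the two factors differ, the vector is zero.
    kernel-vanishes : ∀ h → order ≡ 2 ℕ.* h → ¬ holonomy ≈ σ h → ∀ {x} → Ker S x → ∀ t → x (at t) ≈ 0#
    kernel-vanishes h order≡ hol≉ {x} x∈ t = scaled≈0 x t (decidable-stable (scaled x t ≟ 0#) λ Y≉0 →
      hol≉ (cancelʳ (begin
        holonomy * scaled x t        ≈⟨ scaled-period x t ⟨
        scaled x (t ℕ.+ order)       ≡⟨ ≡.cong (scaled x) (≡.trans (ℕ.+-comm t order) (≡.cong (ℕ._+ t) order≡)) ⟩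
        scaled x (2 ℕ.* h ℕ.+ t)     ≈⟨ alternate (scaled x) (scaled-step x∈) h t ⟩
        σ h * scaled x t             ∎) Y≉0))

    kernel-determined : ∀ {x} → Ker S x → x (at 0) ≈ 0# → x (at 1) ≈ 0# → ∀ t → x (at t) ≈ 0#
    kernel-determined {x} x∈ x₀ x₁ t = scaled≈0 x t (go t)
      where
      go : ∀ t → scaled x t ≈ 0#
      go 0 = trans (*-congˡ x₀) (zeroʳ _)
      go 1 = trans (*-congˡ x₁) (zeroʳ _)
      go (suc (suc t)) = trans (scaled-step x∈ t) (trans (-‿cong (go t)) -0#≈0#)

    -- With trivial gain the scaled vector is periodic. Two rounds consist of `order` double steps,
    -- so the sign rule makes `order` even; then one round consists of `order` / 2 double steps,
    -- which makes the half even too.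
    balanced-order : holonomy ≈ 1# → ∀ {x} → Ker S x → ¬ x (at 0) ≈ 0# → 4 ∣ order
    balanced-order hol≈1 {x} x∈ x₀≉0 = divides quarter (≡.trans order≡ (≡.trans (≡.cong (2 ℕ.*_) h≡)
      (≡.trans (≡.sym (ℕ.*-assoc 2 2 quarter)) (ℕ.*-comm 4 quarter))))
      where
      Y : ℕ → Carrier
      Y = scaled x
      Y₀≉0 : ¬ Y 0 ≈ 0#
      Y₀≉0 eq = x₀≉0 (scaled≈0 x 0 eq)
      period : ∀ t → Y (t ℕ.+ order) ≈ Y t
      period t = trans (scaled-period x t) (trans (*-congʳ hol≈1) (*-identityˡ _))
      sign : ∀ h → Y (2 ℕ.* h ℕ.+ 0) ≈ Y 0 → σ h ≈ 1#
      sign h eq = cancelʳ (trans (sym (alternate Y (scaled-step x∈) h 0)) (trans eq (sym (*-identityˡ _)))) Y₀≉0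
      even-order : ∃[ h ] order ≡ 2 ℕ.* h
      even-order = σ≈1⇒even order (sign order (begin
        Y (2 ℕ.* order ℕ.+ 0)       ≡⟨ ≡.cong Y (≡.trans (ℕ.+-identityʳ _) (≡.cong (order ℕ.+_) (ℕ.+-identityʳ order))) ⟩
        Y (order ℕ.+ order)         ≈⟨ period order ⟩
        Y (0 ℕ.+ order)             ≈⟨ period 0 ⟩
        Y 0                         ∎))
      order≡ = proj₂ even-order
      even-half : ∃[ m ] proj₁ even-order ≡ 2 ℕ.* m
      even-half = σ≈1⇒even (proj₁ even-order) (sign (proj₁ even-order) (begin
        Y (2 ℕ.* proj₁ even-order ℕ.+ 0)  ≡⟨ ≡.cong Y (≡.trans (ℕ.+-identityʳ _) (≡.sym order≡)) ⟩
        Y (0 ℕ.+ order)                   ≈⟨ period 0 ⟩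
        Y 0                               ∎))
      quarter = proj₁ even-half
      h≡ = proj₂ even-half

    -- The converse construction: `s` runs the sign rule from the free values `a` and `b`, and `E`
    -- undoes the scaling by the gains. Balance of the cycle makes `E` periodic, so that it is well
    -- defined on vertices.
    module Solution (h : ℕ) (order≡ : order ≡ 2 ℕ.* h) (hol≈σ : holonomy ≈ σ h) (a b : Carrier) where

      s : ℕ → Carrier
      s 0             = a
      s 1             = b
      s (suc (suc t)) = - s t

      E : ℕ → Carrier
      E t = s t * prefix γ⁻ t

      holonomy⁻ : prefix γ⁻ order ≈ σ h
      holonomy⁻ = begin
        prefix γ⁻ order                  ≈⟨ *-identityʳ _ ⟨
        prefix γ⁻ order * 1#             ≈⟨ *-congˡ (σ² h) ⟨
        prefix γ⁻ order * (σ h * σ h)    ≈⟨ *-assoc _ _ _ ⟨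
        prefix γ⁻ order * σ h * σ h      ≈⟨ *-congʳ (trans (*-comm _ _) (trans (*-congʳ (sym hol≈σ)) (prefix-inverse order))) ⟩
        1# * σ h                         ≈⟨ *-identityˡ _ ⟩
        σ h                              ∎

      E-period : ∀ t → E (t ℕ.+ order) ≈ E t
      E-period t = begin
        s (t ℕ.+ order) * prefix γ⁻ (t ℕ.+ order)   ≈⟨ *-cong
          (trans (reflexive (≡.cong s (≡.trans (ℕ.+-comm t order) (≡.cong (ℕ._+ t) order≡)))) (alternate s (λ _ → ≈-refl) h t))
          (trans (prefix-period γ⁻ γ⁻-period t) (*-congʳ holonomy⁻)) ⟩
        σ h * s t * (σ h * prefix γ⁻ t)             ≈⟨ *-congʳ (*-comm _ _) ⟩
        s t * σ h * (σ h * prefix γ⁻ t)             ≈⟨ *-assoc _ _ _ ⟩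
        s t * (σ h * (σ h * prefix γ⁻ t))           ≈⟨ *-congˡ (trans (sym (*-assoc _ _ _)) (trans (*-congʳ (σ² h)) (*-identityˡ _))) ⟩
        s t * prefix γ⁻ t                           ∎

      E-periods : ∀ r t → E (t ℕ.+ r ℕ.* order) ≈ E t
      E-periods zero    t = reflexive (≡.cong E (ℕ.+-identityʳ t))
      E-periods (suc r) t = trans (reflexive (≡.cong E (≡.sym (ℕ.+-assoc t order (r ℕ.* order)))))
        (trans (E-periods r (t ℕ.+ order)) (E-period t))

      solution : Vec′ n
      solution j with onVertices? C j
      ... | yes (k , _) = E (toℕ k)
      ... | no _        = 0#

      solution-at : ∀ t → solution (at t) ≈ E t
      solution-at t with onVertices? C (at t)
      ... | no ¬on       = contradiction (t mod order , refl) ¬on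
      ... | yes (k , eq) = begin
        E (toℕ k)                                ≡⟨ ≡.cong E (≡.trans (≡.cong toℕ (Cycle.injective C eq)) (toℕ-mod t)) ⟩
        E (t % order)                            ≈⟨ E-periods (t / order) (t % order) ⟨
        E (t % order ℕ.+ (t / order) ℕ.* order)  ≡⟨ ≡.cong E (m≡m%n+[m/n]*n t order) ⟨
        E t                                      ∎

      solution-off : ∀ {j} → ¬ OnVertices C j → solution j ≈ 0#
      solution-off {j} ¬on with onVertices? C j
      ... | yes on = contradiction on ¬on
      ... | no _   = ≈-refl

      solution∈ : Ker S solution
      solution∈ = supp , rows
        where
        supp : ∀ j → j ∉ S → solution j ≈ 0#
        supp j j∉ = solution-off λ { (k , refl) → j∉ (within k) }
        rows-at : ∀ t → at (suc t) · solution ≈ 0#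
        rows-at t = begin
          at (suc t) · solution                                          ≈⟨ row-at t supp ⟩
          γ⁻ t * solution (at t) + γ (suc t) * solution (at (2 ℕ.+ t))   ≈⟨ +-cong (*-congˡ (solution-at t)) (*-congˡ (solution-at (2 ℕ.+ t))) ⟩
          γ⁻ t * (s t * Q) + γ (suc t) * (- s t * (Q * γ⁻ t * γ⁻ (suc t)))  ≈⟨ +-cong left right ⟩
          s t * (Q * γ⁻ t) + - (s t * (Q * γ⁻ t))                        ≈⟨ -‿inverseʳ _ ⟩
          0#                                                             ∎
          where
          Q = prefix γ⁻ t
          left : γ⁻ t * (s t * Q) ≈ s t * (Q * γ⁻ t)
          left = trans (*-comm _ _) (*-assoc _ _ _)
          right : γ (suc t) * (- s t * (Q * γ⁻ t * γ⁻ (suc t))) ≈ - (s t * (Q * γ⁻ t))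
          right = begin
            γ (suc t) * (- s t * (Q * γ⁻ t * γ⁻ (suc t)))    ≈⟨ *-comm _ _ ⟩
            - s t * (Q * γ⁻ t * γ⁻ (suc t)) * γ (suc t)      ≈⟨ *-assoc _ _ _ ⟩
            - s t * (Q * γ⁻ t * γ⁻ (suc t) * γ (suc t))      ≈⟨ *-congˡ (*-assoc _ _ _) ⟩
            - s t * (Q * γ⁻ t * (γ⁻ (suc t) * γ (suc t)))    ≈⟨ *-congˡ (*-congˡ (trans (*-comm _ _) (γγ⁻ (suc t)))) ⟩
            - s t * (Q * γ⁻ t * 1#)                          ≈⟨ *-congˡ (*-identityʳ _) ⟩
            - s t * (Q * γ⁻ t)                               ≈⟨ -‿* _ _ ⟩
            - (s t * (Q * γ⁻ t))                             ∎
        rows : ∀ i → i ∈ S → i · solution ≈ 0#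
        rows i i∈ with onVertices? C i
        ... | yes (k , refl) = ≡.subst (λ v → v · solution ≈ 0#) (at-predecessor k) (rows-at (predecessor k))
        ... | no ¬on = row-zero i λ j ij → case onVertices? C j of λ
              { (yes on)  → contradiction (closed-vertices on i∈ (Adj-sym ij)) ¬on
              ; (no ¬on′) → solution-off ¬on′ }

      solution-0 : solution (at 0) ≈ a
      solution-0 = trans (solution-at 0) (*-identityʳ _)

      solution-1 : solution (at 1) ≈ b * γ⁻ 0
      solution-1 = trans (solution-at 1) (*-congˡ (*-identityˡ _))

    balanced⇒downer : ∀ h → order ≡ 2 ℕ.* h → holonomy ≈ σ h → Downer S (at 0)
    balanced⇒downer h order≡ hol≈σ = solution , solution∈ , λ eq → 1≉0 (trans (sym solution-0) eq)
      where open Solution h order≡ hol≈σ 1# 0#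

    delete-cycle⊑ : ∀ {x} → Ker (S ∖ C) x → Ker S x × x (at 0) ≈ 0# × x (at 1) ≈ 0#
    delete-cycle⊑ {x} (supp , Wx) = ((λ j j∉ → supp j (j∉ ∘ proj₁ ∘ ∈-fromDec⁻ (outside? S C))) , rows)
                                  , vanish (_ , refl) , vanish (_ , refl)
      where
      vanish : ∀ {j} → OnVertices C j → x j ≈ 0#
      vanish on = supp _ λ j∈ → proj₂ (∈-fromDec⁻ (outside? S C) j∈) on
      rows : ∀ i → i ∈ S → i · x ≈ 0#
      rows i i∈ with onVertices? C i
      ... | no ¬on = Wx i (∈-fromDec⁺ (outside? S C) (i∈ , ¬on))
      ... | yes on = row-zero i λ j ij → supp j λ j∈ → case ∈-fromDec⁻ (outside? S C) j∈ of λ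
              (j∈S , ¬on) → ¬on (closed-vertices on j∈S ij)

    ⊑delete-cycle : ∀ {x} → Ker S x → (∀ t → x (at t) ≈ 0#) → Ker (S ∖ C) x
    ⊑delete-cycle {x} (supp , Wx) x≈0 = supp′ , λ i i∈ → Wx i (proj₁ (∈-fromDec⁻ (outside? S C) i∈))
      where
      supp′ : ∀ j → j ∉ S ∖ C → x j ≈ 0#
      supp′ j j∉ with onVertices? C j
      ... | yes on = at≈0⇒vertices≈0 {x} x≈0 on
      ... | no ¬on = supp j λ j∈ → j∉ (∈-fromDec⁺ (outside? S C) (j∈ , ¬on))

    cut-cycle : Subspace n
    cut-cycle = ker S ∧ coordinate (at 0) ∧ coordinate (at 1)

    -- By the two-step recurrence, a kernel vector that is zero at two consecutive vertices is zero
    -- on the whole cycle.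
    dim-cut-cycle : ∀ {d} → Dim cut-cycle d → d ≡ ν (S ∖ C)
    dim-cut-cycle D = dim-unique
      (λ ((x∈ , x₀) , x₁) → ⊑delete-cycle x∈ (kernel-determined x∈ x₀ x₁))
      (λ x∈ → case delete-cycle⊑ x∈ of λ (x∈ , x₀ , x₁) → (x∈ , x₀) , x₁)
      D (dim-kernel entry (S ∖ C))

    ν-delete-≤ : ν S ≤ 2 ℕ.+ ν (S ∖ C)
    ν-delete-≤ with d , D , ν≤ ← dim-cut (coordinate (at 0)) (dim-kernel entry S)
               with e , E , d≤ ← dim-cut (coordinate (at 1)) D =
      ℕ.≤-trans ν≤ (s≤s (ℕ.≤-trans d≤ (s≤s (ℕ.≤-reflexive (dim-cut-cycle E)))))

    ν-delete-≥ : ν (S ∖ C) ≤ ν S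
    ν-delete-≥ = dim-mono (proj₁ ∘ delete-cycle⊑) (dim-kernel entry (S ∖ C)) (dim-kernel entry S)

    ν-delete-unbalanced : ∀ h → order ≡ 2 ℕ.* h → ¬ holonomy ≈ σ h → ν S ≡ ν (S ∖ C)
    ν-delete-unbalanced h order≡ hol≉ = dim-unique
      (λ x∈ → ⊑delete-cycle x∈ (kernel-vanishes h order≡ hol≉ x∈)) (proj₁ ∘ delete-cycle⊑)
      (dim-kernel entry S) (dim-kernel entry (S ∖ C))

    ν-delete-balanced : ∀ h → order ≡ 2 ℕ.* h → holonomy ≈ σ h → ν S ≡ 2 ℕ.+ ν (S ∖ C)
    ν-delete-balanced h order≡ hol≈σ = first refl (hyperplane (coordinate (at 0)) (dim-kernel entry S))
      where
      -- These two solutions show that the coordinates at 0 and at 1 are both proper cuts.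
      module E₀ = Solution h order≡ hol≈σ 1# 0#
      module E₁ = Solution h order≡ hol≈σ 0# 1#
      second : ∀ {d} → Hyperplane (ker S ∧ coordinate (at 0)) (coordinate (at 1)) d → d ≡ suc (ν (S ∖ C))
      second (flat x₁≈0 _) = contradiction (trans (sym (trans E₁.solution-1 (*-identityˡ _)))
        (x₁≈0 (E₁.solution∈ , E₁.solution-0))) (entry≉0 (Adj-sym (at-adjacent 0)))
      second (proper _ _ D) = ≡.cong suc (dim-cut-cycle D)
      first : ∀ {d} → ν S ≡ d → Hyperplane (ker S) (coordinate (at 0)) d → ν S ≡ 2 ℕ.+ ν (S ∖ C)
      first _ (flat x₀≈0 _)  = contradiction (trans (sym E₀.solution-0) (x₀≈0 E₀.solution∈)) 1≉0
      first ν≡ (proper _ _ D) = ≡.trans ν≡ (≡.cong suc (second (hyperplane (coordinate (at 1)) D)))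

-- Disjoint unions of cycles and isolated vertices

module Components (K : InvolutiveField c ℓ) {n : ℕ} (G : Graph n) where

  open Graph G
  open Subgraphs G
  open Cycles K G

  leaf⇒pendant : ∀ {S i j} → Leaf S i j → Pendant G S i
  leaf⇒pendant {S} {i} (i∈ , j∈ , ij , only) = i∈ , unique⇒∣p∣≡1 (neighbours G i ∩ S)
    (Subset.x∈p∩q⁺ (∈-fromDec⁺ (Adj? i) ij , j∈))
    λ k∈ → case Subset.x∈p∩q⁻ (neighbours G i) S k∈ of λ
      (k∈N , k∈S) → only k∈S (∈-fromDec⁻ (Adj? i) k∈N)

  pendant⇒leaf : ∀ {S i} → Pendant G S i → ∃ (Leaf S i)
  pendant⇒leaf {S} {i} (i∈ , deg≡1) with Subset.nonempty? (neighbours G i ∩ S)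
  ... | no none = contradiction (≡.trans (≡.sym deg≡1)
    (≡.trans (≡.cong ∣_∣ (Subset.Empty-unique none)) (Subset.∣⊥∣≡0 n))) λ ()
  ... | yes (j , j∈) with j∈N , j∈S ← Subset.x∈p∩q⁻ (neighbours G i) S j∈ =
    j , i∈ , j∈S , ∈-fromDec⁻ (Adj? i) j∈N , λ k∈ ik →
      ∣p∣≡1⇒unique _ deg≡1 (Subset.x∈p∩q⁺ (∈-fromDec⁺ (Adj? i) ik , k∈)) j∈

  edge-at : (C : Cycle G) → ∀ t {j} → let open Periodic C in
            CycleEdge G C (at (suc t)) j → j ≡ at t ⊎ j ≡ at (2 ℕ.+ t)
  edge-at C t (k , inj₁ (k≡ , refl)) = inj₂ (at-shift 1 (toℕ k) (suc t) (≡.trans (at-toℕ k) k≡))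
    where open Periodic C
  edge-at C t (k , inj₂ (refl , next≡)) = inj₁ (≡.trans (≡.sym (at-toℕ k)) (at-suc-injective (toℕ k) t next≡))
    where open Periodic C

  component-edge : ∀ {S C} → Component S C → ∀ {i j} → OnVertices C i → j ∈ S → Adj i j → CycleEdge G C i j
  component-edge {S} {C} comp {j = j} (k , refl) j∈ ij =
    ≡.subst (λ v → CycleEdge G C v j) (at-predecessor k)
      (edge (Component.closed comp t j∈ (≡.subst (λ v → Adj v j) (≡.sym (at-predecessor k)) ij)))
    where
    open Periodic C
    t = predecessor k
    edge : j ≡ at t ⊎ j ≡ at (2 ℕ.+ t) → CycleEdge G C (at (suc t)) j
    edge (inj₁ j≡) = _ , inj₂ (≡.sym j≡ , at-next t)
    edge (inj₂ j≡) = _ , inj₁ (refl , ≡.trans (at-next (suc t)) (≡.sym j≡))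

  cycleEdge⇒adj : ∀ C {i j} → CycleEdge G C i j → Adj i j
  cycleEdge⇒adj C (k , inj₁ (refl , refl)) = Cycle.adjacent C k
  cycleEdge⇒adj C (k , inj₂ (refl , refl)) = Adj-sym (Cycle.adjacent C k)

  cycleEdge-onVertices : ∀ C {i j} → CycleEdge G C i j → OnVertices C i × OnVertices C j
  cycleEdge-onVertices C (k , inj₁ (k≡ , next≡)) = (k , k≡) , (_ , next≡)
  cycleEdge-onVertices C (k , inj₂ (k≡ , next≡)) = (_ , next≡) , (k , k≡)

  all-on-component : ∀ {S C D} → Component S C → D Within S → ∀ {l} → OnVertices C (Cycle.vertex D l) →
                     ∀ k → OnVertices C (Cycle.vertex D k)
  all-on-component {S} {C} {D} comp D⊆S {l} on k = ≡.subst (OnVertices C) arrive (go s)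
    where
    open Periodic D
    open Cycle D using (order)
    -- Counted from `l`, this ends at index `k` + `order`, whichever of `k` and `l` is larger.
    s = toℕ k ℕ.+ (order ℕ.∸ toℕ l)
    go : ∀ s → OnVertices C (at (s ℕ.+ toℕ l))
    go zero    = ≡.subst (OnVertices C) (≡.sym (at-toℕ l)) on
    go (suc s) = Component.closed-vertices comp (go s) (D⊆S _) (at-adjacent (s ℕ.+ toℕ l))
    arrive : at (s ℕ.+ toℕ l) ≡ Cycle.vertex D k
    arrive = ≡.trans (≡.cong at (≡.trans (ℕ.+-assoc (toℕ k) _ (toℕ l))
        (≡.cong (toℕ k ℕ.+_) (ℕ.m∸n+n≡m (ℕ.<⇒≤ (Fin.toℕ<n l))))))
      (≡.trans (at-period (toℕ k)) (at-toℕ k))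

  edges-in-component : ∀ {S C D} → Component S C → D Within S → ∀ {k l} →
    Cycle.vertex C k ≡ Cycle.vertex D l → ∀ {i j} → CycleEdge G D i j → CycleEdge G C i j
  edges-in-component {S} {C} {D} comp D⊆S k≡l e
    with (p , refl) , (q , refl) ← cycleEdge-onVertices D e =
    component-edge comp (all-on-component {C = C} {D} comp D⊆S (_ , k≡l) p) (D⊆S q) (cycleEdge⇒adj D e)

  -- If the two cycles meet, each stays on the vertices of the other, and without chords they then
  -- have the same edges.
  components-disjoint : ∀ {S C D} → Component S C → Component S D → ¬ SameCycle G C D → Disjoint G C D
  components-disjoint {S} {C} {D} compC compD different k l k≡l = different λ i j → mk⇔
    (edges-in-component {C = D} {C} compD (Component.within compC) (≡.sym k≡l))
    (edges-in-component {C = C} {D} compC (Component.within compD) k≡l)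

  ∖⊆ : ∀ S C → (S ∖ C) ⊆ S
  ∖⊆ S C = proj₁ ∘ ∈-fromDec⁻ (outside? S C)

  ∖⊆remove : ∀ S C k → (S ∖ C) ⊆ S - Cycle.vertex C k
  ∖⊆remove S C k j∈ with j∈S , ¬on ← ∈-fromDec⁻ (outside? S C) j∈ =
    x∈p∧x≢y⇒x∈p-y j∈S λ j≡ → ¬on (k , ≡.sym j≡)

  ∣∖∣< : ∀ S C → C Within S → ∣ S ∖ C ∣ < ∣ S ∣
  ∣∖∣< S C C⊆S = ℕ.≤-trans (s≤s (Subset.p⊆q⇒∣p∣≤∣q∣ (∖⊆remove S C zero))) (x∈p⇒∣p-x∣<∣p∣ (C⊆S zero))

  component-off : ∀ {S C} → Component S C → ∀ {i j} → i ∈ S ∖ C → j ∈ S → Adj i j → j ∈ S ∖ C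
  component-off {S} {C} comp i∈ j∈ ij with i∈S , ¬on ← ∈-fromDec⁻ (outside? S C) i∈ =
    ∈-fromDec⁺ (outside? S C) (j∈ , λ on → ¬on (Component.closed-vertices comp on i∈S (Adj-sym ij)))

  Leafless : Subset n → Set
  Leafless S = ∀ {i j} → ¬ Leaf S i j

  TwoNeighbours : Subset n → Set
  TwoNeighbours S = ∀ {x} (o : OnCycle S x) {c} → c ∈ S → Adj x c → c ≡ OnCycle.a o ⊎ c ≡ OnCycle.b o

  two-neighbours-mono : ∀ {S T} → T ⊆ S → TwoNeighbours S → TwoNeighbours T
  two-neighbours-mono {S} {T} T⊆S two o c∈ = two (onCycle-mono {S} {T} T⊆S o) (T⊆S c∈)

  leafless-mono : ∀ {S T} → T ⊆ S → (∀ {i j} → i ∈ T → j ∈ S → Adj i j → j ∈ T) → Leafless S → Leafless T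
  leafless-mono T⊆S closed leafless (i∈ , j∈ , ij , only) =
    leafless (T⊆S i∈ , T⊆S j∈ , ij , λ k∈ ik → only (closed i∈ k∈ ik) ik)

  isolated-off : ∀ {S i} → Isolated S i → ∀ {j k} → j ∈ S - i → k ∈ S → Adj j k → k ∈ S - i
  isolated-off {S} (_ , alone) j∈ k∈ jk = x∈p∧x≢y⇒x∈p-y k∈
    λ { refl → alone (∈-remove⁻ S j∈) (Adj-sym jk) }

  -- The neighbours `a` and `b` chosen in `at-onCycle` are the two cycle neighbours, so `two` is the
  -- closure condition itself.
  component : ∀ {S} → TwoNeighbours S → ∀ C → C Within S → Component S C
  component two C C⊆S = record { within = C⊆S ; closed = λ t → two (Periodic.at-onCycle C C⊆S t) }

  open CyclesAndIsolatedVertices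

  no-cycles : ∀ {S} → (∀ {i} → i ∉ S) → CyclesAndIsolatedVertices G S 0
  no-cycles ∉S = record { cycle = λ () ; within = λ () ; disjoint = λ () ; covers = λ _ _ i∈ → contradiction i∈ ∉S }

  add-isolated : ∀ {S i k} → Isolated S i → CyclesAndIsolatedVertices G (S - i) k → CyclesAndIsolatedVertices G S k
  add-isolated {S} {i} (i∈ , alone) cs = record
    { cycle    = cycle cs
    ; within   = λ a l → ∈-remove⁻ S (within cs a l)
    ; disjoint = disjoint cs
    ; covers   = λ p q p∈ q∈ pq → covers cs p q
        (x∈p∧x≢y⇒x∈p-y p∈ λ { refl → alone q∈ pq })
        (x∈p∧x≢y⇒x∈p-y q∈ λ { refl → alone p∈ (Adj-sym pq) }) pq
    }

  add-cycle : ∀ {S C k} → Component S C → CyclesAndIsolatedVertices G (S ∖ C) k → CyclesAndIsolatedVertices G S (suc k)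
  add-cycle {S} {C} {k} comp cs = record { cycle = cycle′ ; within = within′ ; disjoint = disjoint′ ; covers = covers′ }
    where
    cycle′ : Fin (suc k) → Cycle G
    cycle′ zero    = C
    cycle′ (suc a) = cycle cs a
    within′ : ∀ a l → Cycle.vertex (cycle′ a) l ∈ S
    within′ zero    l = Component.within comp l
    within′ (suc a) l = ∖⊆ S C (within cs a l)
    off : ∀ a p q → Cycle.vertex C p ≢ Cycle.vertex (cycle cs a) q
    off a p q eq = proj₂ (∈-fromDec⁻ (outside? S C) (within cs a q)) (p , eq)
    disjoint′ : ∀ a b → a ≢ b → Disjoint G (cycle′ a) (cycle′ b)
    disjoint′ zero    zero    a≢b = contradiction refl a≢b
    disjoint′ zero    (suc b) _ p q eq = off b p q eq
    disjoint′ (suc a) zero    _ p q eq = off a q p (≡.sym eq)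
    disjoint′ (suc a) (suc b) a≢b = disjoint cs a b (a≢b ∘ ≡.cong suc)
    covers′ : ∀ i j → i ∈ S → j ∈ S → Adj i j → ∃[ a ] CycleEdge G (cycle′ a) i j
    covers′ i j i∈ j∈ ij with onVertices? C i
    ... | yes on = zero , component-edge comp on j∈ ij
    ... | no ¬on with i∈′ ← ∈-fromDec⁺ (outside? S C) (i∈ , ¬on)
                 with a , e ← covers cs i j i∈′ (component-off comp i∈′ j∈ ij) ij = suc a , e

  first-component : ∀ {S k} (cs : CyclesAndIsolatedVertices G S (suc k)) → Component S (cycle cs zero)
  first-component {S} cs = record { within = within cs zero ; closed = closed }
    where
    C = cycle cs zero
    open Periodic C
    closed : ∀ t {j} → j ∈ S → Adj (at (suc t)) j → j ≡ at t ⊎ j ≡ at (2 ℕ.+ t)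
    closed t {j} j∈ e with covers cs _ j (within cs zero _) j∈ e
    ... | zero  , edge = edge-at C t edge
    ... | suc a , edge with l , eq ← proj₁ (cycleEdge-onVertices (cycle cs (suc a)) edge) =
      contradiction eq (disjoint cs (suc a) zero (λ ()) l _)

  remaining-cycles : ∀ {S k} (cs : CyclesAndIsolatedVertices G S (suc k)) →
                     CyclesAndIsolatedVertices G (S ∖ cycle cs zero) k
  remaining-cycles {S} {k} cs = record
    { cycle    = cycle cs ∘ suc
    ; within   = λ a l → ∈-fromDec⁺ (outside? S C) (within cs (suc a) l ,
                   λ (p , eq) → disjoint cs zero (suc a) (λ ()) p l eq)
    ; disjoint = λ a b a≢b → disjoint cs (suc a) (suc b) (a≢b ∘ Fin.suc-injective)
    ; covers   = covers′
    }
    where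
    C = cycle cs zero
    covers′ : ∀ i j → i ∈ S ∖ C → j ∈ S ∖ C → Adj i j → ∃[ a ] CycleEdge G (cycle cs (suc a)) i j
    covers′ i j i∈ j∈ ij with covers cs i j (∖⊆ S C i∈) (∖⊆ S C j∈) ij
    ... | zero , edge  = contradiction (proj₁ (cycleEdge-onVertices C edge)) (proj₂ (∈-fromDec⁻ (outside? S C) i∈))
    ... | suc a , edge = a , edge

-- Tightness of the whole graph and the three conditions

module RankDifference (K : InvolutiveField c ℓ) {n : ℕ} (G : Graph n)
                      (weightΓ weightΦ : Weights.Weight K G)
                      (unitΓ : ∀ {i j} → Graph.Adj G i j → InvolutiveField._≈_ K
                         (Weights.Weight.entry weightΓ i j) (InvolutiveField.1# K)) where

  open InvolutiveField K using (_≈_; 1#; trans; sym; *-cong; *-identityˡ)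
    renaming (refl to ≈-refl)
  open Dimension (InvolutiveField.field′ K) using (dim-unique; dim-kernel)
  open Graph G
  open Subgraphs G
  open Shapes G
  open Cycles K G
  open Components K G
  open Tightness K G weightΓ weightΦ
  open CyclesAndIsolatedVertices
  open ℕ.≤-Reasoning

  holonomyΓ : ∀ C → CycleGain.holonomy weightΓ C ≈ 1#
  holonomyΓ C = go (Cycle.order C)
    where
    open CycleGain weightΓ C
    go : ∀ t → prefix γ t ≈ 1#
    go zero    = ≈-refl
    go (suc t) = trans (*-cong (go t) (unitΓ (Periodic.at-adjacent C t))) (*-identityˡ 1#)

  Unbalanced : Cycle G → Set _
  Unbalanced C = ∃[ h ] Cycle.order C ≡ 2 ℕ.* h × ¬ CycleGain.holonomy weightΦ C ≈ σ h

  halve : ∀ {p} → 4 ∣ p → ∃[ m ] p ≡ 2 ℕ.* (2 ℕ.* m)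
  halve (divides m refl) = m , ≡.trans (ℕ.*-comm m 4) (ℕ.*-assoc 2 2 m)

  -- Isolated vertices and cycles are peeled off. Each cycle lowers `τ` by at least one and ν(G) by
  -- at most two, which yields bounds that pin `k` to `τ S` when `S` is tight.
  decompose : ∀ S → Leafless S → TwoNeighbours S →
    ∃[ k ] CyclesAndIsolatedVertices G S k × k ≤ τ S × Γ.ν S ≤ Φ.ν S ℕ.+ (k ℕ.+ k)
  decompose = subset-induction _ go
    where
    P : Subset n → Set
    P S = Leafless S → TwoNeighbours S →
      ∃[ k ] CyclesAndIsolatedVertices G S k × k ≤ τ S × Γ.ν S ≤ Φ.ν S ℕ.+ (k ℕ.+ k)
    go : ∀ S → (∀ T → ∣ T ∣ < ∣ S ∣ → P T) → P S
    go S ih leafless two with shape S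
    ... | empty ∉S = 0 , no-cycles ∉S , z≤n , ℕ.≤-trans (ℕ.≤-reflexive (Γ.ν-empty S ∉S)) z≤n
    ... | leaf l   = contradiction l leafless
    ... | isolated {i} iso@(i∈ , _)
          with k , cs , k≤ , ν≤ ← ih (S - i) (x∈p⇒∣p-x∣<∣p∣ i∈)
                 (leafless-mono (∈-remove⁻ S) (isolated-off iso) leafless)
                 (two-neighbours-mono {S} {S - i} (∈-remove⁻ S) two) =
      k , add-isolated iso cs , ℕ.≤-trans k≤ (τ-remove S i) , (begin
        Γ.ν S                                ≡⟨ Γ.ν-isolated S iso ⟩
        suc (Γ.ν (S - i))                    ≤⟨ s≤s ν≤ ⟩
        suc (Φ.ν (S - i)) ℕ.+ (k ℕ.+ k)      ≡⟨ ≡.cong (ℕ._+ (k ℕ.+ k)) (Φ.ν-isolated S iso) ⟨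
        Φ.ν S ℕ.+ (k ℕ.+ k)                  ∎)
    ... | cyclic C C⊆S
          with comp ← component two C C⊆S
          with k , cs , k≤ , ν≤ ← ih (S ∖ C) (∣∖∣< S C C⊆S)
                 (leafless-mono (∖⊆ S C) (component-off comp) leafless)
                 (two-neighbours-mono {S} {S ∖ C} (∖⊆ S C) two) =
      suc k , add-cycle comp cs
        , ℕ.≤-trans (s≤s (ℕ.≤-trans k≤ (τ-mono {S - Cycle.vertex C zero} {S ∖ C} (∖⊆remove S C zero))))
            (τ-onCycle (Periodic.vertex-onCycle C C⊆S zero))
        , (begin
        Γ.ν S                                ≤⟨ CycleKernel.ν-delete-≤ weightΓ S C comp ⟩
        2 ℕ.+ Γ.ν (S ∖ C)                    ≤⟨ ℕ.+-monoʳ-≤ 2 ν≤ ⟩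
        2 ℕ.+ (Φ.ν (S ∖ C) ℕ.+ (k ℕ.+ k))    ≡⟨ double-suc _ k ⟨
        Φ.ν (S ∖ C) ℕ.+ (suc k ℕ.+ suc k)    ≤⟨ ℕ.+-monoˡ-≤ _ (CycleKernel.ν-delete-≥ weightΦ S C comp) ⟩
        Φ.ν S ℕ.+ (suc k ℕ.+ suc k)          ∎)

  -- `keeps` is what transfers statements about cycles of the reduced graph to all cycles of the
  -- original one.
  record Reduction (S : Subset n) : Set where
    field
      {T}      : Subset n
      chain    : Star (δ-Transformation G) S T
      pendants : ∀ i → ¬ Pendant G T i
      tight    : Tight T
      τ≡       : τ S ≡ τ T
      keeps    : ∀ C → C Within S → C Within T

  reduce : ∀ S → Tight S → Reduction S
  reduce = subset-induction _ go
    where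
    go : ∀ S → (∀ T → ∣ T ∣ < ∣ S ∣ → Tight T → Reduction T) → Tight S → Reduction S
    go S ih tight with Fin.any? (λ i → (i ∈? S) ×-dec (degree G S i ℕ.≟ 1))
    ... | no none = record { chain = ε ; pendants = λ i p → none (i , p) ; tight = tight
                           ; τ≡ = refl ; keeps = λ _ → id }
    ... | yes (i , pendant) with j , l@(i∈ , j∈ , ij , _) ← pendant⇒leaf pendant = record
      { chain    = delete pendant j∈ ij ◅ chain
      ; pendants = pendants
      ; tight    = tightT
      ; τ≡       = ≡.trans (AtLeaf.τ≡ l tight) τ≡
      ; keeps    = λ C C⊆S → keeps C λ k →
          x∈p∧x≢y⇒x∈p-y (x∈p∧x≢y⇒x∈p-y (C⊆S k)
            (λ { refl → AtLeaf.leaf-not-onCycle l tight (Periodic.vertex-onCycle C C⊆S k) }))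
            (λ { refl → AtLeaf.nbr-not-onCycle l tight (Periodic.vertex-onCycle C C⊆S k) })
      }
      where
      open Reduction (ih (S - i - j) (∣remove₂∣< S i∈ (leaf-nbr∈ l)) (AtLeaf.remains-tight l tight))
        renaming (tight to tightT)

  -- The downer vector of G is nonzero on the cycle, which forces 4 to divide the order. A balanced
  -- cycle would make its vertex a downer of Φ, where it is a Parter vertex.
  tight-cycle : ∀ {S C} → Tight S → Component S C → Unbalanced C × 4 ∣ Cycle.order C
  tight-cycle {S} {C} tight comp = unbalanced (halve four) , four
    where
    open Periodic C
    on : OnCycle S (at 0)
    on = vertex-onCycle (Component.within comp) (0 mod Cycle.order C)
    four′ : Γ.Downer S (at 0) → 4 ∣ Cycle.order C
    four′ (z , z∈ , z≉0) = CycleKernel.balanced-order weightΓ S C comp (holonomyΓ C) {z} z∈ z≉0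
    four : 4 ∣ Cycle.order C
    four = four′ (AtCycle.downerΓ on tight)
    unbalanced : ∃[ m ] Cycle.order C ≡ 2 ℕ.* (2 ℕ.* m) → Unbalanced C
    unbalanced (m , order≡) = 2 ℕ.* m , order≡ , λ hol≈σ → Φ.parter⇒¬downer S
      (AtCycle.parterΦ on tight)
      (CycleKernel.balanced⇒downer weightΦ S C comp (2 ℕ.* m) order≡ hol≈σ)

  Conditions : Set _
  Conditions = CyclesPairwiseDisjoint G × (∀ C → Unbalanced C × 4 ∣ Cycle.order C)
             × (∃[ S ] ∃[ k ] Crucial G S × k ≡ τ ⊤ × CyclesAndIsolatedVertices G S k)

  tight⇒conditions : Tight ⊤ → Conditions
  tight⇒conditions tight⊤ = conditions (reduce ⊤ tight⊤)
    where
    conditions : Reduction ⊤ → Conditions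
    conditions record { T = T ; chain = chain ; pendants = pendants ; tight = tight ; τ≡ = τ≡ ; keeps = keeps }
      with leafless ← (λ {i} {j} (l : Leaf T i j) → pendants i (leaf⇒pendant l))
      with two ← tight⇒two-neighbours T tight leafless
      with k , cs , k≤ , ν≤ ← decompose T leafless two
      = (λ C D → components-disjoint (comp C) (comp D))
      , (λ C → tight-cycle tight (comp C))
      , T , k , (chain , pendants)
      -- Tightness of `T` turns the nullity bound into `τ T` ≤ `k`, the reverse of `k≤`.
      , ≡.trans (ℕ.≤-antisym k≤ (double-cancel (Φ.ν T) (ℕ.≤-trans (ℕ.≤-reflexive (≡.sym tight)) ν≤))) (≡.sym τ≡)
      , cs
      where
      comp : ∀ C → Component T C
      comp C = component two C (keeps C λ _ → Subset.∈⊤)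

  ν-δ : ∀ {S T} → Star (δ-Transformation G) S T → Γ.ν T ≡ Γ.ν S × Φ.ν T ≡ Φ.ν S
  ν-δ ε = refl , refl
  ν-δ {S} (delete {i} {j} pendant j∈ ij ◅ chain)
    with j′ , l@(_ , _ , _ , only) ← pendant⇒leaf pendant
    with refl ← only j∈ ij
    with Γ≡ , Φ≡ ← ν-δ chain = ≡.trans Γ≡ (Γ.ν-leaf S l) , ≡.trans Φ≡ (Φ.ν-leaf S l)

  ν-edgeless : ∀ {S} → CyclesAndIsolatedVertices G S 0 → Γ.ν S ≡ Φ.ν S
  ν-edgeless {S} cs = dim-unique
    (λ (supp , _) → supp , λ i i∈ → Φ.row-zero i λ j ij → supp j λ j∈ → no-edge i∈ j∈ ij)
    (λ (supp , _) → supp , λ i i∈ → Γ.row-zero i λ j ij → supp j λ j∈ → no-edge i∈ j∈ ij)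
    (dim-kernel (Weights.Weight.entry weightΓ) S) (dim-kernel (Weights.Weight.entry weightΦ) S)
    where
    no-edge : ∀ {i j} → i ∈ S → j ∈ S → ¬ Adj i j
    no-edge i∈ j∈ ij with () ← proj₁ (covers cs _ _ i∈ j∈ ij)

  -- Each cycle contributes 2 to ν(G), where trivial gain and order 4m mean balance, and nothing to
  -- ν(Φ); the isolated vertices contribute equally to both.
  ν-cycles : (∀ C → Unbalanced C × 4 ∣ Cycle.order C) → ∀ k {S} → CyclesAndIsolatedVertices G S k →
             Γ.ν S ≡ Φ.ν S ℕ.+ (k ℕ.+ k)
  ν-cycles _ zero cs = ≡.trans (ν-edgeless cs) (≡.sym (ℕ.+-identityʳ _))
  ν-cycles good (suc k) {S} cs = go (good C)
    where
    C = cycle cs zero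
    comp = first-component cs
    go : Unbalanced C × 4 ∣ Cycle.order C → Γ.ν S ≡ Φ.ν S ℕ.+ (suc k ℕ.+ suc k)
    go ((h , order≡ , hol≉) , four) with m , order≡′ ← halve four = begin-equality
      Γ.ν S                                ≡⟨ CycleKernel.ν-delete-balanced weightΓ S C comp (2 ℕ.* m) order≡′
                                                (trans (holonomyΓ C) (sym (σ-even m))) ⟩
      2 ℕ.+ Γ.ν (S ∖ C)                    ≡⟨ ≡.cong (2 ℕ.+_) (ν-cycles good k (remaining-cycles cs)) ⟩
      2 ℕ.+ (Φ.ν (S ∖ C) ℕ.+ (k ℕ.+ k))    ≡⟨ double-suc _ k ⟨
      Φ.ν (S ∖ C) ℕ.+ (suc k ℕ.+ suc k)    ≡⟨ ≡.cong (ℕ._+ _) (CycleKernel.ν-delete-unbalanced weightΦ S C comp h order≡ hol≉) ⟨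
      Φ.ν S ℕ.+ (suc k ℕ.+ suc k)          ∎

  conditions⇒tight : Conditions → Tight ⊤
  conditions⇒tight (_ , good , S , k , (chain , _) , refl , cs) with Γ≡ , Φ≡ ← ν-δ chain =
    ≡.trans (≡.sym Γ≡) (≡.trans (ν-cycles good k cs) (≡.cong (ℕ._+ (k ℕ.+ k)) Φ≡))

-- Complex gains as Hermitian weights

module ComplexWeights (ℝ : Reals c ℓ) where

  open Complex ℝ
  private
    module ℝ = Reals ℝ
    module ℝₚ = RingProperties ℝ.ring
    module 𝔽 = DiscreteField ℂ-field

  conjugate-* : ∀ z w → conj (z * w) ≈ conj z * conj w
  conjugate-* (a +i b) (d +i e) =
      ℝ.+-congˡ (ℝ.-‿cong (ℝ.sym (ℝ.trans (ℝ.sym (ℝₚ.-‿distribˡ-* b _))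
        (ℝ.trans (ℝ.-‿cong (ℝ.sym (ℝₚ.-‿distribʳ-* b e))) (ℝₚ.-‿involutive _)))))
    , ℝ.trans (ℝ.sym (ℝₚ.-‿+-comm _ _)) (ℝ.+-cong (ℝₚ.-‿distribʳ-* a e) (ℝₚ.-‿distribˡ-* b d))

  2≉0 : ¬ 1ℂ + 1ℂ ≈ 0ℂ
  2≉0 (1+1≈0 , _) = irrefl (ℝ.sym 1+1≈0) (<-trans ℝ.0<1 (<-respˡ-≈ (ℝ.+-identityʳ ℝ.1#) (ℝ.+-monoʳ-< ℝ.1# ℝ.0<1)))
    where open ℝ.Order using (irrefl; <-respˡ-≈) renaming (trans to <-trans)

  ℂ-involutive : InvolutiveField c ℓ
  ℂ-involutive = record
    { field′          = ℂ-field
    ; conj            = conj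
    ; conj-cong       = λ (p , q) → p , ℝ.-‿cong q
    ; conj-+          = λ z w → ℝ.refl , ℝ.sym (ℝₚ.-‿+-comm _ _)
    ; conj-*          = conjugate-*
    ; conj-0          = ℝ.refl , ℝₚ.-0#≈0#
    ; conj-involutive = λ z → ℝ.refl , ℝₚ.-‿involutive _
    ; 2≉0             = 2≉0
    }

  conj-0 : conj 0ℂ ≈ 0ℂ
  conj-0 = ℝ.refl , ℝₚ.-0#≈0#

  unimodular-inverse : ∀ {z} → Unimodular z → z * conj z ≈ 1ℂ
  unimodular-inverse {a +i b} ∣z∣≈1 =
      ℝ.trans (ℝ.+-congˡ (ℝ.trans (ℝ.-‿cong (ℝ.sym (ℝₚ.-‿distribʳ-* b b))) (ℝₚ.-‿involutive _))) ∣z∣≈1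
    , ℝ.trans (ℝ.+-cong (ℝ.sym (ℝₚ.-‿distribʳ-* a b)) (ℝ.*-comm b a)) (ℝ.-‿inverseˡ _)

  open Weights using (Weight)

  graphWeight : (G : Graph n) → Weight ℂ-involutive G
  graphWeight {n} G = record { entry = M ; hermitian = hermitian ; off-edge = off-edge ; on-edge = on-edge }
    where
    open Graph G
    M : Fin n → Fin n → ℂ
    M = adjacencyMatrix ℝ G
    hermitian : ∀ i j → M j i ≈ conj (M i j)
    hermitian i j with Adj? i j | Adj? j i
    ... | yes _ | yes _ = ℝ.refl , ℝ.sym ℝₚ.-0#≈0#
    ... | no _  | no _  = 𝔽.sym conj-0
    ... | yes e | no ¬e = contradiction (Adj-sym e) ¬e
    ... | no ¬e | yes e = contradiction (Adj-sym e) ¬e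
    off-edge : ∀ {i j} → ¬ Adj i j → M i j ≈ 0ℂ
    off-edge {i} {j} ¬e with Adj? i j
    ... | yes e = contradiction e ¬e
    ... | no _  = 𝔽.refl
    on-edge : ∀ {i j} → Adj i j → M i j * M j i ≈ 1ℂ
    on-edge {i} {j} e with Adj? i j | Adj? j i
    ... | yes _ | yes _ = 𝔽.*-identityˡ 1ℂ
    ... | no ¬e | _     = contradiction e ¬e
    ... | _     | no ¬e = contradiction (Adj-sym e) ¬e

  graphWeight-unit : (G : Graph n) {i j : Fin n} → Graph.Adj G i j → adjacencyMatrix ℝ G i j ≈ 1ℂ
  graphWeight-unit G {i} {j} e with Graph.Adj? G i j
  ... | yes _ = 𝔽.refl
  ... | no ¬e = contradiction e ¬e

  gainEntry : (Φ : GainGraph ℝ n) {i j : Fin n} → GainGraph.Adj Φ i j →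
              gainAdjacencyMatrix ℝ Φ i j ≈ GainGraph.gain Φ i j
  gainEntry Φ {i} {j} e with GainGraph.Adj? Φ i j
  ... | yes _ = 𝔽.refl
  ... | no ¬e = contradiction e ¬e

  gainWeight : (Φ : GainGraph ℝ n) → Weight ℂ-involutive (GainGraph.graph Φ)
  gainWeight {n} Φ = record { entry = M ; hermitian = hermitian ; off-edge = off-edge ; on-edge = on-edge }
    where
    open GainGraph Φ
    M : Fin n → Fin n → ℂ
    M = gainAdjacencyMatrix ℝ Φ
    hermitian : ∀ i j → M j i ≈ conj (M i j)
    hermitian i j with Adj? i j | Adj? j i
    ... | yes e | yes _ = gain-conj e
    ... | no _  | no _  = 𝔽.sym conj-0
    ... | yes e | no ¬e = contradiction (Adj-sym e) ¬e
    ... | no ¬e | yes e = contradiction (Adj-sym e) ¬e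
    off-edge : ∀ {i j} → ¬ Adj i j → M i j ≈ 0ℂ
    off-edge {i} {j} ¬e with Adj? i j
    ... | yes e = contradiction e ¬e
    ... | no _  = 𝔽.refl
    on-edge : ∀ {i j} → Adj i j → M i j * M j i ≈ 1ℂ
    on-edge {i} {j} e = 𝔽.trans (𝔽.*-cong (gainEntry Φ e) (𝔽.trans (gainEntry Φ (Adj-sym e)) (gain-conj e)))
      (unimodular-inverse (gain-unimodular e))

  module GainProduct (Φ : GainGraph ℝ n) (C : Cycle (GainGraph.graph Φ)) where

    open GainGraph Φ
    open Cycles ℂ-involutive graph using (module CycleGain)
    open CycleGain (gainWeight Φ) C
    open Subgraphs.Periodic graph C
    open Cycle C
    private module Product = MonoidSum 𝔽.*-commutativeMonoid

    -- `Product.sum` unfolds from the first factor and `prefix` from the last; this reconciles them.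
    prefix-unshift : ∀ (f : ℕ → ℂ) m → prefix f (suc m) ≈ f 0 * prefix (f ∘ suc) m
    prefix-unshift f zero    = 𝔽.*-comm _ _
    prefix-unshift f (suc m) = 𝔽.trans (𝔽.*-congʳ (prefix-unshift f m)) (𝔽.*-assoc (f 0) (prefix (f ∘ suc) m) (f (suc m)))

    product≈prefix : ∀ {m} (g : Fin m → ℂ) (f : ℕ → ℂ) → (∀ k → g k ≈ f (toℕ k)) → Product.sum g ≈ prefix f m
    product≈prefix {zero}  g f g≈f = 𝔽.refl
    product≈prefix {suc m} g f g≈f = 𝔽.trans
      (𝔽.*-cong (g≈f zero) (product≈prefix (g ∘ suc) (f ∘ suc) (g≈f ∘ suc)))
      (𝔽.sym (prefix-unshift f m))

    cycleGain≈holonomy : cycleGain ℝ Φ C ≈ holonomy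
    cycleGain≈holonomy = product≈prefix {order} _ γ λ k → 𝔽.sym (𝔽.trans
      (gainEntry Φ (at-adjacent (toℕ k)))
      (𝔽.reflexive (≡.cong (λ v → gain v (vertex (next k))) (at-toℕ k))))

-- From nullities back to ranks

module Conclusion (ℝ : Reals c ℓ) {n : ℕ} (Φ : GainGraph ℝ n) where

  open Complex ℝ
  open ComplexWeights ℝ
  private module 𝔽 = DiscreteField ℂ-field
  G = GainGraph.graph Φ
  open Subgraphs G using (τ)
  open Dimension ℂ-field using (rank+nullity)
  open Rank ℂ-field using (rank-exists)
  open Tightness ℂ-involutive G (graphWeight G) (gainWeight Φ) using (Tight; module Γ; module Φ)
  open RankDifference ℂ-involutive G (graphWeight G) (gainWeight Φ) (graphWeight-unit G)

  -- The graph induced on all vertices is a different record with the same edges, so monotonicity is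
  -- applied in both directions.
  θ≡τ : θ G ≡ + τ ⊤
  θ≡τ = ≡.trans (θ≡cyclomatic G) (≡.cong +_ (ℕ.≤-antisym
    (cyclomatic-mono G (induced G ⊤) λ e → Subset.∈⊤ , Subset.∈⊤ , e)
    (cyclomatic-mono (induced G ⊤) G λ (_ , _ , e) → e)))

  rankΓ+νΓ : graphRank ℝ G ℕ.+ Γ.ν ⊤ ≡ n
  rankΓ+νΓ = rank+nullity _ (proj₂ (rank-exists (adjacencyMatrix ℝ G)))

  rankΦ+νΦ : gainGraphRank ℝ Φ ℕ.+ Φ.ν ⊤ ≡ n
  rankΦ+νΦ = rank+nullity _ (proj₂ (rank-exists (gainAdjacencyMatrix ℝ Φ)))

  RankEquation : Set
  RankEquation = + gainGraphRank ℝ Φ ≡ + graphRank ℝ G ℤ.+ + 2 ℤ.* θ G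

  rank-sides : + graphRank ℝ G ℤ.+ + 2 ℤ.* θ G ≡ + (graphRank ℝ G ℕ.+ (τ ⊤ ℕ.+ τ ⊤))
  rank-sides = ≡.trans (≡.cong (λ z → + graphRank ℝ G ℤ.+ + 2 ℤ.* z) θ≡τ)
    (≡.cong (λ z → + graphRank ℝ G ℤ.+ z) (≡.trans (≡.sym (ℤ.pos-* 2 (τ ⊤)))
      (≡.cong (λ k → + (τ ⊤ ℕ.+ k)) (ℕ.+-identityʳ (τ ⊤)))))

  private
    -- r + ν = n on both sides turns a surplus of rank into a deficit of nullity.
    exchange : ∀ {r r′ ν ν′ s} → r ℕ.+ ν ≡ n → r′ ℕ.+ ν′ ≡ n → r′ ≡ r ℕ.+ s → ν ≡ ν′ ℕ.+ s
    exchange {r} {r′} {ν} {ν′} {s} r+ν r′+ν′ refl = ℕ.+-cancelˡ-≡ r ν (ν′ ℕ.+ s)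
      (≡.trans r+ν (≡.trans (≡.sym r′+ν′) (≡.trans (ℕ.+-assoc r s ν′) (≡.cong (r ℕ.+_) (ℕ.+-comm s ν′)))))

  rank⇒tight : RankEquation → Tight ⊤
  rank⇒tight eq = exchange rankΓ+νΓ rankΦ+νΦ (ℤ.+-injective (≡.trans eq rank-sides))

  tight⇒rank : Tight ⊤ → RankEquation
  tight⇒rank tight = ≡.trans (≡.cong +_ (exchange
    (≡.trans (ℕ.+-comm (Φ.ν ⊤) _) rankΦ+νΦ) (≡.trans (ℕ.+-comm (Γ.ν ⊤) _) rankΓ+νΓ) tight)) (≡.sym rank-sides)

  Good : Set _
  Good = (C : Cycle G) → TypeB ℝ Φ C × 4 ∣ Cycle.order C

  unbalanced⇒typeB : ∀ {C} → Unbalanced C → TypeB ℝ Φ C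
  unbalanced⇒typeB {C} (h , order≡ , hol≉) = h , order≡ , λ eq → hol≉ (𝔽.trans (𝔽.sym (GainProduct.cycleGain≈holonomy Φ C)) eq)

  typeB⇒unbalanced : ∀ {C} → TypeB ℝ Φ C → Unbalanced C
  typeB⇒unbalanced {C} (h , order≡ , gain≉) = h , order≡ , λ eq → gain≉ (𝔽.trans (GainProduct.cycleGain≈holonomy Φ C) eq)

  Conclusions : Set _
  Conclusions = CyclesPairwiseDisjoint G × Good
              × (∃[ S ] ∃[ k ] Crucial G S × + k ≡ θ G × CyclesAndIsolatedVertices G S k)

  conditions⇒conclusions : Conditions → Conclusions
  conditions⇒conclusions (disjoint , good , S , k , crucial , k≡ , cs) =
    disjoint , (λ C → unbalanced⇒typeB {C} (proj₁ (good C)) , proj₂ (good C)) ,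
    S , k , crucial , ≡.trans (≡.cong +_ k≡) (≡.sym θ≡τ) , cs

  conclusions⇒conditions : Conclusions → Conditions
  conclusions⇒conditions (disjoint , good , S , k , crucial , k≡ , cs) =
    disjoint , (λ C → typeB⇒unbalanced {C} (proj₁ (good C)) , proj₂ (good C)) ,
    S , k , crucial , ℤ.+-injective (≡.trans k≡ θ≡τ) , cs

  rank-equation⇔conclusions : RankEquation ⇔ Conclusions
  rank-equation⇔conclusions = mk⇔
    (λ eq → conditions⇒conclusions (tight⇒conditions (rank⇒tight eq)))
    (λ cs → tight⇒rank (conditions⇒tight (conclusions⇒conditions cs)))

open import Data.Integer.Base using (_+_; _*_)

theorem4p9 : ∀ {c ℓ : Level} (ℝ : Reals c ℓ) {n : ℕ} (Φ : GainGraph ℝ n) →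
    let G = GainGraph.graph Φ in
    + gainGraphRank ℝ Φ ≡ + graphRank ℝ G + + 2 * θ G
    ⇔ ( CyclesPairwiseDisjoint G
    × ((C : Cycle G) → TypeB ℝ Φ C × 4 ∣ Cycle.order C)
    × (∃[ S ] ∃[ k ] Crucial G S × + k ≡ θ G × CyclesAndIsolatedVertices G S k))
theorem4p9 ℝ Φ = Conclusion.rank-equation⇔conclusions ℝ Φ
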